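{- Let $a,b\in\mathbb{Z}$ be such that $x^3-ax+b$ is irreducible over $\mathbb{Q}$ and such that for every prime number $p$ one has $v_p(a)<2$ or $v_p(b)<3$. Let $\mathbb{K}=\mathbb{Q}(\theta)$ where $\theta^3-a\theta+b=0$. Put $\Delta=4a^3-27b^2$, $s_3=v_3(\Delta)$ and $\Delta_3=\Delta/3^{s_3}$. Then $$i(\mathbb{K})=2^{\alpha}3^{\beta},$$ where $$\alpha=\begin{cases}1 & \text{if } 1=v_2(a)<v_2(b)\ \text{ or }\ a\not\equiv b \pmod 2,\\ 0&\text{otherwise,}\end{cases}$$ and $$\beta=\begin{cases}1 & \text{if } \big(a\equiv 3 \pmod 9,\ b^2\equiv a+1 \pmod{27},\ s_3>6 \text{ is even, and } \Delta_3\equiv 1\pmod 3\big)\\ & \text{or } \big(a\equiv 1\pmod 3 \text{ and } 3\mid b\big),\\ 0&\text{otherwise.}\end{cases}$$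
   Context: For a prime $p$, $v_p$ denotes the $p$-adic valuation on $\mathbb{Q}$, with $v_p(0)=\infty$. For a number field $\mathbb{K}$ of degree $n$ over $\mathbb{Q}$ with ring of integers $\mathbb{A}$, let $\widehat{\mathbb{A}}$ be the set of $\theta\in\mathbb{A}$ that are primitive over $\mathbb{Q}$, i.e. $\mathbb{K}=\mathbb{Q}(\theta)$. For $\theta\in\mathbb{A}$ let $F_\theta(x)\in\mathbb{Z}[x]$ be the (degree $n$) characteristic polynomial of $\theta$ over $\mathbb{Q}$ and set $i(\theta)=\gcd_{x\in\mathbb{Z}}F_\theta(x)$. Define $i(\mathbb{K})=\operatorname{lcm}_{\theta\in\widehat{\mathbb{A}}}\, i(\theta)$. -}

module Defs where

open import Algebra.Bundles using (CommutativeRing; RawRing)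
import Algebra.Definitions.RawSemiring as RawSemiringDefs
open import Algebra.Morphism.Structures using (module RingMorphisms)
open import Data.Bool.Base using (if_then_else_)
open import Data.Fin.Base using (Fin; zero; suc; toℕ; punchIn)
import Data.Fin.Properties as Fin
open import Data.Integer.Base as ℤ using (ℤ; +_; 0ℤ; 1ℤ; ∣_∣; _/ℕ_)
import Data.Integer.Divisibility.Signed as ℤ
import Data.Integer.Properties as ℤ
open import Data.List.Base as List using (List; []; _∷_; foldr)
open import Data.Nat.Base as ℕ using (ℕ; zero; suc)
import Data.Nat.Divisibility as ℕ
import Data.Nat.Properties as ℕ
open import Data.Product.Base using (∃-syntax; _×_)
open import Data.Rational.Base as ℚ using (ℚ; 0ℚ)
open import Data.Sum.Base using (_⊎_)
open import Data.Vec.Functional using (Vector)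
open import Level using (Level; _⊔_)
open import Relation.Binary.Construct.Add.Supremum.Strict ℕ._<_ using (_<⁺_; <⁺-dec)
open import Relation.Binary.PropositionalEquality using (_≡_)
open import Relation.Nullary using (¬_; Dec; does; ¬?)
open import Relation.Nullary.Construct.Add.Supremum using (_⁺; ⊤⁺; [_]; ≡-dec)
open import Relation.Nullary.Decidable using (_×-dec_; _⊎-dec_)

-- Univariate polynomials as coefficient lists, constant term first.  Trailing
-- zeros are allowed, so equality of polynomials is equality of all coefficients.

module Polynomial {c ℓ} (R : RawRing c ℓ) where

  open RawRing R

  Poly : Set c
  Poly = List Carrier

  coeff : Poly → ℕ → Carrier
  coeff []      _       = 0#
  coeff (a ∷ _) zero    = a
  coeff (_ ∷ p) (suc k) = coeff p k

  infix 4 _≈ₚ_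
  _≈ₚ_ : Poly → Poly → Set ℓ
  p ≈ₚ q = ∀ k → coeff p k ≈ coeff q k

  infixl 6 _+ₚ_
  _+ₚ_ : Poly → Poly → Poly
  []      +ₚ q       = q
  p       +ₚ []      = p
  (a ∷ p) +ₚ (b ∷ q) = (a + b) ∷ (p +ₚ q)

  infixl 7 _*ₚ_
  _*ₚ_ : Poly → Poly → Poly
  []      *ₚ q = []
  (a ∷ p) *ₚ q = List.map (a *_) q +ₚ (0# ∷ (p *ₚ q))

  C : Carrier → Poly
  C a = a ∷ []

  X : Poly
  X = 0# ∷ 1# ∷ []

  polyRawRing : RawRing c ℓ
  polyRawRing = record
    { Carrier = Poly
    ; _≈_     = _≈ₚ_
    ; _+_     = _+ₚ_
    ; _*_     = _*ₚ_
    ; -_      = List.map (-_)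
    ; 0#      = []
    ; 1#      = C 1#
    }

  Irreducible : Poly → Set (c ⊔ ℓ)
  Irreducible = RawSemiringDefs.Irreducible (RawRing.rawSemiring polyRawRing)

  Monic : Poly → Set ℓ
  Monic p = ∃[ d ] (coeff p d ≈ 1# × (∀ k → d ℕ.< k → coeff p k ≈ 0#))

  eval : Poly → Carrier → Carrier
  eval p x = foldr (λ a r → a + x * r) 0# p

module ℤ[X] = Polynomial ℤ.+-*-rawRing
module ℚ[X] = Polynomial ℚ.+-*-rawRing

ℤ→ℚ : ℤ → ℚ
ℤ→ℚ n = n ℚ./ 1

ℤ[X]→ℚ[X] : ℤ[X].Poly → ℚ[X].Poly
ℤ[X]→ℚ[X] = List.map ℤ→ℚ

-- Laplace expansion along the first row.
module Determinant {c ℓ} (R : RawRing c ℓ) where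

  open RawRing R
  open RawSemiringDefs rawSemiring using (sum; _^_)

  det : ∀ n → (Fin n → Fin n → Carrier) → Carrier
  det zero    M = 1#
  det (suc n) M = sum λ j →
    ((- 1#) ^ toℕ j) * (M zero j * det n (λ i k → M (suc i) (punchIn j k)))

-- A field together with an embedding of ℚ and a finite ℚ-basis.  The
-- characteristic polynomials below do not depend on the choice of basis.
record NumberField (c ℓ : Level) : Set (Level.suc (c ⊔ ℓ)) where
  field
    commutativeRing : CommutativeRing c ℓ

  open CommutativeRing commutativeRing public
  open RawSemiringDefs (RawRing.rawSemiring rawRing) public using (sum)

  field
    0≉1     : ¬ (0# ≈ 1#)
    inverse : ∀ x → ¬ (x ≈ 0#) → ∃[ y ] (x * y ≈ 1#)

    ι     : ℚ → Carrier
    ι-hom : RingMorphisms.IsRingHomomorphism ℚ.+-*-rawRing rawRing ι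

    degree      : ℕ
    basis       : Vector Carrier degree
    coord       : Carrier → Vector ℚ degree
    spanning    : ∀ x → x ≈ sum (λ i → ι (coord x i) * basis i)
    independent : ∀ (r : Vector ℚ degree) →
                  sum (λ i → ι (r i) * basis i) ≈ 0# → ∀ i → r i ≡ 0ℚ

module _ {c ℓ} (K : NumberField c ℓ) where

  open NumberField K

  evalℚ : ℚ[X].Poly → Carrier → Carrier
  evalℚ p = Polynomial.eval rawRing (List.map ι p)

  evalℤ : ℤ[X].Poly → Carrier → Carrier
  evalℤ p = evalℚ (ℤ[X]→ℚ[X] p)

  IsIntegral : Carrier → Set ℓ
  IsIntegral θ = ∃[ p ] (ℤ[X].Monic p × evalℤ p θ ≈ 0#)

  -- K = ℚ(θ): every element is a quotient p(θ)/q(θ) with p, q ∈ ℚ[X].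
  IsPrimitive : Carrier → Set (c ⊔ ℓ)
  IsPrimitive θ =
    ∀ y → ∃[ p ] ∃[ q ] (¬ (evalℚ q θ ≈ 0#) × y * evalℚ q θ ≈ evalℚ p θ)

  -- The j-th column is the coordinate vector of θ times the j-th basis element.
  mulMatrix : Carrier → Fin degree → Fin degree → ℚ
  mulMatrix θ i j = coord (θ * basis j) i

  -- det (X·I − M), M the matrix of multiplication by θ.
  charPoly : Carrier → ℚ[X].Poly
  charPoly θ = Determinant.det ℚ[X].polyRawRing degree λ i j →
    (if does (i Fin.≟ j) then ℚ[X].X else []) ℚ[X].+ₚ ℚ[X].C (ℚ.- mulMatrix θ i j)

  IsCharPoly : Carrier → ℤ[X].Poly → Set
  IsCharPoly θ F = ℤ[X]→ℚ[X] F ℚ[X].≈ₚ charPoly θ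

  -- d = i(θ) = gcd { F(x) : x ∈ ℤ }, where F ∈ ℤ[X] is the characteristic
  -- polynomial of θ.
  IsElementIndex : Carrier → ℕ → Set
  IsElementIndex θ d = ∃[ F ]
    ( IsCharPoly θ F
    × (∀ x → d ℕ.∣ ∣ ℤ[X].eval F x ∣)
    × (∀ e → (∀ x → e ℕ.∣ ∣ ℤ[X].eval F x ∣) → e ℕ.∣ d))

  IsCommonMultipleOfIndices : ℕ → Set (c ⊔ ℓ)
  IsCommonMultipleOfIndices m =
    ∀ θ → IsIntegral θ → IsPrimitive θ → ∀ d → IsElementIndex θ d → d ℕ.∣ m

  -- m = i(K) = lcm { i(θ) : θ integral and primitive }
  IsFieldIndex : ℕ → Set (c ⊔ ℓ)
  IsFieldIndex m =
    IsCommonMultipleOfIndices m ×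
    (∀ m′ → IsCommonMultipleOfIndices m′ → m ℕ.∣ m′)

-- The largest k ≤ b with p ^ k ∣ m.
largestExponent : (p m b : ℕ) → ℕ
largestExponent p m zero    = 0
largestExponent p m (suc b) =
  if does ((p ℕ.^ suc b) ℕ.∣? m) then suc b else largestExponent p m b

-- For p ≥ 2 and n ≢ 0 the largest k with p ^ k ∣ n: such a k satisfies
-- k < p ^ k ≤ ∣ n ∣, so searching up to ∣ n ∣ suffices.  (Junk value 0 at n = 0.)
ord : ℕ → ℤ → ℕ
ord p n = largestExponent p ∣ n ∣ ∣ n ∣

-- The p-adic valuation on ℤ, with v_p(0) = ∞.
v : ℕ → ℤ → ℕ ⁺
v p n = if does (n ℤ.≟ 0ℤ) then ⊤⁺ else [ ord p n ]

infix 4 _≡_[mod_] _≡?_[mod_]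
_≡_[mod_] : ℤ → ℤ → ℕ → Set
x ≡ y [mod n ] = + n ℤ.∣ (x ℤ.- y)

_≡?_[mod_] : ∀ x y n → Dec (x ≡ y [mod n ])
x ≡? y [mod n ] = + n ℤ.∣? (x ℤ.- y)

-- x³ − a x + b
cubic : ℤ → ℤ → ℤ[X].Poly
cubic a b = b ∷ ℤ.- a ∷ 0ℤ ∷ 1ℤ ∷ []

module _ (a b : ℤ) where

  Δ : ℤ
  Δ = + 4 ℤ.* a ℤ.^ 3 ℤ.- + 27 ℤ.* b ℤ.^ 2

  -- Δ is the discriminant of cubic a b, hence non-zero when the cubic is
  -- irreducible, so that ord 3 Δ is then v₃(Δ).
  s₃ : ℕ
  s₃ = ord 3 Δ

  Δ₃ : ℤ
  Δ₃ = _/ℕ_ Δ (3 ℕ.^ s₃) {{ℕ.m^n≢0 3 s₃}}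

  αCondition : Set
  αCondition = (v 2 a ≡ [ 1 ] × v 2 a <⁺ v 2 b) ⊎ ¬ (a ≡ b [mod 2 ])

  αCondition? : Dec αCondition
  αCondition? =
    (≡-dec ℕ._≟_ (v 2 a) [ 1 ] ×-dec <⁺-dec ℕ._<?_ (v 2 a) (v 2 b))
      ⊎-dec ¬? (a ≡? b [mod 2 ])

  βCondition : Set
  βCondition =
    ( a ≡ + 3 [mod 9 ]
    × b ℤ.^ 2 ≡ a ℤ.+ 1ℤ [mod 27 ]
    × (6 ℕ.< s₃ × 2 ℕ.∣ s₃)
    × Δ₃ ≡ 1ℤ [mod 3 ])
    ⊎ (a ≡ 1ℤ [mod 3 ] × + 3 ℤ.∣ b)

  βCondition? : Dec βCondition
  βCondition? =
    (     (a ≡? + 3 [mod 9 ])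
    ×-dec (b ℤ.^ 2 ≡? a ℤ.+ 1ℤ [mod 27 ])
    ×-dec (6 ℕ.<? s₃ ×-dec 2 ℕ.∣? s₃)
    ×-dec (Δ₃ ≡? 1ℤ [mod 3 ]))
    ⊎-dec ((a ≡? 1ℤ [mod 3 ]) ×-dec (+ 3 ℤ.∣? b))

  α : ℕ
  α = if does αCondition? then 1 else 0

  β : ℕ
  β = if does βCondition? then 1 else 0

{-# OPTIONS --safe #-}
module Submission where

open import Defs
open import Algebra.Bundles using (CommutativeRing; RawRing)
import Algebra.Definitions.RawSemiring as RawSemiringDefs
open import Algebra.Morphism.Structures using (module RingMorphisms)
import Algebra.Properties.Ring as RingProperties
import Algebra.Properties.Semiring.Mult.TCOptimised as Mult
import Algebra.Properties.Semiring.Sum as SemiringSum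
open import Data.Bool.Base using (Bool; true; false; T; _∧_; if_then_else_)
open import Data.Bool.Properties using (T-∧)
open import Data.Fin.Base using (Fin; zero; suc)
open import Data.Fin.Patterns
import Data.Fin.Properties as Fin
open import Data.Integer.Base as ℤ using (ℤ; +_; -[1+_]; 0ℤ; 1ℤ; ∣_∣)
import Data.Integer.DivMod as ℤ
open import Data.Integer.Divisibility.Signed as ℤ using (divides)
import Data.Integer.Properties as ℤ
open import Data.List.Base as List using (List; []; _∷_)
open import Data.Nat.Base as ℕ using (ℕ; zero; suc; NonZero; s≤s; z≤n)
import Data.Nat.DivMod as ℕ
import Data.Nat.Divisibility as ℕ
import Data.Nat.GCD as ℕ
open import Data.Nat.Induction using (<-wellFounded)
open import Data.Nat.Primality using (Prime; prime?; euclidsLemma; prime⇒nonTrivial; prime⇒nonZero)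
import Data.Nat.Properties as ℕ
open import Data.Product.Base as Product using (_×_; _,_; proj₁; proj₂; ∃-syntax)
open import Data.Rational.Base as ℚ using (ℚ; 0ℚ; 1ℚ)
import Data.Rational.Properties as ℚ
open import Data.Rational.Unnormalised.Base as ℚᵘ using (mkℚᵘ; *≡*)
import Data.Rational.Unnormalised.Properties as ℚᵘ
import Data.Sign.Base as Sign
open import Data.Sum.Base as Sum using (_⊎_; inj₁; inj₂; [_,_]′)
open import Data.Vec.Base as Vec using (Vec; []; _∷_; lookup; allFin)
open import Data.Vec.Functional using (Vector)
open import Data.Vec.N-ary using (N-ary; ∀ⁿ; curryⁿ; _$ⁿ_)
open import Data.Vec.Properties using (lookup-map)
open import Function.Base using (_∘_; id)
open import Function.Bundles using (Equivalence)
open import Induction.WellFounded using (Acc; acc)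
open import Level using (0ℓ; _⊔_)
open import Relation.Binary.Construct.Add.Supremum.Strict ℕ._<_ using (_<⁺_; [_]; [_]<⊤⁺)
open import Relation.Binary.PropositionalEquality using (_≡_; _≢_; refl; cong; cong₂; sym; trans; subst; subst₂; module ≡-Reasoning)
open import Relation.Nullary using (¬_; Dec; yes; no; does; contradiction)
open import Relation.Nullary.Construct.Add.Supremum using ([_])
open import Relation.Nullary.Decidable using (toWitness; toWitnessFalse)

-- The characteristic polynomial F of x ∈ K is a monic cubic, with third
-- difference 6, so i(x) ∣ 6 and only the primes 2 and 3 matter.  Write
-- x = (u + v θ + w θ²) / m with integers u, v, w, m: the coefficients of F are
-- the trace, the sum of the principal minors and the norm, integral forms in
-- u, v, w divided by m, m², m³.  If p ∣ i(x), then p divides F(0), F(1), F(−1),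
-- and unless α = 1 (p = 2) or β = 1 (p = 3) this forces p to divide all of
-- u, v, w, m, which is impossible by descent; here θ is first replaced by a
-- translate, by (θ − k) / 3 or by θ² / p, so that the cubic becomes Eisenstein
-- or separable modulo p.  For p = 3 moreover F ≡ X³ − X, so disc F ≡ 1 modulo 3,
-- and disc F = Δ · (index form)² / m⁶ shows that s₃ is even and Δ₃ ≡ 1.
-- Conversely θ, θ² + θ, θ² / 2 and, in the case s₃ > 6, the inverse of a scaled
-- translate of θ have index divisible by 2, respectively by 3.
--
-- The characteristic polynomial does not depend on the basis because by Newton's
-- identities its coefficients are polynomials in traces, and tr(PQ) = tr(QP);
-- the trace of 1 shows that the degree is 3.

-- Deciding ring identities

-- In terms of prime ideals, 2 divides some i(x) exactly when at least two primes lie over 2, and 3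
-- divides some i(x) exactly when 3 splits completely. Neither ideals nor the ring of integers
-- appear: the splitting type of p is read off from the forms in u, v, w. Modulo p the norm form of
-- an irreducible cubic vanishes only at 0; for an Eisenstein cubic the pure terms of the norm have
-- valuations distinct modulo 3; and for a separable cubic modulo 3, an element with F ≡ X³ - X
-- forces the cubic itself to be η³ - η.
--
-- The delicate case is 3 ∣ a, 3 ∤ b, where the cubic is a cube modulo 3 but may still split over
-- the 3-adic numbers. After θ = k + 3 ζ the discriminant is Δ / 3⁶, while the trace of ζ is prime
-- to 3. The residues 0, 1, -1 have sum 0, so ζ cannot take all three of them and 3 must divide the
-- discriminant once more: this is the origin of s₃ > 6. With a = 3 a′, a scaled inverse of θ - b /
-- (2 a′) then separates the two roots that are still congruent, by one formula for all s₃.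

infixl 6 _⊕_
infixl 7 _⊗_
infix  8 ⊝_

data Expr (n : ℕ) : Set where
  con     : ℤ → Expr n
  var     : Fin n → Expr n
  _⊕_ _⊗_ : Expr n → Expr n → Expr n
  ⊝_      : Expr n → Expr n

exprRing : ℕ → RawRing 0ℓ 0ℓ
exprRing n = record
  { Carrier = Expr n
  ; _≈_     = _≡_
  ; _+_     = _⊕_
  ; _*_     = _⊗_
  ; -_      = ⊝_
  ; 0#      = con 0ℤ
  ; 1#      = con 1ℤ
  }

variables : ∀ n → Vec (Expr n) n
variables n = Vec.map var (allFin n)

∀ⁿ-intro : ∀ {a p} {A : Set a} n (P : Vec A n → Set p) → (∀ ρ → P ρ) → ∀ⁿ n (curryⁿ P)
∀ⁿ-intro zero    P h = h []
∀ⁿ-intro (suc n) P h = λ x → ∀ⁿ-intro n (λ ρ → P (x ∷ ρ)) (λ ρ → h (x ∷ ρ))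

-- Multivariate polynomials over ℤ, as nested lists of coefficients.
Dense : ℕ → Set
Dense zero    = ℤ
Dense (suc n) = List (Dense n)

isZero : ∀ n → Dense n → Bool
isZero zero    (+ zero)   = true
isZero zero    (+ suc _)  = false
isZero zero    -[1+ _ ]   = false
isZero (suc n) []         = true
isZero (suc n) (c ∷ p)    = isZero n c ∧ isZero (suc n) p

conᵈ : ∀ n → ℤ → Dense n
conᵈ zero    k = k
conᵈ (suc n) k = conᵈ n k ∷ []

varᵈ : ∀ {n} → Fin n → Dense n
varᵈ {suc n} zero    = conᵈ n 0ℤ ∷ conᵈ n 1ℤ ∷ []
varᵈ {suc n} (suc i) = varᵈ i ∷ []

addᵈ : ∀ n → Dense n → Dense n → Dense n
addᵈ zero    j       k       = j ℤ.+ k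
addᵈ (suc n) []      q       = q
addᵈ (suc n) (c ∷ p) []      = c ∷ p
addᵈ (suc n) (c ∷ p) (d ∷ q) = addᵈ n c d ∷ addᵈ (suc n) p q

negᵈ : ∀ n → Dense n → Dense n
negᵈ zero    k       = ℤ.- k
negᵈ (suc n) []      = []
negᵈ (suc n) (c ∷ p) = negᵈ n c ∷ negᵈ (suc n) p

mulᵈ   : ∀ n → Dense n → Dense n → Dense n
scaleᵈ : ∀ n → Dense n → List (Dense n) → List (Dense n)
mulᵈ zero    j       k = j ℤ.* k
mulᵈ (suc n) []      q = []
mulᵈ (suc n) (c ∷ p) q = addᵈ (suc n) (scaleᵈ n c q) (conᵈ n 0ℤ ∷ mulᵈ (suc n) p q)
scaleᵈ n c []      = []
scaleᵈ n c (d ∷ q) = mulᵈ n c d ∷ scaleᵈ n c q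

normalise : ∀ {n} → Expr n → Dense n
normalise {n} (con k) = conᵈ n k
normalise     (var i) = varᵈ i
normalise {n} (e ⊕ f) = addᵈ n (normalise e) (normalise f)
normalise {n} (e ⊗ f) = mulᵈ n (normalise e) (normalise f)
normalise {n} (⊝ e)   = negᵈ n (normalise e)

-- Sums keep vanishing leading coefficients, so a polynomial has many dense forms. Hence the
-- difference is tested for vanishing in every coefficient, and two forms are never compared
-- directly.
sameNormalForm : ∀ {n} → Expr n → Expr n → Bool
sameNormalForm {n} e f = isZero n (normalise (e ⊕ ⊝ f))

module Evaluation {c ℓ} (R : RawRing c ℓ) where

  open RawRing R
  open import Algebra.Definitions.RawSemiring rawSemiring using (_×′_)

  -- `1 ×′ x` is `x` by definition, so `con 1ℤ` evaluates to `1#` and `con (+ 2)` to `1# + 1#` on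
  -- the nose; goals stated in the ring match evaluated expressions without rewriting.
  fromℤ : ℤ → Carrier
  fromℤ (+ n)    = n ×′ 1#
  fromℤ -[1+ n ] = - (suc n ×′ 1#)

  ⟦_⟧ : ∀ {n} → Expr n → Vec Carrier n → Carrier
  ⟦ con k ⟧ ρ = fromℤ k
  ⟦ var i ⟧ ρ = lookup ρ i
  ⟦ e ⊕ f ⟧ ρ = ⟦ e ⟧ ρ + ⟦ f ⟧ ρ
  ⟦ e ⊗ f ⟧ ρ = ⟦ e ⟧ ρ * ⟦ f ⟧ ρ
  ⟦ ⊝ e ⟧   ρ = - ⟦ e ⟧ ρ

module Solver {c ℓ} (R : CommutativeRing c ℓ) where

  open CommutativeRing R renaming (refl to ≈-refl; sym to ≈-sym; trans to ≈-trans)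
  open Evaluation rawRing public
  open RingProperties ring
  open Mult semiring using () renaming (_×_ to _·_; 1+× to 1+·; ×-homo-+ to ·-homo-+; ×1-homo-* to ·1-homo-*)
  open import Relation.Binary.Reasoning.Setoid setoid
  open import Algebra.Properties.CommutativeSemigroup +-commutativeSemigroup using (interchange)

  x-y≈0⇒x≈y : ∀ {x y} → x - y ≈ 0# → x ≈ y
  x-y≈0⇒x≈y {x} {y} = x∙y⁻¹≈ε⇒x≈y x y

  fromℤ-⊖ : ∀ m n → fromℤ (m ℤ.⊖ n) ≈ m · 1# - n · 1#
  fromℤ-⊖ m zero = begin
    m · 1#       ≈⟨ +-identityʳ _ ⟨
    m · 1# + 0#  ≈⟨ +-congˡ -0#≈0# ⟨
    m · 1# - 0#  ∎
  fromℤ-⊖ zero (suc n) = ≈-sym (+-identityˡ _)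
  fromℤ-⊖ (suc m) (suc n) = begin
    fromℤ (suc m ℤ.⊖ suc n)                 ≡⟨ cong fromℤ (ℤ.[1+m]⊖[1+n]≡m⊖n m n) ⟩
    fromℤ (m ℤ.⊖ n)                         ≈⟨ fromℤ-⊖ m n ⟩
    m · 1# - n · 1#                         ≈⟨ +-identityˡ _ ⟨
    0# + (m · 1# - n · 1#)                  ≈⟨ +-congʳ (-‿inverseʳ 1#) ⟨
    (1# - 1#) + (m · 1# - n · 1#)           ≈⟨ interchange _ _ _ _ ⟩
    (1# + m · 1#) + (- 1# - n · 1#)         ≈⟨ +-cong (≈-sym (1+· m 1#)) (-‿+-comm 1# (n · 1#)) ⟩
    suc m · 1# - (1# + n · 1#)              ≈⟨ +-congˡ (-‿cong (1+· n 1#)) ⟨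
    suc m · 1# - suc n · 1#                 ∎

  fromℤ-+ : ∀ j k → fromℤ (j ℤ.+ k) ≈ fromℤ j + fromℤ k
  fromℤ-+ (+ m)    (+ n)    = ·-homo-+ 1# m n
  fromℤ-+ (+ m)    -[1+ n ] = fromℤ-⊖ m (suc n)
  fromℤ-+ -[1+ m ] (+ n)    = ≈-trans (fromℤ-⊖ n (suc m)) (+-comm _ _)
  fromℤ-+ -[1+ m ] -[1+ n ] = begin
    - (suc (suc (m ℕ.+ n)) · 1#)       ≡⟨ cong (λ k → - (k · 1#)) (cong suc (sym (ℕ.+-suc m n))) ⟩
    - ((suc m ℕ.+ suc n) · 1#)         ≈⟨ -‿cong (·-homo-+ 1# (suc m) (suc n)) ⟩
    - (suc m · 1# + suc n · 1#)        ≈⟨ -‿+-comm _ _ ⟨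
    - (suc m · 1#) - suc n · 1#        ∎

  fromℤ-neg : ∀ k → fromℤ (ℤ.- k) ≈ - fromℤ k
  fromℤ-neg (+ zero)  = ≈-sym -0#≈0#
  fromℤ-neg (+ suc n) = ≈-refl
  fromℤ-neg -[1+ n ]  = ≈-sym (-‿involutive _)

  fromℤ-neg◃ : ∀ n → fromℤ (Sign.- ℤ.◃ n) ≈ - (n · 1#)
  fromℤ-neg◃ zero    = ≈-sym -0#≈0#
  fromℤ-neg◃ (suc n) = ≈-refl

  fromℤ-* : ∀ j k → fromℤ (j ℤ.* k) ≈ fromℤ j * fromℤ k
  fromℤ-* (+ m)    (+ n)    = begin
    fromℤ (Sign.+ ℤ.◃ m ℕ.* n)  ≡⟨ cong fromℤ (ℤ.+◃n≡+n (m ℕ.* n)) ⟩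
    (m ℕ.* n) · 1#              ≈⟨ ·1-homo-* m n ⟩
    (m · 1#) * (n · 1#)         ∎
  fromℤ-* (+ m)    -[1+ n ] = begin
    fromℤ (Sign.- ℤ.◃ m ℕ.* suc n)  ≈⟨ fromℤ-neg◃ (m ℕ.* suc n) ⟩
    - ((m ℕ.* suc n) · 1#)          ≈⟨ -‿cong (·1-homo-* m (suc n)) ⟩
    - ((m · 1#) * (suc n · 1#))     ≈⟨ -‿distribʳ-* _ _ ⟩
    (m · 1#) * - (suc n · 1#)       ∎
  fromℤ-* -[1+ m ] (+ n)    = begin
    fromℤ (Sign.- ℤ.◃ suc m ℕ.* n)  ≈⟨ fromℤ-neg◃ (suc m ℕ.* n) ⟩
    - ((suc m ℕ.* n) · 1#)          ≈⟨ -‿cong (·1-homo-* (suc m) n) ⟩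
    - ((suc m · 1#) * (n · 1#))     ≈⟨ -‿distribˡ-* _ _ ⟩
    - (suc m · 1#) * (n · 1#)       ∎
  fromℤ-* -[1+ m ] -[1+ n ] = begin
    (suc m ℕ.* suc n) · 1#              ≈⟨ ·1-homo-* (suc m) (suc n) ⟩
    (suc m · 1#) * (suc n · 1#)         ≈⟨ -‿involutive _ ⟨
    - - ((suc m · 1#) * (suc n · 1#))   ≈⟨ -‿cong (-‿distribˡ-* _ _) ⟩
    - (- (suc m · 1#) * (suc n · 1#))   ≈⟨ -‿distribʳ-* _ _ ⟩
    - (suc m · 1#) * - (suc n · 1#)     ∎

  evalᵈ : ∀ n → Dense n → Vec Carrier n → Carrier
  evalᵈ zero    k       []      = fromℤ k
  evalᵈ (suc n) []      (x ∷ ρ) = 0#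
  evalᵈ (suc n) (c ∷ p) (x ∷ ρ) = evalᵈ n c ρ + x * evalᵈ (suc n) p (x ∷ ρ)

  isZero-sound : ∀ n p → T (isZero n p) → ∀ ρ → evalᵈ n p ρ ≈ 0#
  isZero-sound zero    (+ zero) t []      = ≈-refl
  isZero-sound (suc n) []       t (x ∷ ρ) = ≈-refl
  isZero-sound (suc n) (c ∷ p)  t (x ∷ ρ) = begin
    evalᵈ n c ρ + x * evalᵈ (suc n) p (x ∷ ρ)
      ≈⟨ +-cong (isZero-sound n c (proj₁ both) ρ) (*-congˡ (isZero-sound (suc n) p (proj₂ both) (x ∷ ρ))) ⟩
    0# + x * 0#  ≈⟨ ≈-trans (+-identityˡ _) (zeroʳ x) ⟩
    0#           ∎
    where both = Equivalence.to T-∧ t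

  conᵈ-sound : ∀ n k ρ → evalᵈ n (conᵈ n k) ρ ≈ fromℤ k
  conᵈ-sound zero    k []      = ≈-refl
  conᵈ-sound (suc n) k (x ∷ ρ) = begin
    evalᵈ n (conᵈ n k) ρ + x * 0#  ≈⟨ +-cong (conᵈ-sound n k ρ) (zeroʳ x) ⟩
    fromℤ k + 0#                   ≈⟨ +-identityʳ _ ⟩
    fromℤ k                        ∎

  varᵈ-sound : ∀ {n} (i : Fin n) ρ → evalᵈ n (varᵈ i) ρ ≈ lookup ρ i
  varᵈ-sound {suc n} zero (x ∷ ρ) = begin
    evalᵈ n (conᵈ n 0ℤ) ρ + x * (evalᵈ n (conᵈ n 1ℤ) ρ + x * 0#)
      ≈⟨ +-cong (conᵈ-sound n 0ℤ ρ) (*-congˡ (+-cong (conᵈ-sound n 1ℤ ρ) (zeroʳ x))) ⟩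
    0# + x * (1# + 0#)  ≈⟨ +-identityˡ _ ⟩
    x * (1# + 0#)       ≈⟨ *-congˡ (+-identityʳ 1#) ⟩
    x * 1#              ≈⟨ *-identityʳ x ⟩
    x                   ∎
  varᵈ-sound {suc n} (suc i) (x ∷ ρ) = begin
    evalᵈ n (varᵈ i) ρ + x * 0#  ≈⟨ +-cong (varᵈ-sound i ρ) (zeroʳ x) ⟩
    lookup ρ i + 0#              ≈⟨ +-identityʳ _ ⟩
    lookup ρ i                   ∎

  addᵈ-sound : ∀ n p q ρ → evalᵈ n (addᵈ n p q) ρ ≈ evalᵈ n p ρ + evalᵈ n q ρ
  addᵈ-sound zero    j       k       []      = fromℤ-+ j k
  addᵈ-sound (suc n) []      q       (x ∷ ρ) = ≈-sym (+-identityˡ _)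
  addᵈ-sound (suc n) (c ∷ p) []      (x ∷ ρ) = ≈-sym (+-identityʳ _)
  addᵈ-sound (suc n) (c ∷ p) (d ∷ q) (x ∷ ρ) = begin
    evalᵈ n (addᵈ n c d) ρ + x * evalᵈ (suc n) (addᵈ (suc n) p q) (x ∷ ρ)
      ≈⟨ +-cong (addᵈ-sound n c d ρ) (≈-trans (*-congˡ (addᵈ-sound (suc n) p q (x ∷ ρ))) (distribˡ x _ _)) ⟩
    (evalᵈ n c ρ + evalᵈ n d ρ) + (x * evalᵈ (suc n) p (x ∷ ρ) + x * evalᵈ (suc n) q (x ∷ ρ))
      ≈⟨ interchange _ _ _ _ ⟩
    (evalᵈ n c ρ + x * evalᵈ (suc n) p (x ∷ ρ)) + (evalᵈ n d ρ + x * evalᵈ (suc n) q (x ∷ ρ)) ∎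

  negᵈ-sound : ∀ n p ρ → evalᵈ n (negᵈ n p) ρ ≈ - evalᵈ n p ρ
  negᵈ-sound zero    k       []      = fromℤ-neg k
  negᵈ-sound (suc n) []      (x ∷ ρ) = ≈-sym -0#≈0#
  negᵈ-sound (suc n) (c ∷ p) (x ∷ ρ) = begin
    evalᵈ n (negᵈ n c) ρ + x * evalᵈ (suc n) (negᵈ (suc n) p) (x ∷ ρ)
      ≈⟨ +-cong (negᵈ-sound n c ρ) (*-congˡ (negᵈ-sound (suc n) p (x ∷ ρ))) ⟩
    - evalᵈ n c ρ + x * - evalᵈ (suc n) p (x ∷ ρ)     ≈⟨ +-congˡ (-‿distribʳ-* x _) ⟨
    - evalᵈ n c ρ - x * evalᵈ (suc n) p (x ∷ ρ)       ≈⟨ -‿+-comm _ _ ⟩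
    - (evalᵈ n c ρ + x * evalᵈ (suc n) p (x ∷ ρ))     ∎

  mulᵈ-sound : ∀ n p q ρ → evalᵈ n (mulᵈ n p q) ρ ≈ evalᵈ n p ρ * evalᵈ n q ρ
  scaleᵈ-sound : ∀ n c q x ρ →
    evalᵈ (suc n) (scaleᵈ n c q) (x ∷ ρ) ≈ evalᵈ n c ρ * evalᵈ (suc n) q (x ∷ ρ)
  mulᵈ-sound zero    j       k []      = fromℤ-* j k
  mulᵈ-sound (suc n) []      q (x ∷ ρ) = ≈-sym (zeroˡ _)
  mulᵈ-sound (suc n) (c ∷ p) q (x ∷ ρ) = begin
    evalᵈ (suc n) (addᵈ (suc n) (scaleᵈ n c q) (conᵈ n 0ℤ ∷ mulᵈ (suc n) p q)) (x ∷ ρ)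
      ≈⟨ addᵈ-sound (suc n) (scaleᵈ n c q) _ (x ∷ ρ) ⟩
    evalᵈ (suc n) (scaleᵈ n c q) (x ∷ ρ) + (evalᵈ n (conᵈ n 0ℤ) ρ + x * evalᵈ (suc n) (mulᵈ (suc n) p q) (x ∷ ρ))
      ≈⟨ +-cong (scaleᵈ-sound n c q x ρ) (+-cong (conᵈ-sound n 0ℤ ρ) (*-congˡ (mulᵈ-sound (suc n) p q (x ∷ ρ)))) ⟩
    C * Q + (0# + x * (P * Q))  ≈⟨ +-congˡ (≈-trans (+-identityˡ _) (≈-sym (*-assoc x P Q))) ⟩
    C * Q + x * P * Q           ≈⟨ distribʳ Q C (x * P) ⟨
    (C + x * P) * Q             ∎
    where
    C = evalᵈ n c ρ
    P = evalᵈ (suc n) p (x ∷ ρ)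
    Q = evalᵈ (suc n) q (x ∷ ρ)
  scaleᵈ-sound n c []      x ρ = ≈-sym (zeroʳ _)
  scaleᵈ-sound n c (d ∷ q) x ρ = begin
    evalᵈ n (mulᵈ n c d) ρ + x * evalᵈ (suc n) (scaleᵈ n c q) (x ∷ ρ)
      ≈⟨ +-cong (mulᵈ-sound n c d ρ) (*-congˡ (scaleᵈ-sound n c q x ρ)) ⟩
    C * D + x * (C * Q)  ≈⟨ +-congˡ (≈-trans (≈-sym (*-assoc x C Q)) (≈-trans (*-congʳ (*-comm x C)) (*-assoc C x Q))) ⟩
    C * D + C * (x * Q)  ≈⟨ distribˡ C D (x * Q) ⟨
    C * (D + x * Q)      ∎
    where
    C = evalᵈ n c ρ
    D = evalᵈ n d ρ
    Q = evalᵈ (suc n) q (x ∷ ρ)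

  normalise-sound : ∀ {n} (e : Expr n) ρ → evalᵈ n (normalise e) ρ ≈ ⟦ e ⟧ ρ
  normalise-sound {n} (con k) ρ = conᵈ-sound n k ρ
  normalise-sound     (var i) ρ = varᵈ-sound i ρ
  normalise-sound {n} (e ⊕ f) ρ =
    ≈-trans (addᵈ-sound n (normalise e) (normalise f) ρ) (+-cong (normalise-sound e ρ) (normalise-sound f ρ))
  normalise-sound {n} (e ⊗ f) ρ =
    ≈-trans (mulᵈ-sound n (normalise e) (normalise f) ρ) (*-cong (normalise-sound e ρ) (normalise-sound f ρ))
  normalise-sound {n} (⊝ e)   ρ =
    ≈-trans (negᵈ-sound n (normalise e) ρ) (-‿cong (normalise-sound e ρ))

  ring-identity : ∀ {n} (e f : Expr n) {_ : T (sameNormalForm e f)} → ∀ ρ → ⟦ e ⟧ ρ ≈ ⟦ f ⟧ ρ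
  ring-identity {n} e f {t} ρ = x-y≈0⇒x≈y (begin
    ⟦ e ⊕ ⊝ f ⟧ ρ                     ≈⟨ normalise-sound (e ⊕ ⊝ f) ρ ⟨
    evalᵈ n (normalise (e ⊕ ⊝ f)) ρ   ≈⟨ isZero-sound n (normalise (e ⊕ ⊝ f)) t ρ ⟩
    0#                                ∎)

  solve : ∀ n (f : N-ary n (Expr n) (Expr n × Expr n)) →
          let (lhs , rhs) = f $ⁿ variables n in
          {_ : T (sameNormalForm lhs rhs)} →
          ∀ⁿ n (curryⁿ λ ρ → ⟦ lhs ⟧ ρ ≈ ⟦ rhs ⟧ ρ)
  solve n f {t} = ∀ⁿ-intro n _ λ ρ → ring-identity (proj₁ (f $ⁿ variables n)) (proj₂ (f $ⁿ variables n)) {t} ρ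

-- The algebra R[η] with η³ = p η² + q η + r, in the basis 1, η, η².
module CubicForms {c ℓ} (R : RawRing c ℓ) where

  open RawRing R

  module _ (p q r u v w : Carrier) where

    -- x η = m₁₀ + m₁₁ η + m₁₂ η² and x η² = m₂₀ + m₂₁ η + m₂₂ η² for x = u + v η + w η²;
    -- index is the determinant of 1, x, x² in the basis 1, η, η².
    private
      m₁₀ = r * w
      m₁₁ = u + q * w
      m₁₂ = v + p * w
      m₂₀ = r * m₁₂
      m₂₁ = m₁₀ + q * m₁₂
      m₂₂ = m₁₁ + p * m₁₂

    adjugate₀ adjugate₁ adjugate₂ trace norm minors index : Carrier
    adjugate₀ = m₁₁ * m₂₂ + - (m₁₂ * m₂₁)
    adjugate₁ = w * m₂₁ + - (v * m₂₂)
    adjugate₂ = v * m₁₂ + - (w * m₁₁)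
    trace     = u + m₁₁ + m₂₂
    norm      = u * adjugate₀ + m₁₀ * adjugate₁ + m₂₀ * adjugate₂
    minors    = (u * m₁₁ + - (v * m₁₀)) + (u * m₂₂ + - (w * m₂₀)) + adjugate₀
    index     = v * v * v + p * (v * v * w) * (1# + 1#) + (p * p + - q) * (v * (w * w))
                  + - ((p * q + r) * (w * w * w))

  module _ (p q r u v w u′ v′ w′ : Carrier) where

    private
      c₃ = v * w′ + w * v′
      c₄ = w * w′

    product₀ product₁ product₂ : Carrier
    product₀ = u * u′ + r * c₃ + p * r * c₄
    product₁ = u * v′ + v * u′ + q * c₃ + (p * q + r) * c₄
    product₂ = u * w′ + v * v′ + w * u′ + p * c₃ + (p * p + q) * c₄

  -- The discriminant of X³ - t X² + s X - n, with 18 and 27 built up from `1#`. For η³ = p η² + q η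
  -- + r it is `discriminant p (- q) r`.
  discriminant : Carrier → Carrier → Carrier → Carrier
  discriminant t s n =
    t * t * (s * s) + - (s * s * s * 4#) + - (t * t * t * n * 4#)
      + t * s * n * (4# * 4# + 1# + 1#) + - (n * n * (4# * 4# + 4# * (1# + 1#) + 1# + 1# + 1#))
    where 4# = 1# + 1# + 1# + 1#

module ℤSolver = Solver ℤ.+-*-commutativeRing

module E {n} = CubicForms (exprRing n)
module Z = CubicForms ℤ.+-*-rawRing

-- Congruences decided by running through residues.

all< : ℕ → (ℕ → Bool) → Bool
all< zero    f = true
all< (suc n) f = f n ∧ all< n f

all<-sound : ∀ {n} f → T (all< n f) → ∀ {k} → k ℕ.< n → T (f k)
all<-sound {suc n} f t {k} k<1+n with k ℕ.≟ n
... | yes refl = proj₁ (Equivalence.to T-∧ t)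
... | no  k≢n  = all<-sound f (proj₂ (Equivalence.to T-∧ t)) (ℕ.≤∧≢⇒< (ℕ.≤-pred k<1+n) k≢n)

module ModularCheck (n : ℕ) {{n≢0 : NonZero n}} where

  open Evaluation ℤ.+-*-rawRing

  divisible : ℤ → Bool
  divisible z = ∣ z ∣ ℕ.% n ℕ.≡ᵇ 0

  divisible-sound : ∀ z → T (divisible z) → + n ℤ.∣ z
  divisible-sound z t = ℤ.∣ᵤ⇒∣ (ℕ.m%n≡0⇒n∣m ∣ z ∣ n (ℕ.≡ᵇ⇒≡ _ 0 t))

  divisible-complete : ∀ z → + n ℤ.∣ z → T (divisible z)
  divisible-complete z n∣z = ℕ.≡⇒≡ᵇ _ 0 (ℕ.n∣m⇒m%n≡0 ∣ z ∣ n (ℤ.∣⇒∣ᵤ n∣z))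

  -- The first hypothesis that fails ends the test, so cheap and restrictive hypotheses are best
  -- listed first.
  implies : ∀ {k} → List (Expr k) → Expr k → Vec ℤ k → Bool
  implies []       g ρ = divisible (⟦ g ⟧ ρ)
  implies (h ∷ hs) g ρ = if divisible (⟦ h ⟧ ρ) then implies hs g ρ else true

  allResidues : ∀ k → (Vec ℤ k → Bool) → Bool
  allResidues zero    f = f []
  allResidues (suc k) f = all< n λ r → allResidues k λ ρ → f (+ r ∷ ρ)

  residues : ∀ {k} → Vec ℤ k → Vec ℤ k
  residues = Vec.map λ z → + (z ℤ.%ℕ n)

  allResidues-sound : ∀ k f → T (allResidues k f) → ∀ ρ → T (f (residues ρ))
  allResidues-sound zero    f t []      = t
  allResidues-sound (suc k) f t (z ∷ ρ) =
    allResidues-sound k _ (all<-sound {n} _ t (ℤ.n%ℕd<d z n)) ρ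

  residue-≡ : ∀ z → + n ℤ.∣ (z ℤ.- + (z ℤ.%ℕ n))
  residue-≡ z = divides (z ℤ./ℕ n) (trans (cong (ℤ._- + r) (ℤ.a≡a%ℕn+[a/ℕn]*n z n))
    (ℤSolver.solve 2 (λ r m → r ⊕ m ⊕ ⊝ r , m) (+ r) (z ℤ./ℕ n ℤ.* + n)))
    where r = z ℤ.%ℕ n

  eval-≡ : ∀ {k} (e : Expr k) ρ → + n ℤ.∣ (⟦ e ⟧ ρ ℤ.- ⟦ e ⟧ (residues ρ))
  eval-≡ (con k) ρ = subst (+ n ℤ.∣_) (sym (ℤ.+-inverseʳ (fromℤ k))) (divides 0ℤ refl)
  eval-≡ (var i) ρ = subst (λ z → + n ℤ.∣ (lookup ρ i ℤ.- z)) (sym (lookup-map i _ ρ)) (residue-≡ (lookup ρ i))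
  eval-≡ (e ⊕ f) ρ =
    subst (+ n ℤ.∣_) (ℤSolver.solve 4 (λ a a′ b b′ → (a ⊕ ⊝ a′) ⊕ (b ⊕ ⊝ b′) , (a ⊕ b) ⊕ ⊝ (a′ ⊕ b′)) (⟦ e ⟧ ρ) _ _ _)
      (ℤ.∣m∣n⇒∣m+n (eval-≡ e ρ) (eval-≡ f ρ))
  eval-≡ (e ⊗ f) ρ =
    subst (+ n ℤ.∣_) (ℤSolver.solve 4 (λ a a′ b b′ → a ⊗ (b ⊕ ⊝ b′) ⊕ b′ ⊗ (a ⊕ ⊝ a′) , a ⊗ b ⊕ ⊝ (a′ ⊗ b′)) (⟦ e ⟧ ρ) _ _ _)
      (ℤ.∣m∣n⇒∣m+n (ℤ.∣n⇒∣m*n (⟦ e ⟧ ρ) (eval-≡ f ρ)) (ℤ.∣n⇒∣m*n (⟦ f ⟧ (residues ρ)) (eval-≡ e ρ)))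
  eval-≡ (⊝ e) ρ =
    subst (+ n ℤ.∣_) (ℤSolver.solve 2 (λ a a′ → ⊝ (a ⊕ ⊝ a′) , ⊝ a ⊕ ⊝ (⊝ a′)) (⟦ e ⟧ ρ) _)
      (ℤ.∣m⇒∣-m (eval-≡ e ρ))

  Implication : ∀ {k} → List (Expr k) → Expr k → Vec ℤ k → Set
  Implication []       g ρ = + n ℤ.∣ ⟦ g ⟧ ρ
  Implication (h ∷ hs) g ρ = + n ℤ.∣ ⟦ h ⟧ ρ → Implication hs g ρ

  implies-sound : ∀ {k} hs g (ρ : Vec ℤ k) → T (implies hs g (residues ρ)) → Implication hs g ρ
  implies-sound [] g ρ t =
    subst (+ n ℤ.∣_) (ℤSolver.solve 2 (λ a a′ → (a ⊕ ⊝ a′) ⊕ a′ , a) (⟦ g ⟧ ρ) _)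
      (ℤ.∣m∣n⇒∣m+n (eval-≡ g ρ) (divisible-sound _ t))
  implies-sound (h ∷ hs) g ρ t n∣h = implies-sound hs g ρ
    (holds (divisible (⟦ h ⟧ (residues ρ))) (divisible-complete _ (subst (+ n ℤ.∣_)
      (ℤSolver.solve 2 (λ a a′ → a ⊕ ⊝ (a ⊕ ⊝ a′) , a′) (⟦ h ⟧ ρ) _) (ℤ.∣m∣n⇒∣m-n n∣h (eval-≡ h ρ)))) t)
    where
    holds : ∀ b {c} → T b → T (if b then c else true) → T c
    holds true _ t = t

  -- Integer polynomials respect congruences, so the finitely many tuples of residues settle the
  -- implication for all integers; they are run through during type checking.
  modular : ∀ k (f : N-ary k (Expr k) (List (Expr k) × Expr k)) →
            let (hs , g) = f $ⁿ variables k in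
            {_ : T (allResidues k (implies hs g))} →
            ∀ⁿ k (curryⁿ (Implication hs g))
  modular k f {t} = ∀ⁿ-intro k _ λ ρ → implies-sound _ _ ρ (allResidues-sound k _ t ρ)

-- The cofactor is supplied as an expression, so the divisibility is a single ring identity. This
-- also serves divisors that are variables, such as π, π² and π³ below, where no residues can be
-- enumerated.
multiple-of : ∀ n (f : N-ary n (Expr n) (Expr n × Expr n × Expr n)) →
              let (e , d , k) = f $ⁿ variables n in
              {_ : T (sameNormalForm e (k ⊗ d))} →
              ∀ⁿ n (curryⁿ λ ρ → ℤSolver.⟦ d ⟧ ρ ℤ.∣ ℤSolver.⟦ e ⟧ ρ)
multiple-of n f {t} = ∀ⁿ-intro n _ λ ρ → divides (ℤSolver.⟦ k ⟧ ρ) (ℤSolver.ring-identity e (k ⊗ d) {t} ρ)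
  where
  e = proj₁ (f $ⁿ variables n)
  d = proj₁ (proj₂ (f $ⁿ variables n))
  k = proj₂ (proj₂ (f $ⁿ variables n))

∣-minus : ∀ {d} x y → d ℤ.∣ x → d ℤ.∣ (x ℤ.- y) → d ℤ.∣ y
∣-minus x y d∣x d∣x-y =
  subst (_ ℤ.∣_) (ℤSolver.solve 2 (λ x y → x ⊕ ⊝ (x ⊕ ⊝ y) , y) x y) (ℤ.∣m∣n⇒∣m-n d∣x d∣x-y)

∣-plus : ∀ {d} x y → d ℤ.∣ y → d ℤ.∣ (x ℤ.- y) → d ℤ.∣ x
∣-plus x y d∣y d∣x-y =
  subst (_ ℤ.∣_) (ℤSolver.solve 2 (λ x y → (x ⊕ ⊝ y) ⊕ y , x) x y) (ℤ.∣m∣n⇒∣m+n d∣x-y d∣y)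

-- Integral representations of field elements, and descent.

module _ {P : ℕ} (P-prime : Prime P) where

  prime-∣-* : ∀ x y → + P ℤ.∣ x ℤ.* y → + P ℤ.∣ x ⊎ + P ℤ.∣ y
  prime-∣-* x y P∣xy = Sum.map ℤ.∣ᵤ⇒∣ ℤ.∣ᵤ⇒∣
    (euclidsLemma ∣ x ∣ ∣ y ∣ P-prime (subst (P ℕ.∣_) (ℤ.abs-* x y) (ℤ.∣⇒∣ᵤ P∣xy)))

  prime-∣-cube : ∀ x → + P ℤ.∣ x ℤ.* x ℤ.* x → + P ℤ.∣ x
  prime-∣-cube x P∣x³ = [ (λ P∣x² → [ id , id ]′ (prime-∣-* x x P∣x²)) , id ]′ (prime-∣-* (x ℤ.* x) x P∣x³)

-- The element (u + v η + w η²) / m has characteristic polynomial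
-- x³ + c₂ x² + c₁ x + c₀, where η³ = p η² + q η + r.
record Represents (p q r c₀ c₁ c₂ u v w m : ℤ) : Set where
  constructor represents
  field
    trace-eq  : Z.trace  p q r u v w ≡ ℤ.- (c₂ ℤ.* m)
    minors-eq : Z.minors p q r u v w ≡ c₁ ℤ.* (m ℤ.* m)
    norm-eq   : Z.norm   p q r u v w ≡ ℤ.- (c₀ ℤ.* (m ℤ.* m ℤ.* m))

  -- The value of a characteristic polynomial at 1 is the norm of 1 - x, here with denominators
  -- cleared. Thus divisibility of F(1), like that of F(0), becomes a statement about a norm.
  norm-1- : Z.norm p q r (m ℤ.- u) (ℤ.- v) (ℤ.- w) ≡ (1ℤ ℤ.+ c₂ ℤ.+ c₁ ℤ.+ c₀) ℤ.* (m ℤ.* m ℤ.* m)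
  norm-1- = begin
    Z.norm p q r (m ℤ.- u) (ℤ.- v) (ℤ.- w)
      ≡⟨ ℤSolver.solve 7 (λ p q r u v w m → E.norm p q r (m ⊕ ⊝ u) (⊝ v) (⊝ w) ,
           m ⊗ m ⊗ m ⊕ ⊝ (E.trace p q r u v w ⊗ (m ⊗ m)) ⊕ E.minors p q r u v w ⊗ m ⊕ ⊝ E.norm p q r u v w)
           p q r u v w m ⟩
    m ℤ.* m ℤ.* m ℤ.- Z.trace p q r u v w ℤ.* (m ℤ.* m) ℤ.+ Z.minors p q r u v w ℤ.* m ℤ.- Z.norm p q r u v w
      ≡⟨ cong₂ ℤ._-_ (cong₂ (λ t s → m ℤ.* m ℤ.* m ℤ.- t ℤ.* (m ℤ.* m) ℤ.+ s ℤ.* m) trace-eq minors-eq) norm-eq ⟩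
    m ℤ.* m ℤ.* m ℤ.- ℤ.- (c₂ ℤ.* m) ℤ.* (m ℤ.* m) ℤ.+ c₁ ℤ.* (m ℤ.* m) ℤ.* m ℤ.- ℤ.- (c₀ ℤ.* (m ℤ.* m ℤ.* m))
      ≡⟨ ℤSolver.solve 4 (λ c₀ c₁ c₂ m →
           m ⊗ m ⊗ m ⊕ ⊝ (⊝ (c₂ ⊗ m) ⊗ (m ⊗ m)) ⊕ c₁ ⊗ (m ⊗ m) ⊗ m ⊕ ⊝ (⊝ (c₀ ⊗ (m ⊗ m ⊗ m))) ,
           (con 1ℤ ⊕ c₂ ⊕ c₁ ⊕ c₀) ⊗ (m ⊗ m ⊗ m)) c₀ c₁ c₂ m ⟩
    (1ℤ ℤ.+ c₂ ℤ.+ c₁ ℤ.+ c₀) ℤ.* (m ℤ.* m ℤ.* m) ∎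
    where open ≡-Reasoning

cancelˡ : ∀ k {x y} → k ≢ 0ℤ → k ℤ.* x ≡ k ℤ.* y → x ≡ y
cancelˡ k {x} {y} k≢0 = ℤ.*-cancelˡ-≡ k x y {{ℤ.≢-nonZero k≢0}}

*-≢0 : ∀ {x y} → x ≢ 0ℤ → y ≢ 0ℤ → x ℤ.* y ≢ 0ℤ
*-≢0 {x} x≢0 y≢0 xy≡0 = [ x≢0 , y≢0 ]′ (ℤ.i*j≡0⇒i≡0∨j≡0 x xy≡0)

-- Trace, minors and norm are homogeneous of degrees 1, 2 and 3, and so are the right hand sides in
-- m.
represents-cancel : ∀ {p q r c₀ c₁ c₂} k {u v w m} → k ≢ 0ℤ →
  Represents p q r c₀ c₁ c₂ (k ℤ.* u) (k ℤ.* v) (k ℤ.* w) (k ℤ.* m) → Represents p q r c₀ c₁ c₂ u v w m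
represents-cancel {p} {q} {r} {c₀} {c₁} {c₂} k {u} {v} {w} {m} k≢0 (represents t s n) = represents
  (cancelˡ k k≢0 (trans (sym (ℤSolver.solve 7 (λ p q r u v w k →
      E.trace p q r (k ⊗ u) (k ⊗ v) (k ⊗ w) , k ⊗ E.trace p q r u v w) p q r u v w k))
    (trans t (ℤSolver.solve 3 (λ c k m → ⊝ (c ⊗ (k ⊗ m)) , k ⊗ ⊝ (c ⊗ m)) c₂ k m))))
  (cancelˡ (k ℤ.* k) (*-≢0 k≢0 k≢0) (trans (sym (ℤSolver.solve 7 (λ p q r u v w k →
      E.minors p q r (k ⊗ u) (k ⊗ v) (k ⊗ w) , k ⊗ k ⊗ E.minors p q r u v w) p q r u v w k))
    (trans s (ℤSolver.solve 3 (λ c k m → c ⊗ (k ⊗ m ⊗ (k ⊗ m)) , k ⊗ k ⊗ (c ⊗ (m ⊗ m))) c₁ k m))))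
  (cancelˡ (k ℤ.* k ℤ.* k) (*-≢0 (*-≢0 k≢0 k≢0) k≢0) (trans (sym (ℤSolver.solve 7 (λ p q r u v w k →
      E.norm p q r (k ⊗ u) (k ⊗ v) (k ⊗ w) , k ⊗ k ⊗ k ⊗ E.norm p q r u v w) p q r u v w k))
    (trans n (ℤSolver.solve 3 (λ c k m → ⊝ (c ⊗ (k ⊗ m ⊗ (k ⊗ m) ⊗ (k ⊗ m))) , k ⊗ k ⊗ k ⊗ ⊝ (c ⊗ (m ⊗ m ⊗ m))) c₀ k m))))

AllDivisible : ℕ → ℤ → ℤ → ℤ → ℤ → Set
AllDivisible P u v w m = + P ℤ.∣ u × + P ℤ.∣ v × + P ℤ.∣ w × + P ℤ.∣ m

∣quotient∣< : ∀ {P} → 1 ℕ.< P → ∀ k → k ≢ 0ℤ → ∣ k ∣ ℕ.< ∣ + P ℤ.* k ∣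
∣quotient∣< {P} 1<P k k≢0 = begin-strict
  ∣ k ∣          ≡⟨ ℕ.*-identityˡ _ ⟨
  1 ℕ.* ∣ k ∣    <⟨ ℕ.*-monoˡ-< ∣ k ∣ {{ℤ.≢-nonZero k≢0}} 1<P ⟩
  P ℕ.* ∣ k ∣    ≡⟨ ℤ.abs-* (+ P) k ⟨
  ∣ + P ℤ.* k ∣  ∎
  where open ℕ.≤-Reasoning

factorʳ : ∀ {P k x} → x ≡ k ℤ.* + P → x ≡ + P ℤ.* k
factorʳ {P} {k} eq = trans eq (ℤ.*-comm k (+ P))

-- Dividing u, v, w, m by P makes the absolute value of m smaller unless m is 0. The conclusion is
-- `m ≡ 0ℤ` and not an absurdity because the zero quadruple is always a representation.
descent : ∀ {p q r c₀ c₁ c₂} P → 1 ℕ.< P →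
  (∀ {u v w m} → Represents p q r c₀ c₁ c₂ u v w m → AllDivisible P u v w m) →
  ∀ {u v w m} → Represents p q r c₀ c₁ c₂ u v w m → m ≡ 0ℤ
descent {p} {q} {r} {c₀} {c₁} {c₂} P 1<P step rep = go rep (<-wellFounded _)
  where
  P≢0 : + P ≢ 0ℤ
  P≢0 refl = contradiction 1<P λ ()
  go : ∀ {u v w m} → Represents p q r c₀ c₁ c₂ u v w m → Acc ℕ._<_ ∣ m ∣ → m ≡ 0ℤ
  go {m = m} rep (acc rs) with m ℤ.≟ 0ℤ
  ... | yes m≡0 = m≡0
  ... | no  m≢0 with step rep
  ... | divides u′ u-eq , divides v′ v-eq , divides w′ w-eq , divides m′ m-eq
    with refl ← factorʳ {P} {u′} u-eq | refl ← factorʳ {P} {v′} v-eq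
       | refl ← factorʳ {P} {w′} w-eq | refl ← factorʳ {P} {m′} m-eq
    = contradiction (trans (cong (+ P ℤ.*_) m′≡0) (ℤ.*-zeroʳ (+ P))) m≢0
    where
    m′≢0 : m′ ≢ 0ℤ
    m′≢0 refl = m≢0 (ℤ.*-zeroʳ (+ P))
    m′≡0 = go (represents-cancel (+ P) P≢0 rep) (rs (∣quotient∣< 1<P m′ m′≢0))

-- Norms from Eisenstein cubics.

module Eisenstein {P} (P-prime : Prime P) (p q r : ℤ) (P∤r : ¬ (+ P ℤ.∣ r))
  {c₀ c₁ c₂} (P∣c₀ : + P ℤ.∣ c₀) (P∣F1 : + P ℤ.∣ 1ℤ ℤ.+ c₂ ℤ.+ c₁ ℤ.+ c₀) where

  π = + P

  instance
    π≢0 : ℤ.NonZero π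
    π≢0 = prime⇒nonZero P-prime

  N : ℤ → ℤ → ℤ → ℤ
  N = Z.norm (π ℤ.* p) (π ℤ.* q) (π ℤ.* r)

  N≡u³ : ∀ u v w → π ℤ.∣ (N u v w ℤ.- u ℤ.* u ℤ.* u)
  N≡u³ = multiple-of 7 (λ π p q r u v w →
    E.norm (π ⊗ p) (π ⊗ q) (π ⊗ r) u v w ⊕ ⊝ (u ⊗ u ⊗ u) , π ,
    p ⊗ (v ⊗ u ⊗ u ⊕ π ⊗ p ⊗ w ⊗ u ⊗ u ⊕ ⊝ (π ⊗ q ⊗ u ⊗ v ⊗ w) ⊕ ⊝ (con (+ 2) ⊗ π ⊗ r ⊗ u ⊗ w ⊗ w) ⊕ π ⊗ r ⊗ v ⊗ v ⊗ w)
    ⊕ q ⊗ (con (+ 2) ⊗ u ⊗ u ⊗ w ⊕ ⊝ (u ⊗ v ⊗ v) ⊕ π ⊗ q ⊗ u ⊗ w ⊗ w ⊕ ⊝ (π ⊗ r ⊗ v ⊗ w ⊗ w))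
    ⊕ r ⊗ (⊝ (con (+ 3) ⊗ u ⊗ v ⊗ w) ⊕ v ⊗ v ⊗ v ⊕ π ⊗ r ⊗ w ⊗ w ⊗ w)) π p q r

  N≡πrv³ : ∀ u v w → π ℤ.* π ℤ.∣ (N (π ℤ.* u) v w ℤ.- π ℤ.* (r ℤ.* (v ℤ.* v ℤ.* v)))
  N≡πrv³ = multiple-of 7 (λ π p q r u v w →
    E.norm (π ⊗ p) (π ⊗ q) (π ⊗ r) (π ⊗ u) v w ⊕ ⊝ (π ⊗ (r ⊗ (v ⊗ v ⊗ v))) , π ⊗ π ,
    p ⊗ (r ⊗ v ⊗ v ⊗ w ⊕ π ⊗ (v ⊗ u ⊗ u ⊕ π ⊗ p ⊗ w ⊗ u ⊗ u ⊕ ⊝ (q ⊗ u ⊗ v ⊗ w) ⊕ ⊝ (con (+ 2) ⊗ r ⊗ u ⊗ w ⊗ w)))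
    ⊕ q ⊗ (⊝ (u ⊗ v ⊗ v) ⊕ ⊝ (r ⊗ v ⊗ w ⊗ w) ⊕ π ⊗ (con (+ 2) ⊗ u ⊗ u ⊗ w ⊕ q ⊗ u ⊗ w ⊗ w))
    ⊕ r ⊗ (r ⊗ w ⊗ w ⊗ w ⊕ ⊝ (con (+ 3) ⊗ u ⊗ v ⊗ w)) ⊕ π ⊗ u ⊗ u ⊗ u) π p q r

  N≡π²r²w³ : ∀ u v w → π ℤ.* π ℤ.* π ℤ.∣ (N (π ℤ.* u) (π ℤ.* v) w ℤ.- π ℤ.* π ℤ.* (r ℤ.* (r ℤ.* (w ℤ.* w ℤ.* w))))
  N≡π²r²w³ = multiple-of 7 (λ π p q r u v w →
    E.norm (π ⊗ p) (π ⊗ q) (π ⊗ r) (π ⊗ u) (π ⊗ v) w ⊕ ⊝ (π ⊗ π ⊗ (r ⊗ (r ⊗ (w ⊗ w ⊗ w)))) , π ⊗ π ⊗ π ,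
    u ⊗ u ⊗ u ⊕ q ⊗ w ⊗ (con (+ 2) ⊗ u ⊗ u ⊕ q ⊗ u ⊗ w ⊕ ⊝ (r ⊗ v ⊗ w))
    ⊕ ⊝ (r ⊗ u ⊗ w ⊗ (con (+ 2) ⊗ p ⊗ w ⊕ con (+ 3) ⊗ v))
    ⊕ π ⊗ (p ⊗ (r ⊗ v ⊗ v ⊗ w ⊕ ⊝ (q ⊗ u ⊗ v ⊗ w) ⊕ u ⊗ u ⊗ v ⊕ p ⊗ u ⊗ u ⊗ w) ⊕ r ⊗ v ⊗ v ⊗ v ⊕ ⊝ (q ⊗ u ⊗ v ⊗ v))) π p q r

  Rep = Represents (π ℤ.* p) (π ℤ.* q) (π ℤ.* r) c₀ c₁ c₂

  module _ {u v w m} (rep : Rep u v w m) where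

    open Represents rep

    π∣u : π ℤ.∣ u
    π∣u = prime-∣-cube P-prime u (∣-minus (N u v w) _
      (subst (π ℤ.∣_) (sym norm-eq) (ℤ.∣m⇒∣-m (ℤ.∣m⇒∣m*n _ P∣c₀))) (N≡u³ u v w))

    π∣m : π ℤ.∣ m
    π∣m = ∣-plus m u π∣u (prime-∣-cube P-prime (m ℤ.- u) (∣-minus (N (m ℤ.- u) (ℤ.- v) (ℤ.- w)) _
      (subst (π ℤ.∣_) (sym norm-1-) (ℤ.∣m⇒∣m*n _ P∣F1)) (N≡u³ (m ℤ.- u) (ℤ.- v) (ℤ.- w))))

    π³∣N : π ℤ.* π ℤ.* π ℤ.∣ N u v w
    π³∣N = subst (π ℤ.* π ℤ.* π ℤ.∣_) (sym norm-eq) (ℤ.∣m⇒∣-m (ℤ.∣n⇒∣m*n c₀ (cube π∣m)))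
      where
      cube : π ℤ.∣ m → π ℤ.* π ℤ.* π ℤ.∣ m ℤ.* m ℤ.* m
      cube (divides k refl) = divides (k ℤ.* k ℤ.* k)
        (ℤSolver.solve 2 (λ k π → k ⊗ π ⊗ (k ⊗ π) ⊗ (k ⊗ π) , k ⊗ k ⊗ k ⊗ (π ⊗ π ⊗ π)) k π)

  -- Modulo π the norm is u³, so P ∣ F(0) gives π ∣ u, and P ∣ F(1) gives π ∣ m - u. Only then is π³
  -- ∣ m³ available, hence π³ ∣ N. The terms u³, π r v³, π² r² w³ have valuations in different
  -- classes modulo 3, so π³ ∣ N forces π to divide v and then w.
  step : ∀ {u v w m} → Rep u v w m → AllDivisible P u v w m
  step {u} {v} {w} {m} rep = go (π∣u rep)
    where
    go : π ℤ.∣ u → AllDivisible P u v w m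
    go (divides u′ eq) with refl ← factorʳ {P} {u′} eq = π∣u rep , π∣v , π∣w π∣v , π∣m rep
      where
      π∣v : π ℤ.∣ v
      π∣v = [ (λ P∣r → contradiction P∣r P∤r) , prime-∣-cube P-prime v ]′
        (prime-∣-* P-prime r _ (ℤ.*-cancelˡ-∣ π (∣-minus (N u v w) _
          (ℤ.∣-trans (ℤ.divides π (ℤ.*-assoc π π π)) (π³∣N rep)) (N≡πrv³ u′ v w))))
      π∣w : π ℤ.∣ v → π ℤ.∣ w
      π∣w (divides v′ eq) with refl ← factorʳ {P} {v′} eq =
        [ no-r , [ no-r , prime-∣-cube P-prime w ]′ ∘ prime-∣-* P-prime r _ ]′
          (prime-∣-* P-prime r _ (ℤ.*-cancelˡ-∣ π (ℤ.*-cancelˡ-∣ π (∣-resp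
            (ℤSolver.solve 1 (λ π → π ⊗ π ⊗ π , π ⊗ (π ⊗ π)) π)
            (ℤ.*-assoc π π _)
            (∣-minus (N u v w) _ (π³∣N rep) (N≡π²r²w³ u′ v′ w))))))
        where
        no-r : π ℤ.∣ r → π ℤ.∣ w
        no-r P∣r = contradiction P∣r P∤r
        ∣-resp : ∀ {x x′ y y′} → x ≡ x′ → y ≡ y′ → x ℤ.∣ y → x′ ℤ.∣ y′
        ∣-resp refl refl d = d

  m≡0 : ∀ {u v w m} → Rep u v w m → m ≡ 0ℤ
  m≡0 = descent P (ℕ.nonTrivial⇒n>1 P {{prime⇒nonTrivial P-prime}}) step

module Mod2  = ModularCheck 2
module Mod3  = ModularCheck 3
module Mod27 = ModularCheck 27

prime-2 : Prime 2
prime-2 = toWitness {a? = prime? 2} _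

prime-3 : Prime 3
prime-3 = toWitness {a? = prime? 3} _

-- Orders and valuations of integers.

largestExponent-∣ : ∀ p m b → p ℕ.^ largestExponent p m b ℕ.∣ m
largestExponent-∣ p m zero = ℕ.1∣ m
largestExponent-∣ p m (suc b) with (p ℕ.^ suc b) ℕ.∣? m
... | yes pᵇ∣m = pᵇ∣m
... | no  _    = largestExponent-∣ p m b

largestExponent-max : ∀ p m b {k} → k ℕ.≤ b → p ℕ.^ k ℕ.∣ m → k ℕ.≤ largestExponent p m b
largestExponent-max p m zero    z≤n  _    = z≤n
largestExponent-max p m (suc b) {k} k≤1+b pᵏ∣m with (p ℕ.^ suc b) ℕ.∣? m
... | yes _    = k≤1+b
... | no  p∤m with k ℕ.≟ suc b
...   | yes refl = contradiction pᵏ∣m p∤m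
...   | no  k≢   = largestExponent-max p m b (ℕ.≤-pred (ℕ.≤∧≢⇒< k≤1+b k≢)) pᵏ∣m

infix 9 _^ᶻ_
_^ᶻ_ : ℕ → ℕ → ℤ
p ^ᶻ k = + (p ℕ.^ k)

^ᶻ-suc : ∀ p k → p ^ᶻ suc k ≡ + p ℤ.* p ^ᶻ k
^ᶻ-suc p k = ℤ.pos-* p (p ℕ.^ k)

^ᶻ-mono-∣ : ∀ p {j k} → j ℕ.≤ k → p ^ᶻ j ℤ.∣ p ^ᶻ k
^ᶻ-mono-∣ p {j} {k} j≤k = divides (p ^ᶻ (k ℕ.∸ j)) (trans
  (cong (λ e → + (p ℕ.^ e)) (sym (ℕ.m∸n+n≡m j≤k)))
  (trans (cong +_ (ℕ.^-distribˡ-+-* p (k ℕ.∸ j) j)) (ℤ.pos-* (p ℕ.^ (k ℕ.∸ j)) (p ℕ.^ j))))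

n<p^n : ∀ {p} → 1 ℕ.< p → ∀ n → n ℕ.< p ℕ.^ n
n<p^n 1<p zero    = s≤s z≤n
n<p^n {p} 1<p (suc n) = begin-strict
  suc n            ≤⟨ n<p^n 1<p n ⟩
  p ℕ.^ n          ≡⟨ ℕ.*-identityˡ _ ⟨
  1 ℕ.* p ℕ.^ n    <⟨ ℕ.*-monoˡ-< (p ℕ.^ n) {{ℕ.m^n≢0 p n {{ℕ.>-nonZero (ℕ.<-trans (s≤s z≤n) 1<p)}}}} 1<p ⟩
  p ℕ.* p ℕ.^ n    ∎
  where open ℕ.≤-Reasoning

ord-∣ : ∀ p n → p ^ᶻ ord p n ℤ.∣ n
ord-∣ p n = ℤ.∣ᵤ⇒∣ (largestExponent-∣ p ∣ n ∣ ∣ n ∣)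

module _ {p} (1<p : 1 ℕ.< p) where

  ord-max : ∀ {n k} → n ≢ 0ℤ → p ^ᶻ k ℤ.∣ n → k ℕ.≤ ord p n
  ord-max {n} {k} n≢0 pᵏ∣n = largestExponent-max p ∣ n ∣ ∣ n ∣
    (ℕ.≤-trans (ℕ.<⇒≤ (n<p^n 1<p k)) (ℕ.∣⇒≤ {{ℤ.≢-nonZero n≢0}} (ℤ.∣⇒∣ᵤ pᵏ∣n)))
    (ℤ.∣⇒∣ᵤ pᵏ∣n)

  ord-< : ∀ {n k} → ¬ (p ^ᶻ k ℤ.∣ n) → ord p n ℕ.< k
  ord-< {n} {k} pᵏ∤n = ℕ.≰⇒> λ k≤ord → pᵏ∤n (ℤ.∣-trans (^ᶻ-mono-∣ p k≤ord) (ord-∣ p n))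

  ord-≡ : ∀ {n k} → n ≢ 0ℤ → p ^ᶻ k ℤ.∣ n → ¬ (p ^ᶻ suc k ℤ.∣ n) → ord p n ≡ k
  ord-≡ n≢0 pᵏ∣n pᵏ⁺¹∤n = ℕ.≤-antisym (ℕ.≤-pred (ord-< pᵏ⁺¹∤n)) (ord-max n≢0 pᵏ∣n)

  v-<⇒∤ : ∀ {n k} → v p n <⁺ [ k ] → ¬ (p ^ᶻ k ℤ.∣ n)
  v-<⇒∤ {n} v<k pᵏ∣n with n ℤ.≟ 0ℤ | v<k
  ... | yes _   | ()
  ... | no  n≢0 | [ ord<k ] = ℕ.<⇒≱ ord<k (ord-max n≢0 pᵏ∣n)

  ∣⇒<-v : ∀ {n k} → p ^ᶻ suc k ℤ.∣ n → [ k ] <⁺ v p n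
  ∣⇒<-v {n} pᵏ⁺¹∣n with n ℤ.≟ 0ℤ
  ... | yes _   = [ _ ]<⊤⁺
  ... | no  n≢0 = [ ord-max n≢0 pᵏ⁺¹∣n ]

  <-v⇒∣ : ∀ {n k} → [ k ] <⁺ v p n → p ^ᶻ suc k ℤ.∣ n
  <-v⇒∣ {n} k<v with n ℤ.≟ 0ℤ | k<v
  ... | yes refl | _         = divides 0ℤ refl
  ... | no  _    | [ k<ord ] = ℤ.∣-trans (^ᶻ-mono-∣ p k<ord) (ord-∣ p n)

  v-≡ : ∀ {n k} → p ^ᶻ k ℤ.∣ n → ¬ (p ^ᶻ suc k ℤ.∣ n) → v p n ≡ [ k ]
  v-≡ {n} pᵏ∣n pᵏ⁺¹∤n with n ℤ.≟ 0ℤ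
  ... | yes refl = contradiction (divides 0ℤ refl) pᵏ⁺¹∤n
  ... | no  n≢0  = cong [_] (ord-≡ n≢0 pᵏ∣n pᵏ⁺¹∤n)

  v-≡⇒ : ∀ {n k} → v p n ≡ [ k ] → p ^ᶻ k ℤ.∣ n × ¬ (p ^ᶻ suc k ℤ.∣ n)
  v-≡⇒ {n} v≡k with n ℤ.≟ 0ℤ | v≡k
  ... | no n≢0 | refl = ord-∣ p n , λ pᵏ⁺¹∣n → ℕ.<⇒≱ (ℕ.n<1+n _) (ord-max n≢0 pᵏ⁺¹∣n)

/ℕ-exact : ∀ n d .{{_ : NonZero d}} → + d ℤ.∣ n → n ≡ (n ℤ./ℕ d) ℤ.* + d
/ℕ-exact n d d∣n = trans (ℤ.a≡a%ℕn+[a/ℕn]*n n d)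
  (trans (cong (λ r → + r ℤ.+ (n ℤ./ℕ d) ℤ.* + d) remainder≡0) (ℤ.+-identityˡ _))
  where
  d∣remainder : + d ℤ.∣ + (n ℤ.%ℕ d)
  d∣remainder = ℤ.∣m+n∣n⇒∣m (subst (+ d ℤ.∣_) (ℤ.a≡a%ℕn+[a/ℕn]*n n d) d∣n) (divides (n ℤ./ℕ d) refl)
  remainder≡0 : n ℤ.%ℕ d ≡ 0
  remainder≡0 = [ id , (λ where (d≢0 , d≤r) → contradiction d≤r (ℕ.<⇒≱ (ℤ.n%ℕd<d n d))) ]′
    (small (n ℤ.%ℕ d) (ℤ.∣⇒∣ᵤ d∣remainder))
    where
    small : ∀ r → d ℕ.∣ r → r ≡ 0 ⊎ (r ≢ 0 × d ℕ.≤ r)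
    small zero    _   = inj₁ refl
    small (suc r) d∣r = inj₂ ((λ ()) , ℕ.∣⇒≤ d∣r)

module _ (a b : ℤ) where

  Δ-factored : Δ a b ≡ 3 ^ᶻ s₃ a b ℤ.* Δ₃ a b
  Δ-factored = trans (/ℕ-exact (Δ a b) (3 ℕ.^ s₃ a b) {{ℕ.m^n≢0 3 (s₃ a b)}} (ord-∣ 3 (Δ a b))) (ℤ.*-comm (Δ₃ a b) (3 ^ᶻ s₃ a b))

  3∤Δ₃ : Δ a b ≢ 0ℤ → ¬ (+ 3 ℤ.∣ Δ₃ a b)
  3∤Δ₃ Δ≢0 (divides k eq) = ℕ.<⇒≱ (ℕ.n<1+n _) (ord-max {3} (s≤s (s≤s z≤n)) Δ≢0 (divides k (begin
    Δ a b                                  ≡⟨ Δ-factored ⟩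
    3 ^ᶻ s₃ a b ℤ.* Δ₃ a b                 ≡⟨ cong (3 ^ᶻ s₃ a b ℤ.*_) eq ⟩
    3 ^ᶻ s₃ a b ℤ.* (k ℤ.* + 3)            ≡⟨ ℤSolver.solve 3 (λ x k t → x ⊗ (k ⊗ t) , k ⊗ (t ⊗ x)) (3 ^ᶻ s₃ a b) k (+ 3) ⟩
    k ℤ.* (+ 3 ℤ.* 3 ^ᶻ s₃ a b)            ≡⟨ cong (k ℤ.*_) (^ᶻ-suc 3 (s₃ a b)) ⟨
    k ℤ.* 3 ^ᶻ suc (s₃ a b)                ∎)))
    where open ≡-Reasoning

odd⇒≡1 : ∀ x → ¬ (+ 2 ℤ.∣ x) → + 2 ℤ.∣ (x ℤ.- 1ℤ)
odd⇒≡1 x 2∤x = [ (λ d → contradiction d 2∤x) , id ]′ (prime-∣-* prime-2 x _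
  (Mod2.modular 1 (λ x → [] , x ⊗ (x ⊕ ⊝ con 1ℤ)) x))

3∣x²⇒3∣x : ∀ x → + 3 ℤ.∣ x ℤ.* x → + 3 ℤ.∣ x
3∣x²⇒3∣x = Mod3.modular 1 λ x → x ⊗ x ∷ [] , x

3∤⇒x²≡1 : ∀ x → ¬ (+ 3 ℤ.∣ x) → + 3 ℤ.∣ (x ℤ.* x ℤ.- 1ℤ)
3∤⇒x²≡1 x 3∤x = [ (λ d → contradiction d 3∤x) , id ]′ (prime-∣-* prime-3 x _
  (Mod3.modular 1 (λ x → [] , x ⊗ (x ⊗ x ⊕ ⊝ con 1ℤ)) x))

3∣-factors : ∀ {x} y → ¬ (+ 3 ℤ.∣ x) → + 3 ℤ.∣ x ℤ.* (y ℤ.* y) → + 3 ℤ.∣ y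
3∣-factors {x} y 3∤x d = [ (λ 3∣x → contradiction 3∣x 3∤x) , 3∣x²⇒3∣x y ]′ (prime-∣-* prime-3 x _ d)

-- The squares change neither the parity of the 3-adic valuation nor the leading 3-adic digit.
square-class : ∀ s {d e} → + 3 ℤ.∣ (d ℤ.- 1ℤ) → ¬ (+ 3 ℤ.∣ e) → ∀ M I → M ≢ 0ℤ →
  d ℤ.* (M ℤ.* M) ≡ 3 ^ᶻ s ℤ.* e ℤ.* (I ℤ.* I) → 2 ℕ.∣ s × + 3 ℤ.∣ (e ℤ.- 1ℤ)
square-class s {d} {e} d≡1 3∤e M I M≢0 eq = go s _ refl M I M≢0 eq (<-wellFounded _)
  where
  Conclusion : ℕ → Set
  Conclusion s = 2 ℕ.∣ s × + 3 ℤ.∣ (e ℤ.- 1ℤ)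

  3∤d : ¬ (+ 3 ℤ.∣ d)
  3∤d 3∣d = contradiction (∣-minus d 1ℤ 3∣d d≡1) (λ 3∣1 → contradiction (ℕ.∣⇒≤ (ℤ.∣⇒∣ᵤ 3∣1)) λ { (s≤s ()) })

  go : ∀ s K → K ≡ 3 ^ᶻ s → ∀ M I → M ≢ 0ℤ → d ℤ.* (M ℤ.* M) ≡ K ℤ.* e ℤ.* (I ℤ.* I) →
       Acc ℕ._<_ ∣ M ∣ → Conclusion s
  go s K K≡ M I M≢0 eq (acc rs) with + 3 ℤ.∣? M
  go zero K refl M I M≢0 eq (acc rs) | no 3∤M = 2 ℕ.∣0 ,
    Mod3.modular 4 (λ M d e I → M ⊗ M ⊕ ⊝ con 1ℤ ∷ d ⊕ ⊝ con 1ℤ ∷ d ⊗ (M ⊗ M) ⊕ ⊝ (con 1ℤ ⊗ e ⊗ (I ⊗ I)) ∷ [] , e ⊕ ⊝ con 1ℤ)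
      M d e I (3∤⇒x²≡1 M 3∤M) d≡1 (divides 0ℤ (ℤ.i≡j⇒i-j≡0 eq))
  go (suc s) K K≡ M I M≢0 eq (acc rs) | no 3∤M = contradiction (3∣-factors M 3∤d
    (subst (+ 3 ℤ.∣_) (sym eq) (ℤ.∣m⇒∣m*n _ (ℤ.∣m⇒∣m*n e
      (subst (+ 3 ℤ.∣_) (sym (trans K≡ (^ᶻ-suc 3 s))) (ℤ.∣m⇒∣m*n (3 ^ᶻ s) (ℤ.∣-refl {+ 3}))))))) 3∤M
  go s K K≡ M I M≢0 eq (acc rs) | yes (divides M′ M-eq) with refl ← factorʳ {3} {M′} M-eq = descend s K K≡ eq
    where
    M′≢0 : M′ ≢ 0ℤ
    M′≢0 refl = M≢0 (ℤ.*-zeroʳ (+ 3))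

    smaller : ∣ M′ ∣ ℕ.< ∣ + 3 ℤ.* M′ ∣
    smaller = ∣quotient∣< {3} (s≤s (s≤s z≤n)) M′ M′≢0

    9∣lhs : + 9 ℤ.∣ d ℤ.* (+ 3 ℤ.* M′ ℤ.* (+ 3 ℤ.* M′))
    9∣lhs = multiple-of 2 (λ d M → d ⊗ (con (+ 3) ⊗ M ⊗ (con (+ 3) ⊗ M)) , con (+ 9) , d ⊗ M ⊗ M) d M′

    cancel-9 : ∀ x → d ℤ.* (+ 3 ℤ.* M′ ℤ.* (+ 3 ℤ.* M′)) ≡ + 9 ℤ.* x → d ℤ.* (M′ ℤ.* M′) ≡ x
    cancel-9 x eq = cancelˡ (+ 9) (λ ())
      (trans (ℤSolver.solve 2 (λ d M → con (+ 9) ⊗ (d ⊗ (M ⊗ M)) , d ⊗ (con (+ 3) ⊗ M ⊗ (con (+ 3) ⊗ M))) d M′) eq)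

    divideI : ∀ s K → K ≡ 3 ^ᶻ s → + 3 ℤ.∣ I →
              d ℤ.* (+ 3 ℤ.* M′ ℤ.* (+ 3 ℤ.* M′)) ≡ K ℤ.* e ℤ.* (I ℤ.* I) → Conclusion s
    divideI s K K≡ (divides I′ I-eq) eq with refl ← factorʳ {3} {I′} I-eq = go s K K≡ M′ I′ M′≢0
      (cancel-9 (K ℤ.* e ℤ.* (I′ ℤ.* I′)) (trans eq (ℤSolver.solve 2 (λ x I →
        x ⊗ (con (+ 3) ⊗ I ⊗ (con (+ 3) ⊗ I)) , con (+ 9) ⊗ (x ⊗ (I ⊗ I))) (K ℤ.* e) I′))) (rs smaller)

    descend : ∀ s K → K ≡ 3 ^ᶻ s → d ℤ.* (+ 3 ℤ.* M′ ℤ.* (+ 3 ℤ.* M′)) ≡ K ℤ.* e ℤ.* (I ℤ.* I) → Conclusion s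
    -- The factor 9 coming from M² is cancelled. For s ≤ 1 it must come out of I², as 3 ∤ e; for s ≥
    -- 2 it is taken out of 3ˢ, which keeps the parity of s.
    descend zero K refl eq = divideI 0 K refl (3∣-factors I 3∤e (subst (+ 3 ℤ.∣_)
      (trans eq (cong (ℤ._* (I ℤ.* I)) (ℤ.*-identityˡ e))) (ℤ.∣-trans (divides (+ 3) refl) 9∣lhs))) eq
    descend (suc zero) K refl eq = divideI 1 K refl (3∣-factors I 3∤e (ℤ.*-cancelˡ-∣ (+ 3)
      (subst (+ 9 ℤ.∣_) (trans eq (ℤ.*-assoc (+ 3) e (I ℤ.* I))) 9∣lhs))) eq
    descend (suc (suc s)) K K≡ eq = Product.map₁ (ℕ.∣m∣n⇒∣m+n (ℕ.divides 1 refl)) (go s (3 ^ᶻ s) refl M′ I M′≢0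
      (cancel-9 (3 ^ᶻ s ℤ.* e ℤ.* (I ℤ.* I)) (trans eq (trans
        (cong (λ x → x ℤ.* e ℤ.* (I ℤ.* I)) (trans K≡ (trans (^ᶻ-suc 3 (suc s)) (cong (+ 3 ℤ.*_) (^ᶻ-suc 3 s)))))
        (ℤSolver.solve 3 (λ x e I → con (+ 3) ⊗ (con (+ 3) ⊗ x) ⊗ e ⊗ (I ⊗ I) , con (+ 9) ⊗ (x ⊗ e ⊗ (I ⊗ I))) (3 ^ᶻ s) e I))))
      (rs smaller))

-- Changes of the generator of the cubic field.

represents-rescale : ∀ {p q r p′ q′ r′ c₀ c₁ c₂} k {u v w m} u′ v′ w′ →
  Z.trace  p′ q′ r′ u′ v′ w′ ≡ k ℤ.* Z.trace p q r u v w →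
  Z.minors p′ q′ r′ u′ v′ w′ ≡ k ℤ.* k ℤ.* Z.minors p q r u v w →
  Z.norm   p′ q′ r′ u′ v′ w′ ≡ k ℤ.* k ℤ.* k ℤ.* Z.norm p q r u v w →
  Represents p q r c₀ c₁ c₂ u v w m → Represents p′ q′ r′ c₀ c₁ c₂ u′ v′ w′ (k ℤ.* m)
represents-rescale {c₀ = c₀} {c₁} {c₂} k {m = m} _ _ _ t s n (represents t-eq s-eq n-eq) = represents
  (trans t (trans (cong (k ℤ.*_) t-eq) (ℤSolver.solve 3 (λ k c m → k ⊗ ⊝ (c ⊗ m) , ⊝ (c ⊗ (k ⊗ m))) k c₂ m)))
  (trans s (trans (cong (k ℤ.* k ℤ.*_) s-eq)
    (ℤSolver.solve 3 (λ k c m → k ⊗ k ⊗ (c ⊗ (m ⊗ m)) , c ⊗ (k ⊗ m ⊗ (k ⊗ m))) k c₁ m)))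
  (trans n (trans (cong (k ℤ.* k ℤ.* k ℤ.*_) n-eq)
    (ℤSolver.solve 3 (λ k c m → k ⊗ k ⊗ k ⊗ ⊝ (c ⊗ (m ⊗ m ⊗ m)) , ⊝ (c ⊗ (k ⊗ m ⊗ (k ⊗ m) ⊗ (k ⊗ m)))) k c₀ m)))

-- θ = k + ζ
represents-translate : ∀ {a ρ c₀ c₁ c₂ u v w m} k p q r → p ≡ ℤ.- (+ 3 ℤ.* k) →
  a ≡ q ℤ.+ + 3 ℤ.* (k ℤ.* k) → ρ ≡ r ℤ.+ k ℤ.* k ℤ.* k ℤ.- a ℤ.* k →
  Represents 0ℤ a ρ c₀ c₁ c₂ u v w m →
  Represents p q r c₀ c₁ c₂ (u ℤ.+ k ℤ.* v ℤ.+ k ℤ.* k ℤ.* w) (v ℤ.+ + 2 ℤ.* (k ℤ.* w)) w (1ℤ ℤ.* m)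
represents-translate {u = u} {v} {w} k p q r refl refl refl rep = represents-rescale 1ℤ _ _ _
  (ℤSolver.solve 6 (λ k q r u v w → E.trace (⊝ (con (+ 3) ⊗ k)) q r (u ⊕ k ⊗ v ⊕ k ⊗ k ⊗ w) (v ⊕ con (+ 2) ⊗ (k ⊗ w)) w ,
     con 1ℤ ⊗ E.trace (con 0ℤ) (a′ k q) (ρ′ k q r) u v w) k q r u v w)
  (ℤSolver.solve 6 (λ k q r u v w → E.minors (⊝ (con (+ 3) ⊗ k)) q r (u ⊕ k ⊗ v ⊕ k ⊗ k ⊗ w) (v ⊕ con (+ 2) ⊗ (k ⊗ w)) w ,
     con 1ℤ ⊗ con 1ℤ ⊗ E.minors (con 0ℤ) (a′ k q) (ρ′ k q r) u v w) k q r u v w)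
  (ℤSolver.solve 6 (λ k q r u v w → E.norm (⊝ (con (+ 3) ⊗ k)) q r (u ⊕ k ⊗ v ⊕ k ⊗ k ⊗ w) (v ⊕ con (+ 2) ⊗ (k ⊗ w)) w ,
     con 1ℤ ⊗ con 1ℤ ⊗ con 1ℤ ⊗ E.norm (con 0ℤ) (a′ k q) (ρ′ k q r) u v w) k q r u v w)
  rep
  where
  a′ : ∀ {n} (k q : Expr n) → Expr n
  a′ k q = q ⊕ con (+ 3) ⊗ (k ⊗ k)
  ρ′ : ∀ {n} (k q r : Expr n) → Expr n
  ρ′ k q r = r ⊕ k ⊗ k ⊗ k ⊕ ⊝ (a′ k q ⊗ k)

-- θ = k + 3 ζ
represents-dilate : ∀ {a ρ c₀ c₁ c₂ u v w m} k q r →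
  a ≡ + 9 ℤ.* q ℤ.+ + 3 ℤ.* (k ℤ.* k) → ρ ≡ + 27 ℤ.* r ℤ.+ k ℤ.* k ℤ.* k ℤ.- a ℤ.* k →
  Represents 0ℤ a ρ c₀ c₁ c₂ u v w m →
  Represents (ℤ.- k) q r c₀ c₁ c₂ (u ℤ.+ k ℤ.* v ℤ.+ k ℤ.* k ℤ.* w)
    (+ 3 ℤ.* (v ℤ.+ + 2 ℤ.* (k ℤ.* w))) (+ 9 ℤ.* w) (1ℤ ℤ.* m)
represents-dilate {u = u} {v} {w} k q r refl refl rep = represents-rescale 1ℤ _ _ _
  (ℤSolver.solve 6 (λ k q r u v w → E.trace (⊝ k) q r (u ⊕ k ⊗ v ⊕ k ⊗ k ⊗ w) (con (+ 3) ⊗ (v ⊕ con (+ 2) ⊗ (k ⊗ w))) (con (+ 9) ⊗ w) ,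
     con 1ℤ ⊗ E.trace (con 0ℤ) (a′ k q) (ρ′ k q r) u v w) k q r u v w)
  (ℤSolver.solve 6 (λ k q r u v w → E.minors (⊝ k) q r (u ⊕ k ⊗ v ⊕ k ⊗ k ⊗ w) (con (+ 3) ⊗ (v ⊕ con (+ 2) ⊗ (k ⊗ w))) (con (+ 9) ⊗ w) ,
     con 1ℤ ⊗ con 1ℤ ⊗ E.minors (con 0ℤ) (a′ k q) (ρ′ k q r) u v w) k q r u v w)
  (ℤSolver.solve 6 (λ k q r u v w → E.norm (⊝ k) q r (u ⊕ k ⊗ v ⊕ k ⊗ k ⊗ w) (con (+ 3) ⊗ (v ⊕ con (+ 2) ⊗ (k ⊗ w))) (con (+ 9) ⊗ w) ,
     con 1ℤ ⊗ con 1ℤ ⊗ con 1ℤ ⊗ E.norm (con 0ℤ) (a′ k q) (ρ′ k q r) u v w) k q r u v w)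
  rep
  where
  a′ : ∀ {n} (k q : Expr n) → Expr n
  a′ k q = con (+ 9) ⊗ q ⊕ con (+ 3) ⊗ (k ⊗ k)
  ρ′ : ∀ {n} (k q r : Expr n) → Expr n
  ρ′ k q r = con (+ 27) ⊗ r ⊕ k ⊗ k ⊗ k ⊕ ⊝ (a′ k q ⊗ k)

-- θ² / π generates an Eisenstein extension when π² divides a and exactly
-- divides b.
represents-square : ∀ {c₀ c₁ c₂ u v w m} π a b →
  Represents 0ℤ (π ℤ.* π ℤ.* a) (ℤ.- (π ℤ.* π ℤ.* b)) c₀ c₁ c₂ u v w m →
  Represents (π ℤ.* (+ 2 ℤ.* a)) (π ℤ.* (ℤ.- (π ℤ.* (a ℤ.* a)))) (π ℤ.* (b ℤ.* b)) c₀ c₁ c₂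
    (b ℤ.* u) (π ℤ.* (b ℤ.* w ℤ.+ a ℤ.* v)) (ℤ.- v) (b ℤ.* m)
represents-square {u = u} {v} {w} π a b rep = represents-rescale b _ _ _
  (ℤSolver.solve 6 (λ π a b u v w →
     E.trace (p′ π a) (q′ π a) (r′ π b) (b ⊗ u) (π ⊗ (b ⊗ w ⊕ a ⊗ v)) (⊝ v) ,
     b ⊗ E.trace (con 0ℤ) (π ⊗ π ⊗ a) (⊝ (π ⊗ π ⊗ b)) u v w) π a b u v w)
  (ℤSolver.solve 6 (λ π a b u v w →
     E.minors (p′ π a) (q′ π a) (r′ π b) (b ⊗ u) (π ⊗ (b ⊗ w ⊕ a ⊗ v)) (⊝ v) ,
     b ⊗ b ⊗ E.minors (con 0ℤ) (π ⊗ π ⊗ a) (⊝ (π ⊗ π ⊗ b)) u v w) π a b u v w)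
  (ℤSolver.solve 6 (λ π a b u v w →
     E.norm (p′ π a) (q′ π a) (r′ π b) (b ⊗ u) (π ⊗ (b ⊗ w ⊕ a ⊗ v)) (⊝ v) ,
     b ⊗ b ⊗ b ⊗ E.norm (con 0ℤ) (π ⊗ π ⊗ a) (⊝ (π ⊗ π ⊗ b)) u v w) π a b u v w)
  rep
  where
  p′ q′ : ∀ {n} (π a : Expr n) → Expr n
  p′ π a = π ⊗ (con (+ 2) ⊗ a)
  q′ π a = π ⊗ (⊝ (π ⊗ (a ⊗ a)))
  r′ : ∀ {n} (π b : Expr n) → Expr n
  r′ π b = π ⊗ (b ⊗ b)

-- Cubics with P² exactly dividing b, and necessity of the condition at 2.

module _ {P} (P-prime : Prime P) {c₀ c₁ c₂}
  (P∣c₀ : + P ℤ.∣ c₀) (P∣F1 : + P ℤ.∣ 1ℤ ℤ.+ c₂ ℤ.+ c₁ ℤ.+ c₀) where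

  -- With a = P² a′, b = P² b′ and ζ = θ² / P one has b′ θ = P a′ ζ - ζ². Passing to the generator ζ
  -- therefore costs a denominator b′, the descent yields b′ m = 0, and P ∤ b′ gives m = 0.
  no-representation-pure : ∀ {a b u v w m} → + P ℤ.* + P ℤ.∣ a → + P ℤ.* + P ℤ.∣ b → ¬ (+ P ℤ.* (+ P ℤ.* + P) ℤ.∣ b) →
    Represents 0ℤ a (ℤ.- b) c₀ c₁ c₂ u v w m → m ≡ 0ℤ
  no-representation-pure {m = m} (divides a′ a-eq) (divides b′ b-eq) P³∤b rep
    with refl ← trans a-eq (ℤ.*-comm a′ _) | refl ← trans b-eq (ℤ.*-comm b′ _) =
    [ (λ b′≡0 → contradiction (subst (+ P ℤ.∣_) (sym b′≡0) (divides 0ℤ refl)) P∤b′) , id ]′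
      (ℤ.i*j≡0⇒i≡0∨j≡0 b′ (Eisenstein.m≡0 P-prime _ _ (b′ ℤ.* b′)
        ([ P∤b′ , P∤b′ ]′ ∘ prime-∣-* P-prime b′ b′) P∣c₀ P∣F1 (represents-square (+ P) a′ b′ rep)))
    where
    P∤b′ : ¬ (+ P ℤ.∣ b′)
    P∤b′ (divides k refl) = P³∤b (divides k (ℤSolver.solve 2 (λ π k → π ⊗ π ⊗ (k ⊗ π) , k ⊗ (π ⊗ (π ⊗ π))) (+ P) k))

-- For a and b both odd the cubic is irreducible modulo 2. For both even: 4 ∤ b gives an Eisenstein
-- cubic; 4 ∣ b with 4 ∤ a is the first alternative of `αCondition`; and if 4 divides both, then 8 ∤
-- b by minimality and θ² / 2 is an Eisenstein generator.
α-necessary : ∀ a b {c₀ c₁ c₂ u v w m} → ¬ (+ 4 ℤ.∣ a × + 8 ℤ.∣ b) → m ≢ 0ℤ →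
  Represents 0ℤ a (ℤ.- b) c₀ c₁ c₂ u v w m →
  + 2 ℤ.∣ c₀ → + 2 ℤ.∣ 1ℤ ℤ.+ c₂ ℤ.+ c₁ ℤ.+ c₀ → αCondition a b
α-necessary a b {c₀} {c₁} {c₂} minimal m≢0 rep 2∣c₀ 2∣F1 with a ≡? b [mod 2 ]
... | no  a≢b = inj₂ a≢b
... | yes a≡b with + 2 ℤ.∣? a
...   | no  2∤a = contradiction (descent 2 (s≤s (s≤s z≤n)) step rep) m≢0
  where
  step : ∀ {u v w m} → Represents 0ℤ a (ℤ.- b) c₀ c₁ c₂ u v w m → AllDivisible 2 u v w m
  -- The cubic is x³ + x + 1 modulo 2, with residue field of 8 elements, so an even norm forces even
  -- coordinates. For y = u + v θ + w θ² this gives u, v, w, and for m - y it gives m.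
  step {u} {v} {w} {m} rep =
    Mod2.modular 6 (λ a b u v w m → hyps a b u v w m , u) a b u v w m a-odd a≡b 2∣N 2∣N1 ,
    Mod2.modular 6 (λ a b u v w m → hyps a b u v w m , v) a b u v w m a-odd a≡b 2∣N 2∣N1 ,
    Mod2.modular 6 (λ a b u v w m → hyps a b u v w m , w) a b u v w m a-odd a≡b 2∣N 2∣N1 ,
    Mod2.modular 6 (λ a b u v w m → hyps a b u v w m , m) a b u v w m a-odd a≡b 2∣N 2∣N1
    where
    open Represents rep
    hyps : ∀ {n} (a b u v w m : Expr n) → List (Expr n)
    hyps a b u v w m = a ⊕ ⊝ con 1ℤ ∷ a ⊕ ⊝ b ∷ E.norm (con 0ℤ) a (⊝ b) u v w
                     ∷ E.norm (con 0ℤ) a (⊝ b) (m ⊕ ⊝ u) (⊝ v) (⊝ w) ∷ []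
    a-odd : + 2 ℤ.∣ (a ℤ.- 1ℤ)
    a-odd = odd⇒≡1 a 2∤a
    2∣N : + 2 ℤ.∣ Z.norm 0ℤ a (ℤ.- b) u v w
    2∣N = subst (+ 2 ℤ.∣_) (sym norm-eq) (ℤ.∣m⇒∣-m (ℤ.∣m⇒∣m*n _ 2∣c₀))
    2∣N1 : + 2 ℤ.∣ Z.norm 0ℤ a (ℤ.- b) (m ℤ.- u) (ℤ.- v) (ℤ.- w)
    2∣N1 = subst (+ 2 ℤ.∣_) (sym norm-1-) (ℤ.∣m⇒∣m*n _ 2∣F1)
...   | yes 2∣a with + 4 ℤ.∣? b
...     | yes 4∣b with + 4 ℤ.∣? a
...       | no  4∤a = inj₁ (v-≡ {2} (s≤s (s≤s z≤n)) {a} {1} 2∣a 4∤a ,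
  subst (_<⁺ v 2 b) (sym (v-≡ {2} (s≤s (s≤s z≤n)) {a} {1} 2∣a 4∤a)) (∣⇒<-v {2} (s≤s (s≤s z≤n)) {b} {1} 4∣b))
...       | yes 4∣a = contradiction
  (no-representation-pure prime-2 2∣c₀ 2∣F1 4∣a 4∣b (λ 8∣b → minimal (4∣a , 8∣b)) rep) m≢0
α-necessary a b {c₀} {c₁} {c₂} minimal m≢0 rep 2∣c₀ 2∣F1 | yes a≡b | yes 2∣a@(divides a′ refl) | no 4∤b
  with ∣-minus a b 2∣a a≡b
... | divides b′ refl = contradiction (Eisenstein.m≡0 prime-2 0ℤ a′ (ℤ.- b′) 2∤-b′ 2∣c₀ 2∣F1
        (subst₂ (λ a b → Represents 0ℤ a b c₀ c₁ c₂ _ _ _ _) (ℤ.*-comm a′ (+ 2))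
          (trans (ℤ.neg-distribˡ-* b′ (+ 2)) (ℤ.*-comm (ℤ.- b′) (+ 2))) rep)) m≢0
  where
  2∤-b′ : ¬ (+ 2 ℤ.∣ ℤ.- b′)
  2∤-b′ (divides k eq) = 4∤b (divides (ℤ.- k) (trans (cong (ℤ._* + 2) (trans (sym (ℤ.neg-involutive b′)) (cong ℤ.-_ eq)))
    (ℤSolver.solve 1 (λ k → ⊝ (k ⊗ con (+ 2)) ⊗ con (+ 2) , ⊝ k ⊗ con (+ 4)) k)))

-- Discriminants, and necessity of the condition at 3.

module Mod9 = ModularCheck 9

-- The discriminant is isobaric of weight 6 in trace, minors and norm, which accounts for m⁶. The
-- base change from 1, η, η² to 1, y, y² with y = u + v η + w η² multiplies it by the square of its
-- determinant.
discriminant-represents : ∀ {p q r c₀ c₁ c₂ u v w m} → Represents p q r c₀ c₁ c₂ u v w m →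
  Z.discriminant (ℤ.- c₂) c₁ (ℤ.- c₀) ℤ.* (m ℤ.* m ℤ.* m ℤ.* (m ℤ.* m ℤ.* m)) ≡
  Z.discriminant p (ℤ.- q) r ℤ.* (Z.index p q r u v w ℤ.* Z.index p q r u v w)
discriminant-represents {p} {q} {r} {c₀} {c₁} {c₂} {u} {v} {w} {m} (represents t s n) = begin
  Z.discriminant (ℤ.- c₂) c₁ (ℤ.- c₀) ℤ.* (m ℤ.* m ℤ.* m ℤ.* (m ℤ.* m ℤ.* m))
    ≡⟨ ℤSolver.solve 4 (λ c₀ c₁ c₂ m → E.discriminant (⊝ c₂) c₁ (⊝ c₀) ⊗ (m ⊗ m ⊗ m ⊗ (m ⊗ m ⊗ m)) ,
         E.discriminant (⊝ (c₂ ⊗ m)) (c₁ ⊗ (m ⊗ m)) (⊝ (c₀ ⊗ (m ⊗ m ⊗ m)))) c₀ c₁ c₂ m ⟩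
  Z.discriminant (ℤ.- (c₂ ℤ.* m)) (c₁ ℤ.* (m ℤ.* m)) (ℤ.- (c₀ ℤ.* (m ℤ.* m ℤ.* m)))
    ≡⟨ cong₂ (λ t s → Z.discriminant t s (ℤ.- (c₀ ℤ.* (m ℤ.* m ℤ.* m)))) t s ⟨
  Z.discriminant (Z.trace p q r u v w) (Z.minors p q r u v w) (ℤ.- (c₀ ℤ.* (m ℤ.* m ℤ.* m)))
    ≡⟨ cong (Z.discriminant (Z.trace p q r u v w) (Z.minors p q r u v w)) n ⟨
  Z.discriminant (Z.trace p q r u v w) (Z.minors p q r u v w) (Z.norm p q r u v w)
    ≡⟨ ℤSolver.solve 6 (λ p q r u v w → E.discriminant (E.trace p q r u v w) (E.minors p q r u v w) (E.norm p q r u v w) ,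
         E.discriminant p (⊝ q) r ⊗ (E.index p q r u v w ⊗ E.index p q r u v w)) p q r u v w ⟩
  Z.discriminant p (ℤ.- q) r ℤ.* (Z.index p q r u v w ℤ.* Z.index p q r u v w) ∎
  where open ≡-Reasoning

Δᵉ : ∀ {n} (a b : Expr n) → Expr n
Δᵉ a b = con (+ 4) ⊗ (a ⊗ (a ⊗ (a ⊗ con 1ℤ))) ⊕ ⊝ (con (+ 27) ⊗ (b ⊗ (b ⊗ con 1ℤ)))

discriminant≡Δ : ∀ a b → Z.discriminant 0ℤ (ℤ.- a) (ℤ.- b) ≡ Δ a b
discriminant≡Δ = ℤSolver.solve 2 λ a b → E.discriminant (con 0ℤ) (⊝ a) (⊝ b) , Δᵉ a b

discriminant-dilate : ∀ {a ρ} k q r →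
  a ≡ + 9 ℤ.* q ℤ.+ + 3 ℤ.* (k ℤ.* k) → ρ ≡ + 27 ℤ.* r ℤ.+ k ℤ.* k ℤ.* k ℤ.- a ℤ.* k →
  Z.discriminant 0ℤ (ℤ.- a) ρ ≡ Z.discriminant (ℤ.- k) (ℤ.- q) r ℤ.* + 27 ℤ.* + 27
discriminant-dilate k q r refl refl =
  ℤSolver.solve 3 (λ k q r → E.discriminant (con 0ℤ) (⊝ (con (+ 9) ⊗ q ⊕ con (+ 3) ⊗ (k ⊗ k)))
    (con (+ 27) ⊗ r ⊕ k ⊗ k ⊗ k ⊕ ⊝ ((con (+ 9) ⊗ q ⊕ con (+ 3) ⊗ (k ⊗ k)) ⊗ k)) ,
    E.discriminant (⊝ k) (⊝ q) r ⊗ con (+ 27) ⊗ con (+ 27)) k q r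

3ᵏ≢0 : ∀ k → 3 ^ᶻ k ≢ 0ℤ
3ᵏ≢0 k 3ᵏ≡0 = ℕ.≢-nonZero⁻¹ (3 ℕ.^ k) {{ℕ.m^n≢0 3 k}} (ℤ.+-injective 3ᵏ≡0)

3∤1 : ¬ (+ 3 ℤ.∣ 1ℤ)
3∤1 3∣1 = toWitnessFalse {a? = 3 ℕ.∣? 1} _ (ℤ.∣⇒∣ᵤ 3∣1)

module _ {c₀ c₁ c₂} (3∣c₀ : + 3 ℤ.∣ c₀) (3∣F1 : + 3 ℤ.∣ 1ℤ ℤ.+ c₂ ℤ.+ c₁ ℤ.+ c₀)
  (3∣F-1 : + 3 ℤ.∣ ℤ.- 1ℤ ℤ.+ c₂ ℤ.- c₁ ℤ.+ c₀) where

  private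
    hyps : ∀ {n} (c₀ c₁ c₂ : Expr n) → List (Expr n)
    hyps c₀ c₁ c₂ = c₀ ∷ con 1ℤ ⊕ c₂ ⊕ c₁ ⊕ c₀ ∷ con (ℤ.- 1ℤ) ⊕ c₂ ⊕ ⊝ c₁ ⊕ c₀ ∷ []

  3∣c₂ : + 3 ℤ.∣ c₂
  3∣c₂ = Mod3.modular 3 (λ c₀ c₁ c₂ → hyps c₀ c₁ c₂ , c₂) c₀ c₁ c₂ 3∣c₀ 3∣F1 3∣F-1

  c₁≡-1 : + 3 ℤ.∣ (c₁ ℤ.+ 1ℤ)
  c₁≡-1 = Mod3.modular 3 (λ c₀ c₁ c₂ → hyps c₀ c₁ c₂ , c₁ ⊕ con 1ℤ) c₀ c₁ c₂ 3∣c₀ 3∣F1 3∣F-1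

  discriminant≡1 : + 3 ℤ.∣ (Z.discriminant (ℤ.- c₂) c₁ (ℤ.- c₀) ℤ.- 1ℤ)
  discriminant≡1 = Mod3.modular 3 (λ c₀ c₁ c₂ → hyps c₀ c₁ c₂ , E.discriminant (⊝ c₂) c₁ (⊝ c₀) ⊕ ⊝ con 1ℤ)
    c₀ c₁ c₂ 3∣c₀ 3∣F1 3∣F-1

  -- The second hypothesis says that η³ - p η² - q η - r is not η³ - η modulo 3.
  no-representation-étale : ∀ {p q r u v w m} →
    ¬ (+ 3 ℤ.∣ Z.discriminant p (ℤ.- q) r) →
    + 3 ℤ.∣ (1ℤ ℤ.- p ℤ.* p) ℤ.* (1ℤ ℤ.- r ℤ.* r) ℤ.* (1ℤ ℤ.- (q ℤ.- 1ℤ) ℤ.* (q ℤ.- 1ℤ)) →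
    Represents p q r c₀ c₁ c₂ u v w m → m ≡ 0ℤ
  no-representation-étale {p} {q} {r} 3∤disc non-split = descent 3 (s≤s (s≤s z≤n)) step
    where
    step : ∀ {u v w m} → Represents p q r c₀ c₁ c₂ u v w m → AllDivisible 3 u v w m
    -- If 3 ∤ m, then y / m has the characteristic polynomial X³ - X, so the algebra modulo 3 is a
    -- product of three copies of the prime field and its separable generator satisfies η³ = η,
    -- which is excluded. If 3 ∣ m, then y is nilpotent modulo 3, hence 0 in an algebra of nonzero
    -- discriminant.
    step {u} {v} {w} {m} rep =
      Mod3.modular 7 (λ p q r u v w m → hyps′ p q r u v w m , u) p q r u v w m non-split disc²≡1 3∣T 3∣S 3∣N ,
      Mod3.modular 7 (λ p q r u v w m → hyps′ p q r u v w m , v) p q r u v w m non-split disc²≡1 3∣T 3∣S 3∣N ,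
      Mod3.modular 7 (λ p q r u v w m → hyps′ p q r u v w m , w) p q r u v w m non-split disc²≡1 3∣T 3∣S 3∣N ,
      Mod3.modular 7 (λ p q r u v w m → hyps′ p q r u v w m , m) p q r u v w m non-split disc²≡1 3∣T 3∣S 3∣N
      where
      open Represents rep
      hyps′ : ∀ {n} (p q r u v w m : Expr n) → List (Expr n)
      hyps′ p q r u v w m =
        (con 1ℤ ⊕ ⊝ (p ⊗ p)) ⊗ (con 1ℤ ⊕ ⊝ (r ⊗ r)) ⊗ (con 1ℤ ⊕ ⊝ ((q ⊕ ⊝ con 1ℤ) ⊗ (q ⊕ ⊝ con 1ℤ)))
        ∷ E.discriminant p (⊝ q) r ⊗ E.discriminant p (⊝ q) r ⊕ ⊝ con 1ℤ
        ∷ E.trace p q r u v w ∷ E.minors p q r u v w ⊕ m ⊗ m ∷ E.norm p q r u v w ∷ []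
      disc²≡1 = 3∤⇒x²≡1 (Z.discriminant p (ℤ.- q) r) 3∤disc
      3∣T : + 3 ℤ.∣ Z.trace p q r u v w
      3∣T = subst (+ 3 ℤ.∣_) (sym trace-eq) (ℤ.∣m⇒∣-m (ℤ.∣m⇒∣m*n m 3∣c₂))
      3∣N : + 3 ℤ.∣ Z.norm p q r u v w
      3∣N = subst (+ 3 ℤ.∣_) (sym norm-eq) (ℤ.∣m⇒∣-m (ℤ.∣m⇒∣m*n (m ℤ.* m ℤ.* m) 3∣c₀))
      3∣S : + 3 ℤ.∣ Z.minors p q r u v w ℤ.+ m ℤ.* m
      3∣S = subst (+ 3 ℤ.∣_)
        (trans (ℤSolver.solve 2 (λ c m → (c ⊕ con 1ℤ) ⊗ (m ⊗ m) , c ⊗ (m ⊗ m) ⊕ m ⊗ m) c₁ m) (cong (ℤ._+ m ℤ.* m) (sym minors-eq)))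
        (ℤ.∣m⇒∣m*n (m ℤ.* m) c₁≡-1)

  module β-Necessary (a b : ℤ) {u v w m} (minimal : ¬ (+ 9 ℤ.∣ a × + 27 ℤ.∣ b)) (m≢0 : m ≢ 0ℤ)
    (rep : Represents 0ℤ a (ℤ.- b) c₀ c₁ c₂ u v w m) where

    M I d : ℤ
    M = m ℤ.* m ℤ.* m
    I = Z.index 0ℤ a (ℤ.- b) u v w
    d = Z.discriminant (ℤ.- c₂) c₁ (ℤ.- c₀)

    dM²≡ΔI² : d ℤ.* (M ℤ.* M) ≡ Δ a b ℤ.* (I ℤ.* I)
    dM²≡ΔI² = trans (discriminant-represents rep) (cong (ℤ._* (I ℤ.* I)) (discriminant≡Δ a b))

    Δ≢0 : Δ a b ≢ 0ℤ
    Δ≢0 Δ≡0 = *-≢0 d≢0 (*-≢0 M≢0 M≢0) (trans dM²≡ΔI² (cong (ℤ._* (I ℤ.* I)) Δ≡0))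
      where
      M≢0 : M ≢ 0ℤ
      M≢0 = *-≢0 (*-≢0 m≢0 m≢0) m≢0
      d≢0 : d ≢ 0ℤ
      d≢0 d≡0 = 3∤1 (∣-minus d 1ℤ (subst (+ 3 ℤ.∣_) (sym d≡0) (divides 0ℤ refl)) discriminant≡1)

    leading : 2 ℕ.∣ s₃ a b × + 3 ℤ.∣ (Δ₃ a b ℤ.- 1ℤ)
    leading = square-class (s₃ a b) {d} {Δ₃ a b} discriminant≡1 (3∤Δ₃ a b Δ≢0) M I (*-≢0 (*-≢0 m≢0 m≢0) m≢0)
      (trans dM²≡ΔI² (cong (ℤ._* (I ℤ.* I)) (Δ-factored a b)))

    -- Otherwise s₃ would be the odd number k, against `leading`. With k = 3 and k = 5 this gains a
    -- factor 3 without any change of generator.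
    odd-valuation : ∀ k X → ¬ (2 ℕ.∣ k) → Δ a b ≡ 3 ^ᶻ k ℤ.* X → + 3 ℤ.∣ X
    odd-valuation k X 2∤k eq with + 3 ℤ.∣? X
    ... | yes 3∣X = 3∣X
    ... | no  3∤X = contradiction (subst (2 ℕ.∣_) s≡k (proj₁ leading)) 2∤k
      where
      s≡k : s₃ a b ≡ k
      s≡k = ord-≡ {3} (s≤s (s≤s z≤n)) {Δ a b} {k} Δ≢0 (divides X (trans eq (ℤ.*-comm (3 ^ᶻ k) X)))
        λ { (divides t eq′) → 3∤X (divides t (cancelˡ (3 ^ᶻ k) (3ᵏ≢0 k) (begin
          3 ^ᶻ k ℤ.* X                 ≡⟨ eq ⟨
          Δ a b                        ≡⟨ eq′ ⟩
          t ℤ.* 3 ^ᶻ suc k             ≡⟨ cong (t ℤ.*_) (^ᶻ-suc 3 k) ⟩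
          t ℤ.* (+ 3 ℤ.* 3 ^ᶻ k)       ≡⟨ ℤSolver.solve 2 (λ t x → t ⊗ (con (+ 3) ⊗ x) , x ⊗ (t ⊗ con (+ 3))) t (3 ^ᶻ k) ⟩
          3 ^ᶻ k ℤ.* (t ℤ.* + 3)       ∎))) }
        where open ≡-Reasoning

    module ThreeDividesA (a′ : ℤ) (a≡3a′ : a ≡ + 3 ℤ.* a′) (3∤b : ¬ (+ 3 ℤ.∣ b)) where

      D : ℤ
      D = + 4 ℤ.* (a′ ℤ.* a′ ℤ.* a′) ℤ.- b ℤ.* b

      Dᵉ : ∀ {n} (a′ b : Expr n) → Expr n
      Dᵉ a′ b = con (+ 4) ⊗ (a′ ⊗ a′ ⊗ a′) ⊕ ⊝ (b ⊗ b)

      Δ≡27D : Δ a b ≡ + 27 ℤ.* D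
      Δ≡27D = trans (cong (λ a → Δ a b) a≡3a′)
        (ℤSolver.solve 2 (λ a′ b → Δᵉ (con (+ 3) ⊗ a′) b , con (+ 27) ⊗ Dᵉ a′ b) a′ b)

      b²≡1 : + 3 ℤ.∣ (b ℤ.* b ℤ.- 1ℤ)
      b²≡1 = 3∤⇒x²≡1 b 3∤b

      3∣D : + 3 ℤ.∣ D
      3∣D = odd-valuation 3 D (toWitnessFalse {a? = 2 ℕ.∣? 3} _) Δ≡27D

      a′≡1 : + 3 ℤ.∣ (a′ ℤ.- 1ℤ)
      a′≡1 = Mod3.modular 2 (λ a′ b → b ⊗ b ⊕ ⊝ con 1ℤ ∷ Dᵉ a′ b ∷ [] , a′ ⊕ ⊝ con 1ℤ) a′ b b²≡1 3∣D

      9∣D : + 9 ℤ.∣ D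
      9∣D with + 9 ℤ.∣? D
      ... | yes 9∣D = 9∣D
      ... | no  9∤D = contradiction m≡0 m≢0
        where
        -- Modulo 3 the cubic f = x³ - a x + b is (x + b)³, and f(-b) = -b k. Translating by -b
        -- gives an Eisenstein cubic unless 9 ∣ k.
        k : ℤ
        k = b ℤ.* b ℤ.- 1ℤ ℤ.- + 3 ℤ.* a′
        3∣k : + 3 ℤ.∣ k
        3∣k = ℤ.∣m∣n⇒∣m-n b²≡1 (ℤ.∣m⇒∣m*n a′ (ℤ.∣-refl {+ 3}))
        k/3 : ℤ
        k/3 = ℤ.quotient 3∣k
        3∤r : ¬ (+ 3 ℤ.∣ b ℤ.* k/3)
        -- A congruence modulo 3 enters a check modulo 9 multiplied by 3. Here a′³ ≡ 1 and b² ≡ 1 +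
        -- 3 a′ ≡ 4, so that D ≡ 0 modulo 9.
        3∤r 3∣r = 9∤D (Mod9.modular 3 (λ a′ b k → con (+ 3) ⊗ (a′ ⊕ ⊝ con 1ℤ) ∷ con (+ 3) ⊗ (b ⊗ b ⊕ ⊝ con 1ℤ)
              ∷ con (+ 3) ⊗ k ⊕ ⊝ (b ⊗ b ⊕ ⊝ con 1ℤ ⊕ ⊝ (con (+ 3) ⊗ a′)) ∷ con (+ 3) ⊗ k ∷ [] , Dᵉ a′ b) a′ b k/3
            (ℤ.*-monoʳ-∣ (+ 3) a′≡1) (ℤ.*-monoʳ-∣ (+ 3) b²≡1)
            (divides 0ℤ (ℤ.i≡j⇒i-j≡0 (sym (factorʳ {3} {k/3} (ℤ._∣_.equality 3∣k)))))
            (ℤ.*-monoʳ-∣ (+ 3) ([ (λ 3∣b → contradiction 3∣b 3∤b) , id ]′ (prime-∣-* prime-3 b k/3 3∣r))))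
        rep′ = represents-translate (ℤ.- b) (+ 3 ℤ.* b) (+ 3 ℤ.* (a′ ℤ.- b ℤ.* b)) (+ 3 ℤ.* (b ℤ.* k/3))
            (ℤSolver.solve 1 (λ b → con (+ 3) ⊗ b , ⊝ (con (+ 3) ⊗ (⊝ b))) b)
            (trans a≡3a′ (ℤSolver.solve 2 (λ a′ b → con (+ 3) ⊗ a′ , con (+ 3) ⊗ (a′ ⊕ ⊝ (b ⊗ b)) ⊕ con (+ 3) ⊗ (⊝ b ⊗ ⊝ b)) a′ b))
            (trans (ℤSolver.solve 2 (λ a′ b → ⊝ b , b ⊗ (b ⊗ b ⊕ ⊝ con 1ℤ ⊕ ⊝ (con (+ 3) ⊗ a′)) ⊕ ⊝ b ⊗ ⊝ b ⊗ ⊝ b ⊕ ⊝ (con (+ 3) ⊗ a′ ⊗ ⊝ b)) a′ b)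
              (cong₂ (λ x a → x ℤ.+ ℤ.- b ℤ.* ℤ.- b ℤ.* ℤ.- b ℤ.- a ℤ.* ℤ.- b)
                (trans (cong (b ℤ.*_) (ℤ._∣_.equality 3∣k)) (ℤSolver.solve 2 (λ b k → b ⊗ (k ⊗ con (+ 3)) , con (+ 3) ⊗ (b ⊗ k)) b k/3))
                (sym a≡3a′)))
            rep
        m≡0 : m ≡ 0ℤ
        m≡0 = trans (sym (ℤ.*-identityˡ m)) (Eisenstein.m≡0 prime-3 b (a′ ℤ.- b ℤ.* b) (b ℤ.* k/3) 3∤r 3∣c₀ 3∣F1 rep′)

      27∣D : + 27 ℤ.∣ D
      27∣D = go 9∣D
        where
        go : + 9 ℤ.∣ D → + 27 ℤ.∣ D
        go (divides E D≡9E) = subst (+ 27 ℤ.∣_) (sym (trans D≡9E (ℤ.*-comm E (+ 9)))) (ℤ.*-monoʳ-∣ (+ 9)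
          (odd-valuation 5 E (toWitnessFalse {a? = 2 ℕ.∣? 5} _) (trans Δ≡27D (trans (cong (+ 27 ℤ.*_) D≡9E)
            (ℤSolver.solve 1 (λ E → con (+ 27) ⊗ (E ⊗ con (+ 9)) , con (+ 243) ⊗ E) E)))))

      -- The first two hypotheses make the cubic of ζ = (θ - k) / 3 integral. Its discriminant is D
      -- / 27, prime to 3 when 81 ∤ D, and its trace -k is prime to 3, so modulo 3 it is not η³ - η.
      no-dilation : ∀ k → + 3 ℤ.∣ (a′ ℤ.- k ℤ.* k) → + 27 ℤ.∣ (ℤ.- b ℤ.- k ℤ.* k ℤ.* k ℤ.+ + 3 ℤ.* a′ ℤ.* k) →
        + 3 ℤ.∣ (1ℤ ℤ.- ℤ.- k ℤ.* ℤ.- k) → ¬ (+ 81 ℤ.∣ D) → m ≡ 0ℤ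
      no-dilation k (divides q a′-eq) (divides r f[k]-eq) k²≡1 81∤D =
        trans (sym (ℤ.*-identityˡ m)) (no-representation-étale
          (λ 3∣disc → 81∤D (subst (+ 81 ℤ.∣_) (sym D≡27disc) (ℤ.*-monoˡ-∣ (+ 27) 3∣disc)))
          (ℤ.∣m⇒∣m*n _ (ℤ.∣m⇒∣m*n (1ℤ ℤ.- r ℤ.* r) k²≡1))
          (represents-dilate k q r a-eq b-eq rep))
        where
        a-eq : a ≡ + 9 ℤ.* q ℤ.+ + 3 ℤ.* (k ℤ.* k)
        a-eq = begin
          a                                             ≡⟨ a≡3a′ ⟩
          + 3 ℤ.* a′
            ≡⟨ ℤSolver.solve 2 (λ a k → con (+ 3) ⊗ a , con (+ 3) ⊗ (a ⊕ ⊝ (k ⊗ k)) ⊕ con (+ 3) ⊗ (k ⊗ k)) a′ k ⟩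
          + 3 ℤ.* (a′ ℤ.- k ℤ.* k) ℤ.+ + 3 ℤ.* (k ℤ.* k)
            ≡⟨ cong (λ x → + 3 ℤ.* x ℤ.+ + 3 ℤ.* (k ℤ.* k)) a′-eq ⟩
          + 3 ℤ.* (q ℤ.* + 3) ℤ.+ + 3 ℤ.* (k ℤ.* k)
            ≡⟨ ℤSolver.solve 2 (λ q x → con (+ 3) ⊗ (q ⊗ con (+ 3)) ⊕ x , con (+ 9) ⊗ q ⊕ x) q (+ 3 ℤ.* (k ℤ.* k)) ⟩
          + 9 ℤ.* q ℤ.+ + 3 ℤ.* (k ℤ.* k)               ∎
          where open ≡-Reasoning
        b-eq : ℤ.- b ≡ + 27 ℤ.* r ℤ.+ k ℤ.* k ℤ.* k ℤ.- a ℤ.* k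
        b-eq = begin
          ℤ.- b
            ≡⟨ ℤSolver.solve 3 (λ a b k → ⊝ b , (⊝ b ⊕ ⊝ (k ⊗ k ⊗ k) ⊕ a ⊗ k) ⊕ k ⊗ k ⊗ k ⊕ ⊝ (a ⊗ k)) (+ 3 ℤ.* a′) b k ⟩
          (ℤ.- b ℤ.- k ℤ.* k ℤ.* k ℤ.+ + 3 ℤ.* a′ ℤ.* k) ℤ.+ k ℤ.* k ℤ.* k ℤ.- + 3 ℤ.* a′ ℤ.* k
            ≡⟨ cong₂ (λ x a → x ℤ.+ k ℤ.* k ℤ.* k ℤ.- a ℤ.* k) (trans f[k]-eq (ℤ.*-comm r (+ 27))) (sym a≡3a′) ⟩
          + 27 ℤ.* r ℤ.+ k ℤ.* k ℤ.* k ℤ.- a ℤ.* k ∎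
          where open ≡-Reasoning
        D≡27disc : D ≡ Z.discriminant (ℤ.- k) (ℤ.- q) r ℤ.* + 27
        D≡27disc = cancelˡ (+ 27) (λ ())
          (trans (sym Δ≡27D) (trans (sym (discriminant≡Δ a b)) (trans (discriminant-dilate k q r a-eq b-eq)
            (ℤ.*-comm (Z.discriminant (ℤ.- k) (ℤ.- q) r ℤ.* + 27) (+ 27)))))

      81∣D : + 81 ℤ.∣ D
      81∣D with + 81 ℤ.∣? D
      ... | yes 81∣D = 81∣D
      -- 5 and 2 - a′ are inverses of 2 and a′ modulo 9, the latter because 1 - a′ (2 - a′) = (a′ -
      -- 1)².
      ... | no  81∤D = contradiction (no-dilation (+ 5 ℤ.* b ℤ.* (+ 2 ℤ.- a′))
        (Mod3.modular 2 (λ a b → b ⊗ b ⊕ ⊝ con 1ℤ ∷ a ⊕ ⊝ con 1ℤ ∷ [] , a ⊕ ⊝ (k a b ⊗ k a b)) a′ b b²≡1 a′≡1)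
        (Mod27.modular 2 (λ a b → con (+ 9) ⊗ (a ⊕ ⊝ con 1ℤ) ∷ Dᵉ a b ∷ [] ,
            ⊝ b ⊕ ⊝ (k a b ⊗ k a b ⊗ k a b) ⊕ con (+ 3) ⊗ a ⊗ k a b) a′ b (ℤ.*-monoʳ-∣ (+ 9) a′≡1) 27∣D)
        (Mod3.modular 2 (λ a b → b ⊗ b ⊕ ⊝ con 1ℤ ∷ a ⊕ ⊝ con 1ℤ ∷ [] , con 1ℤ ⊕ ⊝ (⊝ k a b ⊗ ⊝ k a b)) a′ b b²≡1 a′≡1)
        81∤D) m≢0
        where
        -- Approximates the double root b / (2 a′) of the cubic modulo 9.
        k : ∀ {n} (a b : Expr n) → Expr n
        k a b = con (+ 5) ⊗ b ⊗ (con (+ 2) ⊕ ⊝ a)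

      β-condition : βCondition a b
      β-condition = inj₁ (subst (λ a → a ≡ + 3 [mod 9 ]) (sym a≡3a′) (9∣3[a′-1]) ,
        subst (λ a → b ℤ.^ 2 ≡ a ℤ.+ 1ℤ [mod 27 ]) (sym a≡3a′) b²≡a+1 ,
        (ord-max {3} (s≤s (s≤s z≤n)) {Δ a b} {7} Δ≢0 (subst (3 ^ᶻ 7 ℤ.∣_) (sym Δ≡27D) (ℤ.*-monoʳ-∣ (+ 27) 81∣D)) , proj₁ leading) ,
        proj₂ leading)
        where
        9∣3[a′-1] : + 3 ℤ.* a′ ≡ + 3 [mod 9 ]
        9∣3[a′-1] = subst (+ 9 ℤ.∣_) (ℤSolver.solve 1 (λ a → con (+ 3) ⊗ (a ⊕ ⊝ con 1ℤ) , con (+ 3) ⊗ a ⊕ ⊝ con (+ 3)) a′)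
          (ℤ.*-monoʳ-∣ (+ 3) a′≡1)
        b²≡a+1 : b ℤ.^ 2 ≡ + 3 ℤ.* a′ ℤ.+ 1ℤ [mod 27 ]
        -- For a′ = 1 + 3 t one has 4 a′³ ≡ 4 + 36 t ≡ 4 + 9 t = 3 a′ + 1 modulo 27.
        b²≡a+1 = Mod27.modular 2 (λ a′ b → con (+ 9) ⊗ (a′ ⊕ ⊝ con 1ℤ) ∷ Dᵉ a′ b ∷ [] ,
          b ⊗ (b ⊗ con 1ℤ) ⊕ ⊝ (con (+ 3) ⊗ a′ ⊕ con 1ℤ)) a′ b (ℤ.*-monoʳ-∣ (+ 9) a′≡1) 27∣D

    -- If 3 ∤ a, then 3 ∤ Δ, so the cubic is separable modulo 3 and must be x³ - x there, which is
    -- the second alternative of `βCondition`. If 3 divides a and b, `odd-valuation` for 3³ and then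
    -- for 3⁵ gives 9 ∣ a and 9 ∣ b; by minimality 27 ∤ b, and `no-representation-pure` applies.
    β-necessary : βCondition a b
    β-necessary with + 3 ℤ.∣? a | + 3 ℤ.∣? b
    ... | yes (divides a′ a≡) | no 3∤b = ThreeDividesA.β-condition a′ (factorʳ {3} {a′} a≡) 3∤b
    ... | no 3∤a | yes 3∣b with a ≡? 1ℤ [mod 3 ]
    ...   | yes a≡1 = inj₂ (a≡1 , 3∣b)
    ...   | no  a≢1 = contradiction (no-representation-étale 3∤disc non-split rep) m≢0
      where
      a≡-1 : + 3 ℤ.∣ (a ℤ.+ 1ℤ)
      a≡-1 = [ (λ 3∣a → contradiction 3∣a 3∤a) , [ (λ a≡1 → contradiction a≡1 a≢1) , id ]′ ∘ prime-∣-* prime-3 (a ℤ.- 1ℤ) (a ℤ.+ 1ℤ) ]′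
        (prime-∣-* prime-3 a _ (Mod3.modular 1 (λ a → [] , a ⊗ ((a ⊕ ⊝ con 1ℤ) ⊗ (a ⊕ con 1ℤ))) a))
      3∤disc : ¬ (+ 3 ℤ.∣ Z.discriminant 0ℤ (ℤ.- a) (ℤ.- b))
      3∤disc 3∣disc = 3∤a (Mod3.modular 2 (λ a b → E.discriminant (con 0ℤ) (⊝ a) (⊝ b) ∷ [] , a) a b 3∣disc)
      non-split = Mod3.modular 2 (λ a b → a ⊕ con 1ℤ ∷ [] , (con 1ℤ ⊕ ⊝ (con 0ℤ ⊗ con 0ℤ)) ⊗ (con 1ℤ ⊕ ⊝ (⊝ b ⊗ ⊝ b)) ⊗ (con 1ℤ ⊕ ⊝ ((a ⊕ ⊝ con 1ℤ) ⊗ (a ⊕ ⊝ con 1ℤ))))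
        a b a≡-1
    β-necessary | no 3∤a | no 3∤b = contradiction (no-representation-étale 3∤disc non-split rep) m≢0
      where
      3∤disc : ¬ (+ 3 ℤ.∣ Z.discriminant 0ℤ (ℤ.- a) (ℤ.- b))
      3∤disc 3∣disc = 3∤a (Mod3.modular 2 (λ a b → E.discriminant (con 0ℤ) (⊝ a) (⊝ b) ∷ [] , a) a b 3∣disc)
      non-split = Mod3.modular 2 (λ a b → b ⊗ b ⊕ ⊝ con 1ℤ ∷ [] , (con 1ℤ ⊕ ⊝ (con 0ℤ ⊗ con 0ℤ)) ⊗ (con 1ℤ ⊕ ⊝ (⊝ b ⊗ ⊝ b)) ⊗ (con 1ℤ ⊕ ⊝ ((a ⊕ ⊝ con 1ℤ) ⊗ (a ⊕ ⊝ con 1ℤ))))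
        a b (3∤⇒x²≡1 b 3∤b)
    β-necessary | yes (divides a′ a≡) | yes (divides b′ b≡) = contradiction
      (no-representation-pure prime-3 3∣c₀ 3∣F1 (9∣ a≡ 3∣a′) (9∣ b≡ 3∣b′) (λ 27∣b → minimal (9∣ a≡ 3∣a′ , 27∣b)) rep) m≢0
      where
      9∣ : ∀ {x x′} → x ≡ x′ ℤ.* + 3 → + 3 ℤ.∣ x′ → + 9 ℤ.∣ x
      9∣ {x} {x′} x≡ 3∣x′ = subst (+ 9 ℤ.∣_) (sym (factorʳ {3} {x′} x≡)) (ℤ.*-monoʳ-∣ (+ 3) 3∣x′)
      Δ≡ : Δ a b ≡ + 27 ℤ.* (+ 4 ℤ.* (a′ ℤ.* a′ ℤ.* a′) ℤ.- + 9 ℤ.* (b′ ℤ.* b′))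
      Δ≡ = trans (cong₂ Δ a≡ b≡) (ℤSolver.solve 2 (λ a b → Δᵉ (a ⊗ con (+ 3)) (b ⊗ con (+ 3)) ,
        con (+ 27) ⊗ (con (+ 4) ⊗ (a ⊗ a ⊗ a) ⊕ ⊝ (con (+ 9) ⊗ (b ⊗ b)))) a′ b′)
      3∣a′ : + 3 ℤ.∣ a′
      3∣a′ = Mod3.modular 2 (λ a b → con (+ 4) ⊗ (a ⊗ a ⊗ a) ⊕ ⊝ (con (+ 9) ⊗ (b ⊗ b)) ∷ [] , a) a′ b′
        (odd-valuation 3 _ (toWitnessFalse {a? = 2 ℕ.∣? 3} _) Δ≡)
      3∣b′ : + 3 ℤ.∣ b′
      3∣b′ = go 3∣a′
        where
        go : + 3 ℤ.∣ a′ → + 3 ℤ.∣ b′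
        go (divides a″ a′≡) = Mod3.modular 2 (λ a b → con (+ 12) ⊗ (a ⊗ a ⊗ a) ⊕ ⊝ (b ⊗ b) ∷ [] , b) a″ b′
          (odd-valuation 5 _ (toWitnessFalse {a? = 2 ℕ.∣? 5} _) (trans Δ≡ (trans
            (cong (λ a′ → + 27 ℤ.* (+ 4 ℤ.* (a′ ℤ.* a′ ℤ.* a′) ℤ.- + 9 ℤ.* (b′ ℤ.* b′))) a′≡)
            (ℤSolver.solve 2 (λ a b → con (+ 27) ⊗ (con (+ 4) ⊗ (a ⊗ con (+ 3) ⊗ (a ⊗ con (+ 3)) ⊗ (a ⊗ con (+ 3))) ⊕ ⊝ (con (+ 9) ⊗ (b ⊗ b))) ,
              con (+ 243) ⊗ (con (+ 12) ⊗ (a ⊗ a ⊗ a) ⊕ ⊝ (b ⊗ b))) a″ b′))))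

-- Elements whose index is divisible by 2 or by 3.

monicCubic : ℤ → ℤ → ℤ → ℤ[X].Poly
monicCubic c₀ c₁ c₂ = c₀ ∷ c₁ ∷ c₂ ∷ 1ℤ ∷ []

-- The innermost `x ⊗ con 0ℤ` is there because `eval` folds down to the empty list; with it the
-- evaluation is a value of `monicCubic` by definition.
monicCubicᵉ : ∀ {n} (c₀ c₁ c₂ x : Expr n) → Expr n
monicCubicᵉ c₀ c₁ c₂ x = c₀ ⊕ x ⊗ (c₁ ⊕ x ⊗ (c₂ ⊕ x ⊗ (con 1ℤ ⊕ x ⊗ con 0ℤ)))

-- (y₀ + y₁ θ + y₂ θ²) / m generates the field, and l divides its index.
record Witness (l : ℕ) (a b : ℤ) : Set where
  field
    {c₀ c₁ c₂ y₀ y₁ y₂ m} : ℤ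
    m≢0           : m ≢ 0ℤ
    generates     : y₁ ≢ 0ℤ ⊎ y₂ ≢ 0ℤ
    isRepresented : Represents 0ℤ a (ℤ.- b) c₀ c₁ c₂ y₀ y₁ y₂ m
    l∣values      : ∀ x → + l ℤ.∣ ℤ[X].eval (monicCubic c₀ c₁ c₂) x

represents-self : ∀ {p q r} u v w → Represents p q r
  (ℤ.- Z.norm p q r u v w) (Z.minors p q r u v w) (ℤ.- Z.trace p q r u v w) u v w 1ℤ
represents-self {p} {q} {r} u v w = represents
  (ℤSolver.solve 1 (λ t → t , ⊝ (⊝ t ⊗ con 1ℤ)) (Z.trace p q r u v w))
  (ℤSolver.solve 1 (λ s → s , s ⊗ (con 1ℤ ⊗ con 1ℤ)) (Z.minors p q r u v w))
  (ℤSolver.solve 1 (λ n → n , ⊝ (⊝ n ⊗ (con 1ℤ ⊗ con 1ℤ ⊗ con 1ℤ))) (Z.norm p q r u v w))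

α-sufficient : ∀ a b → αCondition a b → Witness 2 a b
α-sufficient a b (inj₂ a≢b) with + 2 ℤ.∣? a
... | no 2∤a = record
  { m≢0           = λ ()
  ; generates     = inj₁ λ ()
  ; isRepresented = represents-self 0ℤ 1ℤ 0ℤ
  ; l∣values      = λ x → Mod2.modular 3 (λ a b x → a ⊕ ⊝ con 1ℤ ∷ b ∷ [] ,
      monicCubicᵉ (⊝ E.norm (con 0ℤ) a (⊝ b) (con 0ℤ) (con 1ℤ) (con 0ℤ)) (E.minors (con 0ℤ) a (⊝ b) (con 0ℤ) (con 1ℤ) (con 0ℤ))
        (⊝ E.trace (con 0ℤ) a (⊝ b) (con 0ℤ) (con 1ℤ) (con 0ℤ)) x) a b x (odd⇒≡1 a 2∤a) 2∣b
  }
  where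
  2∣b : + 2 ℤ.∣ b
  2∣b with + 2 ℤ.∣? b
  ... | yes 2∣b = 2∣b
  ... | no  2∤b = contradiction (subst (+ 2 ℤ.∣_)
    (ℤSolver.solve 2 (λ a b → (a ⊕ ⊝ con 1ℤ) ⊕ ⊝ (b ⊕ ⊝ con 1ℤ) , a ⊕ ⊝ b) a b) (ℤ.∣m∣n⇒∣m-n (odd⇒≡1 a 2∤a) (odd⇒≡1 b 2∤b))) a≢b
-- The cubic is x³ + 1 = (x + 1)(x² + x + 1) modulo 2. At the root 1 the element θ² + θ is 0, at the
-- two primitive cube roots of unity it is 1, so both residues occur.
... | yes 2∣a = record
  { m≢0           = λ ()
  ; generates     = inj₁ λ ()
  ; isRepresented = represents-self 0ℤ 1ℤ 1ℤ
  ; l∣values      = λ x → Mod2.modular 3 (λ a b x → a ∷ b ⊕ ⊝ con 1ℤ ∷ [] ,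
      monicCubicᵉ (⊝ E.norm (con 0ℤ) a (⊝ b) (con 0ℤ) (con 1ℤ) (con 1ℤ)) (E.minors (con 0ℤ) a (⊝ b) (con 0ℤ) (con 1ℤ) (con 1ℤ))
        (⊝ E.trace (con 0ℤ) a (⊝ b) (con 0ℤ) (con 1ℤ) (con 1ℤ)) x) a b x 2∣a
        (odd⇒≡1 b λ 2∣b → a≢b (ℤ.∣m∣n⇒∣m-n 2∣a 2∣b))
  }
α-sufficient a b (inj₁ (v≡1 , v<v)) = go (v-≡⇒ {2} (s≤s (s≤s z≤n)) {a} {1} v≡1)
  (<-v⇒∣ {2} (s≤s (s≤s z≤n)) {b} {1} (subst (_<⁺ v 2 b) v≡1 v<v))
  where
  go : + 2 ℤ.∣ a × ¬ (+ 4 ℤ.∣ a) → + 4 ℤ.∣ b → Witness 2 a b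
  go (divides a′ refl , 4∤a) (divides b′ refl) = record
    { m≢0           = λ ()
    ; generates     = inj₂ λ ()
    -- With a = 2 a′ and b = 4 b′, θ² / 2 has the characteristic polynomial X³ - 2 a′ X² + a′² X - 2
    -- b′², which is X³ + X modulo 2 as a′ is odd.
    ; isRepresented = represents {c₀ = ℤ.- (+ 2 ℤ.* (b′ ℤ.* b′))} {a′ ℤ.* a′} {ℤ.- (+ 2 ℤ.* a′)} {0ℤ} {0ℤ} {1ℤ} {+ 2}
        (ℤSolver.solve 2 (λ a b → E.trace (con 0ℤ) (a ⊗ con (+ 2)) (⊝ (b ⊗ con (+ 4))) (con 0ℤ) (con 0ℤ) (con 1ℤ) ,
          ⊝ (⊝ (con (+ 2) ⊗ a) ⊗ con (+ 2))) a′ b′)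
        (ℤSolver.solve 2 (λ a b → E.minors (con 0ℤ) (a ⊗ con (+ 2)) (⊝ (b ⊗ con (+ 4))) (con 0ℤ) (con 0ℤ) (con 1ℤ) ,
          a ⊗ a ⊗ (con (+ 2) ⊗ con (+ 2))) a′ b′)
        (ℤSolver.solve 2 (λ a b → E.norm (con 0ℤ) (a ⊗ con (+ 2)) (⊝ (b ⊗ con (+ 4))) (con 0ℤ) (con 0ℤ) (con 1ℤ) ,
          ⊝ (⊝ (con (+ 2) ⊗ (b ⊗ b)) ⊗ (con (+ 2) ⊗ con (+ 2) ⊗ con (+ 2)))) a′ b′)
    ; l∣values      = λ x → Mod2.modular 3 (λ a b x → a ⊕ ⊝ con 1ℤ ∷ [] ,
        monicCubicᵉ (⊝ (con (+ 2) ⊗ (b ⊗ b))) (a ⊗ a) (⊝ (con (+ 2) ⊗ a)) x) a′ b′ x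
        (odd⇒≡1 a′ λ 2∣a′ → 4∤a (subst (+ 4 ℤ.∣_) (ℤ.*-comm (+ 2) a′) (ℤ.*-monoʳ-∣ (+ 2) 2∣a′)))
    }

-- Two roots of x³ − 3 a x + b are 3-adically close to b / (2 a).  The element
-- (4 a² θ² + 2 a b θ + b² − 12 a³) / (27 n), which is 9 n b E / (2 a θ − b), is
-- congruent to ±1 at these two roots and to 0 at the third.
β-generator : ∀ a b n E → n ≢ 0ℤ → + 3 ℤ.∣ (a ℤ.- 1ℤ) → + 3 ℤ.∣ (E ℤ.- 1ℤ) →
  + 4 ℤ.* (a ℤ.* a ℤ.* a) ℤ.- b ℤ.* b ≡ + 243 ℤ.* (n ℤ.* n ℤ.* E) → Witness 3 (+ 3 ℤ.* a) b
β-generator a b n E n≢0 a≡1 E≡1 D-eq = record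
  { m≢0           = *-≢0 {+ 27} (λ ()) n≢0
  ; generates     = inj₂ (*-≢0 {+ 4} (λ ()) (*-≢0 a≢0 a≢0))
  ; isRepresented = represents {c₀ = ℤ.- (+ 3 ℤ.* n ℤ.* (b ℤ.* b) ℤ.* (E ℤ.* E))} {ℤ.- (b ℤ.* b ℤ.* E)} {+ 27 ℤ.* n ℤ.* E}
      {b ℤ.* b ℤ.- + 12 ℤ.* (a ℤ.* a ℤ.* a)} {+ 2 ℤ.* a ℤ.* b} {+ 4 ℤ.* (a ℤ.* a)} {+ 27 ℤ.* n}
      (trans (ℤSolver.solve 2 (λ a b → E.trace (con 0ℤ) (con (+ 3) ⊗ a) (⊝ b) (uᵉ a b) (vᵉ a b) (wᵉ a b) , ⊝ (con (+ 3) ⊗ Dᵉ a b)) a b)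
        (trans (cong (λ D → ℤ.- (+ 3 ℤ.* D)) D-eq)
          (ℤSolver.solve 2 (λ n E → ⊝ (con (+ 3) ⊗ D′ n E) , ⊝ (con (+ 27) ⊗ n ⊗ E ⊗ (con (+ 27) ⊗ n))) n E)))
      (trans (ℤSolver.solve 2 (λ a b → E.minors (con 0ℤ) (con (+ 3) ⊗ a) (⊝ b) (uᵉ a b) (vᵉ a b) (wᵉ a b) ,
            ⊝ (con (+ 3) ⊗ (b ⊗ b) ⊗ Dᵉ a b)) a b)
        (trans (cong (λ D → ℤ.- (+ 3 ℤ.* (b ℤ.* b) ℤ.* D)) D-eq)
          (ℤSolver.solve 3 (λ n E b → ⊝ (con (+ 3) ⊗ (b ⊗ b) ⊗ D′ n E) , ⊝ (b ⊗ b ⊗ E) ⊗ (con (+ 27) ⊗ n ⊗ (con (+ 27) ⊗ n))) n E b)))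
      (trans (ℤSolver.solve 2 (λ a b → E.norm (con 0ℤ) (con (+ 3) ⊗ a) (⊝ b) (uᵉ a b) (vᵉ a b) (wᵉ a b) ,
            b ⊗ b ⊗ (Dᵉ a b ⊗ Dᵉ a b)) a b)
        (trans (cong (λ D → b ℤ.* b ℤ.* (D ℤ.* D)) D-eq)
          (ℤSolver.solve 3 (λ n E b → b ⊗ b ⊗ (D′ n E ⊗ D′ n E) ,
            ⊝ (⊝ (con (+ 3) ⊗ n ⊗ (b ⊗ b) ⊗ (E ⊗ E)) ⊗ (con (+ 27) ⊗ n ⊗ (con (+ 27) ⊗ n) ⊗ (con (+ 27) ⊗ n)))) n E b)))
  ; l∣values      = λ x → Mod3.modular 4 (λ n E b x → b ⊗ b ⊕ ⊝ con 1ℤ ∷ E ⊕ ⊝ con 1ℤ ∷ [] ,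
      monicCubicᵉ (⊝ (con (+ 3) ⊗ n ⊗ (b ⊗ b) ⊗ (E ⊗ E))) (⊝ (b ⊗ b ⊗ E)) (con (+ 27) ⊗ n ⊗ E) x) n E b x b²≡1 E≡1
  }
  where
  uᵉ vᵉ wᵉ Dᵉ : ∀ {n} (a b : Expr n) → Expr n
  uᵉ a b = b ⊗ b ⊕ ⊝ (con (+ 12) ⊗ (a ⊗ a ⊗ a))
  vᵉ a b = con (+ 2) ⊗ a ⊗ b
  wᵉ a b = con (+ 4) ⊗ (a ⊗ a)
  Dᵉ a b = con (+ 4) ⊗ (a ⊗ a ⊗ a) ⊕ ⊝ (b ⊗ b)
  D′ : ∀ {k} (n E : Expr k) → Expr k
  D′ n E = con (+ 243) ⊗ (n ⊗ n ⊗ E)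
  a≢0 : a ≢ 0ℤ
  a≢0 refl = 3∤1 (ℤ.∣m⇒∣-m a≡1)
  b²≡1 : + 3 ℤ.∣ (b ℤ.* b ℤ.- 1ℤ)
  b²≡1 = Mod3.modular 2 (λ a b → a ⊕ ⊝ con 1ℤ ∷ con (+ 4) ⊗ (a ⊗ a ⊗ a) ⊕ ⊝ (b ⊗ b) ∷ [] , b ⊗ b ⊕ ⊝ con 1ℤ) a b a≡1
    (subst (+ 3 ℤ.∣_) (sym D-eq) (ℤ.∣m⇒∣m*n (n ℤ.* n ℤ.* E) (divides (+ 81) refl)))

β-sufficient-split : ∀ a b t s h E → a ℤ.- + 3 ≡ t ℤ.* + 9 → 6 ℕ.< s → s ≡ h ℕ.* 2 →
  + 3 ℤ.∣ (E ℤ.- 1ℤ) → Δ a b ≡ 3 ^ᶻ s ℤ.* E → Witness 3 a b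
β-sufficient-split a b t s h E a-eq 6<s s≡2h E≡1 Δ-eq =
  subst (λ a → Witness 3 a b) (sym a≡3a′)
    (β-generator a′ b n E (3ᵏ≢0 j) (divides t (ℤSolver.solve 1 (λ t → con 1ℤ ⊕ con (+ 3) ⊗ t ⊕ ⊝ con 1ℤ , t ⊗ con (+ 3)) t)) E≡1
      (cancelˡ (+ 27) (λ ()) (begin
        + 27 ℤ.* (+ 4 ℤ.* (a′ ℤ.* a′ ℤ.* a′) ℤ.- b ℤ.* b)
          ≡⟨ ℤSolver.solve 2 (λ a b → con (+ 27) ⊗ (con (+ 4) ⊗ (a ⊗ a ⊗ a) ⊕ ⊝ (b ⊗ b)) , Δᵉ (con (+ 3) ⊗ a) b) a′ b ⟩
        Δ (+ 3 ℤ.* a′) b                 ≡⟨ cong (λ a → Δ a b) a≡3a′ ⟨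
        Δ a b                            ≡⟨ Δ-eq ⟩
        3 ^ᶻ s ℤ.* E                     ≡⟨ cong (ℤ._* E) 3ˢ ⟩
        + 81 ℤ.* n ℤ.* (+ 81 ℤ.* n) ℤ.* E
          ≡⟨ ℤSolver.solve 2 (λ n E → con (+ 81) ⊗ n ⊗ (con (+ 81) ⊗ n) ⊗ E , con (+ 27) ⊗ (con (+ 243) ⊗ (n ⊗ n ⊗ E))) n E ⟩
        + 27 ℤ.* (+ 243 ℤ.* (n ℤ.* n ℤ.* E)) ∎)))
  where
  open ≡-Reasoning
  a′ : ℤ
  a′ = 1ℤ ℤ.+ + 3 ℤ.* t
  a≡3a′ : a ≡ + 3 ℤ.* a′
  a≡3a′ = trans (ℤSolver.solve 1 (λ a → a , (a ⊕ ⊝ con (+ 3)) ⊕ con (+ 3)) a) (trans (cong (ℤ._+ + 3) a-eq)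
    (ℤSolver.solve 1 (λ t → t ⊗ con (+ 9) ⊕ con (+ 3) , con (+ 3) ⊗ (con 1ℤ ⊕ con (+ 3) ⊗ t)) t))
  j : ℕ
  -- An even s above 6 is at least 8. Splitting 3⁸ = 27 · 243 off 3ˢ leaves the square n² that
  -- `β-generator` asks for.
  j = h ℕ.∸ 4
  n : ℤ
  n = 3 ^ᶻ j
  3<h : 3 ℕ.< h
  3<h = ℕ.*-cancelʳ-< 2 3 h (subst (6 ℕ.<_) s≡2h 6<s)
  3ʰ : 3 ^ᶻ h ≡ + 81 ℤ.* n
  3ʰ = trans (cong (λ h → + (3 ℕ.^ h)) (sym (ℕ.m+[n∸m]≡n 3<h)))
    (trans (cong +_ (ℕ.^-distribˡ-+-* 3 4 j)) (ℤ.pos-* 81 (3 ℕ.^ j)))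
  3ˢ : 3 ^ᶻ s ≡ + 81 ℤ.* n ℤ.* (+ 81 ℤ.* n)
  3ˢ = begin
    3 ^ᶻ s                          ≡⟨ cong (λ s → + (3 ℕ.^ s)) s≡2h ⟩
    3 ^ᶻ (h ℕ.* 2)                  ≡⟨ cong +_ (ℕ.^-*-assoc 3 h 2) ⟨
    + (3 ℕ.^ h ℕ.* (3 ℕ.^ h ℕ.* 1)) ≡⟨ cong (λ x → + (3 ℕ.^ h ℕ.* x)) (ℕ.*-identityʳ (3 ℕ.^ h)) ⟩
    + (3 ℕ.^ h ℕ.* 3 ℕ.^ h)         ≡⟨ ℤ.pos-* (3 ℕ.^ h) (3 ℕ.^ h) ⟩
    3 ^ᶻ h ℤ.* 3 ^ᶻ h               ≡⟨ cong₂ ℤ._*_ 3ʰ 3ʰ ⟩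
    + 81 ℤ.* n ℤ.* (+ 81 ℤ.* n)     ∎

β-sufficient : ∀ a b → βCondition a b → Witness 3 a b
β-sufficient a b (inj₂ (a≡1 , 3∣b)) = record
  { m≢0           = λ ()
  ; generates     = inj₁ λ ()
  ; isRepresented = represents-self 0ℤ 1ℤ 0ℤ
  ; l∣values      = λ x → Mod3.modular 3 (λ a b x → a ⊕ ⊝ con 1ℤ ∷ b ∷ [] ,
      monicCubicᵉ (⊝ E.norm (con 0ℤ) a (⊝ b) (con 0ℤ) (con 1ℤ) (con 0ℤ)) (E.minors (con 0ℤ) a (⊝ b) (con 0ℤ) (con 1ℤ) (con 0ℤ))
        (⊝ E.trace (con 0ℤ) a (⊝ b) (con 0ℤ) (con 1ℤ) (con 0ℤ)) x) a b x a≡1 3∣b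
  }
β-sufficient a b (inj₁ (divides t a-eq , _ , (6<s , ℕ.divides h s≡2h) , Δ₃≡1)) =
  β-sufficient-split a b t (s₃ a b) h (Δ₃ a b) a-eq 6<s s≡2h Δ₃≡1 (Δ-factored a b)

-- The gcd of the values of a monic cubic.

IsGCDOfValues : ℤ[X].Poly → ℕ → Set
IsGCDOfValues F d =
  (∀ x → d ℕ.∣ ∣ ℤ[X].eval F x ∣) × (∀ e → (∀ x → e ℕ.∣ ∣ ℤ[X].eval F x ∣) → e ℕ.∣ d)

ℤ-induction : ∀ {p} (P : ℤ → Set p) → P 0ℤ → (∀ x → P x → P (x ℤ.+ 1ℤ)) → (∀ x → P x → P (x ℤ.- 1ℤ)) → ∀ x → P x
ℤ-induction P P0 up down (+ zero)      = P0
ℤ-induction P P0 up down (+ suc n)     = subst P (cong +_ (ℕ.+-comm n 1)) (up (+ n) (ℤ-induction P P0 up down (+ n)))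
ℤ-induction P P0 up down -[1+ zero ]   = down 0ℤ P0
ℤ-induction P P0 up down -[1+ suc n ]  =
  subst P (cong (λ k → -[1+ suc k ]) (ℕ.+-identityʳ n)) (down -[1+ n ] (ℤ-induction P P0 up down -[1+ n ]))

module _ (c₀ c₁ c₂ : ℤ) where

  private
    F : ℤ → ℤ
    F = ℤ[X].eval (monicCubic c₀ c₁ c₂)

    third-difference : ∀ x → F (x ℤ.+ + 3) ≡ + 6 ℤ.+ + 3 ℤ.* F (x ℤ.+ + 2) ℤ.- + 3 ℤ.* F (x ℤ.+ 1ℤ) ℤ.+ F x
    third-difference = ℤSolver.solve 4 (λ c₀ c₁ c₂ x → let F = monicCubicᵉ c₀ c₁ c₂ in
      F (x ⊕ con (+ 3)) , con (+ 6) ⊕ con (+ 3) ⊗ F (x ⊕ con (+ 2)) ⊕ ⊝ (con (+ 3) ⊗ F (x ⊕ con 1ℤ)) ⊕ F x) c₀ c₁ c₂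

    6∣difference : ∀ {d} x → d ℤ.∣ F x → d ℤ.∣ F (x ℤ.+ 1ℤ) → d ℤ.∣ F (x ℤ.+ + 2) → d ℤ.∣ F (x ℤ.+ + 3) → d ℤ.∣ + 6
    6∣difference {d} x d₀ d₁ d₂ d₃ = subst (d ℤ.∣_)
      (trans (cong (λ y → y ℤ.- + 3 ℤ.* F (x ℤ.+ + 2) ℤ.+ + 3 ℤ.* F (x ℤ.+ 1ℤ) ℤ.- F x) (third-difference x))
        (ℤSolver.solve 3 (λ f₀ f₁ f₂ → (con (+ 6) ⊕ con (+ 3) ⊗ f₂ ⊕ ⊝ (con (+ 3) ⊗ f₁) ⊕ f₀) ⊕ ⊝ (con (+ 3) ⊗ f₂) ⊕ con (+ 3) ⊗ f₁ ⊕ ⊝ f₀ ,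
          con (+ 6)) (F x) (F (x ℤ.+ 1ℤ)) (F (x ℤ.+ + 2))))
      (ℤ.∣m∣n⇒∣m-n (ℤ.∣m∣n⇒∣m+n (ℤ.∣m∣n⇒∣m-n d₃ (ℤ.∣n⇒∣m*n (+ 3) d₂)) (ℤ.∣n⇒∣m*n (+ 3) d₁)) d₀)

  gcd-of-values-∣6 : ∀ {d} → (∀ x → d ℕ.∣ ∣ F x ∣) → d ℕ.∣ 6
  gcd-of-values-∣6 {d} d∣F = ℤ.∣⇒∣ᵤ (6∣difference {+ d} 0ℤ (at (+ 0)) (at (+ 1)) (at (+ 2)) (at (+ 3)))
    where
    at : ∀ x → + d ℤ.∣ F x
    at x = ℤ.∣ᵤ⇒∣ (d∣F x)

  -- Four consecutive values suffice: their gcd divides the third difference 6, and the next value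
  -- on either side is an integral combination of 6 and three neighbouring values.
  gcd-of-values-exists : ∃[ d ] IsGCDOfValues (monicCubic c₀ c₁ c₂) d
  gcd-of-values-exists = g , (λ x → ℤ.∣⇒∣ᵤ (proj₁ (all x))) ,
    λ e e∣F → ℕ.gcd-greatest (ℕ.gcd-greatest (e∣F (+ 0)) (e∣F (+ 1))) (ℕ.gcd-greatest (e∣F (+ 2)) (e∣F (+ 3)))
    where
    f : ℕ → ℕ
    f n = ∣ F (+ n) ∣
    g₀ g₁ g : ℕ
    g₀ = ℕ.gcd (f 0) (f 1)
    g₁ = ℕ.gcd (f 2) (f 3)
    g = ℕ.gcd g₀ g₁
    g∣F0 : + g ℤ.∣ F (+ 0)
    g∣F0 = ℤ.∣ᵤ⇒∣ (ℕ.∣-trans (ℕ.gcd[m,n]∣m g₀ g₁) (ℕ.gcd[m,n]∣m (f 0) (f 1)))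
    g∣F1 : + g ℤ.∣ F (+ 1)
    g∣F1 = ℤ.∣ᵤ⇒∣ (ℕ.∣-trans (ℕ.gcd[m,n]∣m g₀ g₁) (ℕ.gcd[m,n]∣n (f 0) (f 1)))
    g∣F2 : + g ℤ.∣ F (+ 2)
    g∣F2 = ℤ.∣ᵤ⇒∣ (ℕ.∣-trans (ℕ.gcd[m,n]∣n g₀ g₁) (ℕ.gcd[m,n]∣m (f 2) (f 3)))
    g∣F3 : + g ℤ.∣ F (+ 3)
    g∣F3 = ℤ.∣ᵤ⇒∣ (ℕ.∣-trans (ℕ.gcd[m,n]∣n g₀ g₁) (ℕ.gcd[m,n]∣n (f 2) (f 3)))
    g∣6 : + g ℤ.∣ + 6
    g∣6 = 6∣difference 0ℤ g∣F0 g∣F1 g∣F2 g∣F3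

    Three : ℤ → Set
    Three x = + g ℤ.∣ F x × + g ℤ.∣ F (x ℤ.+ 1ℤ) × + g ℤ.∣ F (x ℤ.+ + 2)

    up : ∀ x → Three x → Three (x ℤ.+ 1ℤ)
    up x (d₀ , d₁ , d₂) = d₁ ,
      subst (λ y → + g ℤ.∣ F y) (sym (ℤ.+-assoc x 1ℤ 1ℤ)) d₂ ,
      subst (λ y → + g ℤ.∣ F y) (sym (ℤ.+-assoc x 1ℤ (+ 2))) (subst (+ g ℤ.∣_) (sym (third-difference x))
        (ℤ.∣m∣n⇒∣m+n (ℤ.∣m∣n⇒∣m-n (ℤ.∣m∣n⇒∣m+n g∣6 (ℤ.∣n⇒∣m*n (+ 3) d₂)) (ℤ.∣n⇒∣m*n (+ 3) d₁)) d₀))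

    down : ∀ x → Three x → Three (x ℤ.- 1ℤ)
    down x (d₀ , d₁ , d₂) =
      ∣-minus (F y′₃ ℤ.- (+ 6 ℤ.+ + 3 ℤ.* F y′₂ ℤ.- + 3 ℤ.* F y′₁)) (F y)
        (ℤ.∣m∣n⇒∣m-n y₃ (ℤ.∣m∣n⇒∣m-n (ℤ.∣m∣n⇒∣m+n g∣6 (ℤ.∣n⇒∣m*n (+ 3) y₂)) (ℤ.∣n⇒∣m*n (+ 3) y₁)))
        (subst (+ g ℤ.∣_) (sym (trans (cong (λ z → z ℤ.- (+ 6 ℤ.+ + 3 ℤ.* F y′₂ ℤ.- + 3 ℤ.* F y′₁) ℤ.- F y) (third-difference y))
          (ℤSolver.solve 2 (λ a f → a ⊕ f ⊕ ⊝ a ⊕ ⊝ f , con 0ℤ) (+ 6 ℤ.+ + 3 ℤ.* F y′₂ ℤ.- + 3 ℤ.* F y′₁) (F y)))) (divides 0ℤ refl)) ,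
      y₁ , y₂
      where
      y y′₁ y′₂ y′₃ : ℤ
      y = x ℤ.- 1ℤ
      y′₁ = y ℤ.+ 1ℤ
      y′₂ = y ℤ.+ + 2
      y′₃ = y ℤ.+ + 3
      y₁ : + g ℤ.∣ F y′₁
      y₁ = subst (λ y → + g ℤ.∣ F y) (ℤSolver.solve 1 (λ x → x , x ⊕ ⊝ con 1ℤ ⊕ con 1ℤ) x) d₀
      y₂ : + g ℤ.∣ F y′₂
      y₂ = subst (λ y → + g ℤ.∣ F y) (ℤSolver.solve 1 (λ x → x ⊕ con 1ℤ , x ⊕ ⊝ con 1ℤ ⊕ con (+ 2)) x) d₁
      y₃ : + g ℤ.∣ F y′₃
      y₃ = subst (λ y → + g ℤ.∣ F y) (ℤSolver.solve 1 (λ x → x ⊕ con (+ 2) , x ⊕ ⊝ con 1ℤ ⊕ con (+ 3)) x) d₂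

    all : ∀ x → Three x
    all = ℤ-induction Three (g∣F0 , g∣F1 , g∣F2) up down

-- Rational arithmetic and the embedding of ℤ.

module ℚSolver = Solver ℚ.+-*-commutativeRing
module Q = CubicForms ℚ.+-*-rawRing

ℚ-inverse : ∀ x → x ≢ 0ℚ → ∃[ y ] x ℚ.* y ≡ 1ℚ
ℚ-inverse x x≢0 = ℚ.1/_ x {{ℚ.≢-nonZero x≢0}} , ℚ.*-inverseʳ x {{ℚ.≢-nonZero x≢0}}

ℚ-cancelˡ : ∀ k {x y} → k ≢ 0ℚ → k ℚ.* x ≡ k ℚ.* y → x ≡ y
ℚ-cancelˡ k {x} {y} k≢0 kx≡ky = begin
  x                       ≡⟨ ℚ.*-identityˡ x ⟨
  1ℚ ℚ.* x                ≡⟨ cong (ℚ._* x) kk⁻¹≡1 ⟨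
  k ℚ.* k⁻¹ ℚ.* x         ≡⟨ ℚSolver.solve 3 (λ k k⁻¹ x → k ⊗ k⁻¹ ⊗ x , k⁻¹ ⊗ (k ⊗ x)) k k⁻¹ x ⟩
  k⁻¹ ℚ.* (k ℚ.* x)       ≡⟨ cong (k⁻¹ ℚ.*_) kx≡ky ⟩
  k⁻¹ ℚ.* (k ℚ.* y)       ≡⟨ ℚSolver.solve 3 (λ k k⁻¹ y → k⁻¹ ⊗ (k ⊗ y) , k ⊗ k⁻¹ ⊗ y) k k⁻¹ y ⟩
  k ℚ.* k⁻¹ ℚ.* y         ≡⟨ cong (ℚ._* y) kk⁻¹≡1 ⟩
  1ℚ ℚ.* y                ≡⟨ ℚ.*-identityˡ y ⟩
  y                       ∎
  where
  open ≡-Reasoning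
  k⁻¹ = proj₁ (ℚ-inverse k k≢0)
  kk⁻¹≡1 = proj₂ (ℚ-inverse k k≢0)

ℚ-zero-product : ∀ x y → x ≢ 0ℚ → x ℚ.* y ≡ 0ℚ → y ≡ 0ℚ
ℚ-zero-product x y x≢0 xy≡0 = ℚ-cancelˡ x x≢0 (trans xy≡0 (sym (ℚ.*-zeroʳ x)))

ℚ-*-≢0 : ∀ {x y} → x ≢ 0ℚ → y ≢ 0ℚ → x ℚ.* y ≢ 0ℚ
ℚ-*-≢0 {x} {y} x≢0 y≢0 xy≡0 = y≢0 (ℚ-zero-product x y x≢0 xy≡0)

toℚᵘ-ℤ→ℚ : ∀ n → ℚ.toℚᵘ (ℤ→ℚ n) ℚᵘ.≃ mkℚᵘ n 0
toℚᵘ-ℤ→ℚ n = ℚ.toℚᵘ-fromℚᵘ (mkℚᵘ n 0)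

ℤ→ℚ-+ : ∀ m n → ℤ→ℚ (m ℤ.+ n) ≡ ℤ→ℚ m ℚ.+ ℤ→ℚ n
ℤ→ℚ-+ m n = ℚ.toℚᵘ-injective (begin-equality
  ℚ.toℚᵘ (ℤ→ℚ (m ℤ.+ n))                  ≃⟨ toℚᵘ-ℤ→ℚ (m ℤ.+ n) ⟩
  mkℚᵘ (m ℤ.+ n) 0                        ≃⟨ *≡* (cong (ℤ._* + 1) (sym (cong₂ ℤ._+_ (ℤ.*-identityʳ m) (ℤ.*-identityʳ n)))) ⟩
  mkℚᵘ m 0 ℚᵘ.+ mkℚᵘ n 0                  ≃⟨ ℚᵘ.+-cong (toℚᵘ-ℤ→ℚ m) (toℚᵘ-ℤ→ℚ n) ⟨
  ℚ.toℚᵘ (ℤ→ℚ m) ℚᵘ.+ ℚ.toℚᵘ (ℤ→ℚ n)      ≃⟨ ℚ.toℚᵘ-homo-+ (ℤ→ℚ m) (ℤ→ℚ n) ⟨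
  ℚ.toℚᵘ (ℤ→ℚ m ℚ.+ ℤ→ℚ n)                ∎)
  where open ℚᵘ.≤-Reasoning

ℤ→ℚ-* : ∀ m n → ℤ→ℚ (m ℤ.* n) ≡ ℤ→ℚ m ℚ.* ℤ→ℚ n
ℤ→ℚ-* m n = ℚ.toℚᵘ-injective (begin-equality
  ℚ.toℚᵘ (ℤ→ℚ (m ℤ.* n))                  ≃⟨ toℚᵘ-ℤ→ℚ (m ℤ.* n) ⟩
  mkℚᵘ (m ℤ.* n) 0                        ≡⟨⟩
  mkℚᵘ m 0 ℚᵘ.* mkℚᵘ n 0                  ≃⟨ ℚᵘ.*-cong (toℚᵘ-ℤ→ℚ m) (toℚᵘ-ℤ→ℚ n) ⟨
  ℚ.toℚᵘ (ℤ→ℚ m) ℚᵘ.* ℚ.toℚᵘ (ℤ→ℚ n)      ≃⟨ ℚ.toℚᵘ-homo-* (ℤ→ℚ m) (ℤ→ℚ n) ⟨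
  ℚ.toℚᵘ (ℤ→ℚ m ℚ.* ℤ→ℚ n)                ∎)
  where open ℚᵘ.≤-Reasoning

ℤ→ℚ-neg : ∀ n → ℤ→ℚ (ℤ.- n) ≡ ℚ.- ℤ→ℚ n
ℤ→ℚ-neg n = ℚ.toℚᵘ-injective (begin-equality
  ℚ.toℚᵘ (ℤ→ℚ (ℤ.- n))      ≃⟨ toℚᵘ-ℤ→ℚ (ℤ.- n) ⟩
  ℚᵘ.- mkℚᵘ n 0             ≃⟨ ℚᵘ.-‿cong (toℚᵘ-ℤ→ℚ n) ⟨
  ℚᵘ.- ℚ.toℚᵘ (ℤ→ℚ n)       ≃⟨ ℚ.toℚᵘ-homo‿- (ℤ→ℚ n) ⟨
  ℚ.toℚᵘ (ℚ.- ℤ→ℚ n)        ∎)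
  where open ℚᵘ.≤-Reasoning

ℤ→ℚ-injective : ∀ {m n} → ℤ→ℚ m ≡ ℤ→ℚ n → m ≡ n
ℤ→ℚ-injective {m} {n} eq = unfold (ℚᵘ.≃-trans (ℚᵘ.≃-sym (toℚᵘ-ℤ→ℚ m))
  (ℚᵘ.≃-trans (ℚᵘ.≃-reflexive (cong ℚ.toℚᵘ eq)) (toℚᵘ-ℤ→ℚ n)))
  where
  unfold : mkℚᵘ m 0 ℚᵘ.≃ mkℚᵘ n 0 → m ≡ n
  unfold (*≡* m*1≡n*1) = trans (sym (ℤ.*-identityʳ m)) (trans m*1≡n*1 (ℤ.*-identityʳ n))

ℤ→ℚ-≢0 : ∀ {n} → n ≢ 0ℤ → ℤ→ℚ n ≢ 0ℚ
ℤ→ℚ-≢0 n≢0 eq = n≢0 (ℤ→ℚ-injective eq)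

ℤ→ℚ-isRingHomomorphism : RingMorphisms.IsRingHomomorphism ℤ.+-*-rawRing ℚ.+-*-rawRing ℤ→ℚ
ℤ→ℚ-isRingHomomorphism = record
  { isSemiringHomomorphism = record
    { isNearSemiringHomomorphism = record
      { +-isMonoidHomomorphism = record
        { isMagmaHomomorphism = record
          { isRelHomomorphism = record { cong = cong ℤ→ℚ }
          ; homo = ℤ→ℚ-+
          }
        ; ε-homo = refl
        }
      ; *-homo = ℤ→ℚ-*
      }
    ; 1#-homo = refl
    }
  ; -‿homo = ℤ→ℚ-neg
  }

clear-denominator : ∀ x → ∃[ n ] ∃[ d ] d ≢ 0ℤ × ℤ→ℚ d ℚ.* x ≡ ℤ→ℚ n
clear-denominator x = ℚ.↥ x , ℚ.↧ x , (λ ()) , ℚ.toℚᵘ-injective (begin-equality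
  ℚ.toℚᵘ (ℤ→ℚ (ℚ.↧ x) ℚ.* x)                   ≃⟨ ℚ.toℚᵘ-homo-* (ℤ→ℚ (ℚ.↧ x)) x ⟩
  ℚ.toℚᵘ (ℤ→ℚ (ℚ.↧ x)) ℚᵘ.* ℚ.toℚᵘ x           ≃⟨ ℚᵘ.*-congʳ (toℚᵘ-ℤ→ℚ (ℚ.↧ x)) ⟩
  mkℚᵘ (ℚ.↧ x) 0 ℚᵘ.* ℚ.toℚᵘ x                 ≃⟨ cross x ⟩
  mkℚᵘ (ℚ.↥ x) 0                               ≃⟨ toℚᵘ-ℤ→ℚ (ℚ.↥ x) ⟨
  ℚ.toℚᵘ (ℤ→ℚ (ℚ.↥ x))                         ∎)
  where
  open ℚᵘ.≤-Reasoning
  cross : ∀ x → mkℚᵘ (ℚ.↧ x) 0 ℚᵘ.* ℚ.toℚᵘ x ℚᵘ.≃ mkℚᵘ (ℚ.↥ x) 0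
  cross x@record{} = *≡* (trans (ℤ.*-identityʳ _) (trans (ℤ.*-comm (ℚ.↧ x) (ℚ.↥ x))
    (cong (λ d → ℚ.↥ x ℤ.* + d) (sym (ℕ.+-identityʳ (ℚ.↧ₙ x))))))

-- Homomorphisms, evaluation of polynomials, and irreducibility over ℚ.

module HomomorphicEvaluation {c₁ ℓ₁ c₂ ℓ₂} (R : RawRing c₁ ℓ₁) (S : CommutativeRing c₂ ℓ₂)
  {h : RawRing.Carrier R → CommutativeRing.Carrier S}
  (h-hom : RingMorphisms.IsRingHomomorphism R (CommutativeRing.rawRing S) h) where

  private
    module R = RawRing R
    module ER = Evaluation R
  open CommutativeRing S using (_≈_; +-cong; *-cong; -‿cong; reflexive; setoid) renaming (trans to ≈-trans; sym to ≈-sym; refl to ≈-refl)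
  open Evaluation (CommutativeRing.rawRing S)
  open RingMorphisms.IsRingHomomorphism h-hom
  open import Algebra.Definitions.RawSemiring R.rawSemiring using (_×′_)
  open import Algebra.Definitions.RawSemiring (RawRing.rawSemiring (CommutativeRing.rawRing S)) using () renaming (_×′_ to _·′_)

  ×′-homo : ∀ n → h (n ×′ R.1#) ≈ n ·′ CommutativeRing.1# S
  ×′-homo zero          = 0#-homo
  ×′-homo (suc zero)    = 1#-homo
  ×′-homo (suc (suc n)) = ≈-trans (+-homo _ _) (+-cong (×′-homo (suc n)) 1#-homo)

  fromℤ-homo : ∀ k → h (ER.fromℤ k) ≈ fromℤ k
  fromℤ-homo (+ n)    = ×′-homo n
  fromℤ-homo -[1+ n ] = ≈-trans (-‿homo _) (-‿cong (×′-homo (suc n)))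

  ⟦⟧-homo : ∀ {n} (e : Expr n) ρ → h (ER.⟦ e ⟧ ρ) ≈ ⟦ e ⟧ (Vec.map h ρ)
  ⟦⟧-homo (con k) ρ = fromℤ-homo k
  ⟦⟧-homo (var i) ρ = reflexive (sym (lookup-map i h ρ))
  ⟦⟧-homo (e ⊕ f) ρ = ≈-trans (+-homo _ _) (+-cong (⟦⟧-homo e ρ) (⟦⟧-homo f ρ))
  ⟦⟧-homo (e ⊗ f) ρ = ≈-trans (*-homo _ _) (*-cong (⟦⟧-homo e ρ) (⟦⟧-homo f ρ))
  ⟦⟧-homo (⊝ e)   ρ = ≈-trans (-‿homo _) (-‿cong (⟦⟧-homo e ρ))

module PolynomialEvaluation {c ℓ} (R : CommutativeRing c ℓ) where

  open CommutativeRing R renaming (refl to ≈-refl; trans to ≈-trans; sym to ≈-sym)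
  open Polynomial rawRing
  open Solver R using (solve)
  open import Relation.Binary.Reasoning.Setoid setoid

  eval-vanish : ∀ p x → (∀ k → coeff p k ≈ 0#) → eval p x ≈ 0#
  eval-vanish []      x p≈0 = ≈-refl
  eval-vanish (a ∷ p) x p≈0 = begin
    a + x * eval p x  ≈⟨ +-cong (p≈0 0) (*-congˡ (eval-vanish p x λ k → p≈0 (suc k))) ⟩
    0# + x * 0#       ≈⟨ solve 1 (λ x → con 0ℤ ⊕ x ⊗ con 0ℤ , con 0ℤ) x ⟩
    0#                ∎

  eval-cong : ∀ p q x → p ≈ₚ q → eval p x ≈ eval q x
  eval-cong []      q       x p≈q = ≈-sym (eval-vanish q x λ k → ≈-sym (p≈q k))
  eval-cong (a ∷ p) []      x p≈q = eval-vanish (a ∷ p) x p≈q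
  eval-cong (a ∷ p) (b ∷ q) x p≈q = +-cong (p≈q 0) (*-congˡ (eval-cong p q x λ k → p≈q (suc k)))

  eval-+ : ∀ p q x → eval (p +ₚ q) x ≈ eval p x + eval q x
  eval-+ []      q       x = ≈-sym (+-identityˡ _)
  eval-+ (a ∷ p) []      x = ≈-sym (+-identityʳ _)
  eval-+ (a ∷ p) (b ∷ q) x = begin
    a + b + x * eval (p +ₚ q) x            ≈⟨ +-congˡ (*-congˡ (eval-+ p q x)) ⟩
    a + b + x * (eval p x + eval q x)
      ≈⟨ solve 5 (λ a b x p q → a ⊕ b ⊕ x ⊗ (p ⊕ q) , a ⊕ x ⊗ p ⊕ (b ⊕ x ⊗ q)) a b x (eval p x) (eval q x) ⟩
    a + x * eval p x + (b + x * eval q x)  ∎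

  eval-scale : ∀ a p x → eval (List.map (a *_) p) x ≈ a * eval p x
  eval-scale a []      x = ≈-sym (zeroʳ a)
  eval-scale a (b ∷ p) x = begin
    a * b + x * eval (List.map (a *_) p) x  ≈⟨ +-congˡ (*-congˡ (eval-scale a p x)) ⟩
    a * b + x * (a * eval p x)              ≈⟨ solve 4 (λ a b x p → a ⊗ b ⊕ x ⊗ (a ⊗ p) , a ⊗ (b ⊕ x ⊗ p)) a b x (eval p x) ⟩
    a * (b + x * eval p x)                  ∎

  eval-* : ∀ p q x → eval (p *ₚ q) x ≈ eval p x * eval q x
  eval-* []      q x = ≈-sym (zeroˡ _)
  eval-* (a ∷ p) q x = begin
    eval (List.map (a *_) q +ₚ (0# ∷ p *ₚ q)) x           ≈⟨ eval-+ (List.map (a *_) q) _ x ⟩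
    eval (List.map (a *_) q) x + (0# + x * eval (p *ₚ q) x) ≈⟨ +-cong (eval-scale a q x) (+-congˡ (*-congˡ (eval-* p q x))) ⟩
    a * eval q x + (0# + x * (eval p x * eval q x))
      ≈⟨ solve 4 (λ a x p q → a ⊗ q ⊕ (con 0ℤ ⊕ x ⊗ (p ⊗ q)) , (a ⊕ x ⊗ p) ⊗ q) a x (eval p x) (eval q x) ⟩
    (a + x * eval p x) * eval q x                         ∎

module _ where

  open PolynomialEvaluation ℚ.+-*-commutativeRing
  open ℚ[X] using (coeff; _+ₚ_; _*ₚ_; _≈ₚ_)
  open RawSemiringDefs (RawRing.rawSemiring ℚ[X].polyRawRing) using (_∣_; mkIrred)

  coeff-+ : ∀ p q k → coeff (p +ₚ q) k ≡ coeff p k ℚ.+ coeff q k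
  coeff-+ []      q       k       = sym (ℚ.+-identityˡ _)
  coeff-+ (a ∷ p) []      k       = sym (ℚ.+-identityʳ _)
  coeff-+ (a ∷ p) (b ∷ q) zero    = refl
  coeff-+ (a ∷ p) (b ∷ q) (suc k) = coeff-+ p q k

  module _ (s t : ℚ) where

    private
      quadratic : ℚ[X].Poly
      quadratic = s ∷ t ∷ 1ℚ ∷ []

    -- Otherwise the leading coefficient of q would survive in q * quadratic.
    quadratic-multiple-vanish : ∀ q → (∀ k → coeff (q *ₚ quadratic) (suc (suc k)) ≡ 0ℚ) → ∀ k → coeff q k ≡ 0ℚ
    quadratic-multiple-vanish []      _    k = refl
    quadratic-multiple-vanish (c ∷ q) high k = vanish k
      where
      open ≡-Reasoning
      tail : ∀ k → coeff (q *ₚ quadratic) (suc (suc k)) ≡ 0ℚ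
      tail k = begin
        coeff (q *ₚ quadratic) (suc (suc k))            ≡⟨ ℚ.+-identityˡ _ ⟨
        0ℚ ℚ.+ coeff (q *ₚ quadratic) (suc (suc k))     ≡⟨ coeff-+ (List.map (c ℚ.*_) quadratic) (0ℚ ∷ (q *ₚ quadratic)) (suc (suc (suc k))) ⟨
        coeff ((c ∷ q) *ₚ quadratic) (suc (suc (suc k))) ≡⟨ high (suc k) ⟩
        0ℚ                                              ∎
      q≈0 : ∀ k → coeff q k ≡ 0ℚ
      q≈0 = quadratic-multiple-vanish q tail
      degree1 : ∀ q → (∀ k → coeff q k ≡ 0ℚ) → coeff (q *ₚ quadratic) 1 ≡ 0ℚ
      degree1 []      _   = refl
      degree1 (d ∷ q) q≈0 = begin
        coeff ((d ∷ q) *ₚ quadratic) 1                 ≡⟨ coeff-+ (List.map (d ℚ.*_) quadratic) (0ℚ ∷ (q *ₚ quadratic)) 1 ⟩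
        d ℚ.* t ℚ.+ coeff (q *ₚ quadratic) 0           ≡⟨ cong₂ (λ x y → x ℚ.* t ℚ.+ y) (q≈0 0) (degree0 q λ k → q≈0 (suc k)) ⟩
        0ℚ ℚ.* t ℚ.+ 0ℚ                                ≡⟨ ℚSolver.solve 1 (λ t → con 0ℤ ⊗ t ⊕ con 0ℤ , con 0ℤ) t ⟩
        0ℚ                                             ∎
        where
        degree0 : ∀ q → (∀ k → coeff q k ≡ 0ℚ) → coeff (q *ₚ quadratic) 0 ≡ 0ℚ
        degree0 []      _   = refl
        degree0 (d ∷ q) q≈0 = begin
          coeff ((d ∷ q) *ₚ quadratic) 0  ≡⟨ coeff-+ (List.map (d ℚ.*_) quadratic) (0ℚ ∷ (q *ₚ quadratic)) 0 ⟩
          d ℚ.* s ℚ.+ 0ℚ                  ≡⟨ cong (λ x → x ℚ.* s ℚ.+ 0ℚ) (q≈0 0) ⟩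
          0ℚ ℚ.* s ℚ.+ 0ℚ                 ≡⟨ ℚSolver.solve 1 (λ t → con 0ℤ ⊗ t ⊕ con 0ℤ , con 0ℤ) s ⟩
          0ℚ                              ∎
      c≡0 : c ≡ 0ℚ
      c≡0 = begin
        c                                               ≡⟨ ℚSolver.solve 1 (λ c → c , c ⊗ con 1ℤ ⊕ con 0ℤ) c ⟩
        c ℚ.* 1ℚ ℚ.+ 0ℚ                                 ≡⟨ cong (c ℚ.* 1ℚ ℚ.+_) (degree1 q q≈0) ⟨
        c ℚ.* 1ℚ ℚ.+ coeff (q *ₚ quadratic) 1           ≡⟨ coeff-+ (List.map (c ℚ.*_) quadratic) (0ℚ ∷ (q *ₚ quadratic)) 2 ⟨
        coeff ((c ∷ q) *ₚ quadratic) 2                  ≡⟨ high 0 ⟩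
        0ℚ                                              ∎
      vanish : ∀ k → coeff (c ∷ q) k ≡ 0ℚ
      vanish zero    = c≡0
      vanish (suc k) = q≈0 k

    -- A linear factor has a rational root at which to evaluate; a quadratic one need not, hence the
    -- argument by degrees, which first shows that the cofactor is zero.
    quadratic∤1 : ¬ (quadratic ∣ ℚ[X].C 1ℚ)
    quadratic∤1 record { quotient = q ; equality = q*g≈1 } = contradiction 1≡0 λ ()
      where
      q≈0 : ∀ k → coeff q k ≡ 0ℚ
      q≈0 = quadratic-multiple-vanish q λ k → q*g≈1 (suc (suc k))
      open ≡-Reasoning
      1≡0 : 1ℚ ≡ 0ℚ
      1≡0 = begin
        1ℚ                                             ≡⟨⟩
        ℚ[X].eval (ℚ[X].C 1ℚ) 0ℚ                       ≡⟨ eval-cong (q *ₚ quadratic) (ℚ[X].C 1ℚ) 0ℚ q*g≈1 ⟨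
        ℚ[X].eval (q *ₚ quadratic) 0ℚ                  ≡⟨ eval-* q quadratic 0ℚ ⟩
        ℚ[X].eval q 0ℚ ℚ.* ℚ[X].eval quadratic 0ℚ      ≡⟨ cong (ℚ._* ℚ[X].eval quadratic 0ℚ) (eval-vanish q 0ℚ q≈0) ⟩
        0ℚ ℚ.* ℚ[X].eval quadratic 0ℚ                  ≡⟨ ℚ.*-zeroˡ (ℚ[X].eval quadratic 0ℚ) ⟩
        0ℚ                                             ∎

  linear∤1 : ∀ t → ¬ ((ℚ.- t ∷ 1ℚ ∷ []) ∣ ℚ[X].C 1ℚ)
  linear∤1 t record { quotient = q ; equality = q*g≈1 } = contradiction 1≡0 λ ()
    where
    open ≡-Reasoning
    1≡0 : 1ℚ ≡ 0ℚ
    1≡0 = begin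
      1ℚ                                                     ≡⟨ ℚSolver.solve 1 (λ t → con 1ℤ , con 1ℤ ⊕ t ⊗ con 0ℤ) t ⟩
      ℚ[X].eval (ℚ[X].C 1ℚ) t                                ≡⟨ eval-cong (q *ₚ (ℚ.- t ∷ 1ℚ ∷ [])) (ℚ[X].C 1ℚ) t q*g≈1 ⟨
      ℚ[X].eval (q *ₚ (ℚ.- t ∷ 1ℚ ∷ [])) t                   ≡⟨ eval-* q (ℚ.- t ∷ 1ℚ ∷ []) t ⟩
      ℚ[X].eval q t ℚ.* (ℚ.- t ℚ.+ t ℚ.* (1ℚ ℚ.+ t ℚ.* 0ℚ))
        ≡⟨ ℚSolver.solve 2 (λ q t → q ⊗ (⊝ t ⊕ t ⊗ (con 1ℤ ⊕ t ⊗ con 0ℤ)) , con 0ℤ) (ℚ[X].eval q t) t ⟩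
      0ℚ                                                     ∎

  module _ (a b : ℤ) where

    irreducible⇒no-root : ℚ[X].Irreducible (ℤ[X]→ℚ[X] (cubic a b)) →
      ∀ t → t ℚ.* t ℚ.* t ≢ ℤ→ℚ a ℚ.* t ℚ.+ ℤ→ℚ (ℤ.- b)
    irreducible⇒no-root (mkIrred _ split) t t³≡at-b =
      [ linear∤1 t , quadratic∤1 _ _ ]′ (split {ℚ.- t ∷ 1ℚ ∷ []} {g} factorisation)
      where
      A = ℤ→ℚ a
      g : ℚ[X].Poly
      g = t ℚ.* t ℚ.- A ∷ t ∷ 1ℚ ∷ []
      open ≡-Reasoning
      factorisation : ℤ[X]→ℚ[X] (cubic a b) ≈ₚ (ℚ.- t ∷ 1ℚ ∷ []) *ₚ g
      factorisation 0 = begin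
        ℤ→ℚ b                                      ≡⟨ ℚSolver.solve 1 (λ b → b , ⊝ (⊝ b)) (ℤ→ℚ b) ⟩
        ℚ.- (ℚ.- ℤ→ℚ b)                            ≡⟨ cong ℚ.-_ (ℤ→ℚ-neg b) ⟨
        ℚ.- ℤ→ℚ (ℤ.- b)                            ≡⟨ ℚSolver.solve 2 (λ y B → ⊝ B , y ⊕ ⊝ (y ⊕ B)) (A ℚ.* t) (ℤ→ℚ (ℤ.- b)) ⟩
        A ℚ.* t ℚ.- (A ℚ.* t ℚ.+ ℤ→ℚ (ℤ.- b))      ≡⟨ cong (λ x → A ℚ.* t ℚ.- x) t³≡at-b ⟨
        A ℚ.* t ℚ.- t ℚ.* t ℚ.* t                  ≡⟨ ℚSolver.solve 2 (λ t A → A ⊗ t ⊕ ⊝ (t ⊗ t ⊗ t) , ⊝ t ⊗ (t ⊗ t ⊕ ⊝ A) ⊕ con 0ℤ) t A ⟩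
        ℚ.- t ℚ.* (t ℚ.* t ℚ.- A) ℚ.+ 0ℚ           ∎
      factorisation 1 = trans (ℤ→ℚ-neg a)
        (ℚSolver.solve 2 (λ t A → ⊝ A , ⊝ t ⊗ t ⊕ (con 1ℤ ⊗ (t ⊗ t ⊕ ⊝ A) ⊕ con 0ℤ)) t A)
      factorisation 2 = ℚSolver.solve 1 (λ t → con 0ℤ , ⊝ t ⊗ con 1ℤ ⊕ con 1ℤ ⊗ t) t
      factorisation 3 = refl
      factorisation (suc (suc (suc (suc k)))) = refl

-- Characteristic polynomials by Newton's identities.

module CharacteristicPolynomial {c ℓ} (R : RawRing c ℓ) where

  open RawRing R
  open Polynomial R
  open RawSemiringDefs rawSemiring using (sum)

  charPolyOf : ∀ n → (Fin n → Fin n → Carrier) → Poly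
  charPolyOf n M = Determinant.det polyRawRing n λ i j →
    (if does (i Fin.≟ j) then X else []) +ₚ C (- M i j)

  -- The traces of M, M² and M³, with the factors in the order in which the expansion `coords-*` of
  -- a product produces them.
  powerSum₁ powerSum₂ powerSum₃ : ∀ n → (Fin n → Fin n → Carrier) → Carrier
  powerSum₁ n M = sum {n} λ i → M i i
  powerSum₂ n M = sum {n} λ i → sum {n} λ j → M j i * M i j
  powerSum₃ n M = sum {n} λ i → sum {n} λ j → M j i * (sum {n} λ k → M k j * M i k)

module Newton {c ℓ} (R : CommutativeRing c ℓ) where

  open CommutativeRing R renaming (refl to ≈-refl)
  open Polynomial rawRing
  open CharacteristicPolynomial rawRing
  open Solver R using (ring-identity; ⟦_⟧)

  private
    module S = CharacteristicPolynomial (exprRing 9)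
    module SP = Polynomial (exprRing 9)

    entry : Fin 3 → Fin 3 → Fin 9
    entry 0F 0F = 0F
    entry 0F 1F = 1F
    entry 0F 2F = 2F
    entry 1F 0F = 3F
    entry 1F 1F = 4F
    entry 1F 2F = 5F
    entry 2F 0F = 6F
    entry 2F 1F = 7F
    entry 2F 2F = 8F

    -- Computing the determinant over the expressions themselves gives expressions whose values at
    -- the entries of a matrix unfold to the coefficients of its characteristic polynomial. Newton's
    -- identities are thereby ring identities in nine variables.
    generic : Fin 3 → Fin 3 → Expr 9
    generic i j = var (entry i j)

    t₁ t₂ t₃ : Expr 9
    t₁ = S.powerSum₁ 3 generic
    t₂ = S.powerSum₂ 3 generic
    t₃ = S.powerSum₃ 3 generic

    coefficient : ℕ → Expr 9
    coefficient = SP.coeff (S.charPolyOf 3 generic)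

  module _ (M : Fin 3 → Fin 3 → Carrier) where

    private
      ρ : Vec Carrier 9
      ρ = M 0F 0F ∷ M 0F 1F ∷ M 0F 2F ∷ M 1F 0F ∷ M 1F 1F ∷ M 1F 2F ∷ M 2F 0F ∷ M 2F 1F ∷ M 2F 2F ∷ []
      χ : ℕ → Carrier
      χ = coeff (charPolyOf 3 M)
      p₁ p₂ p₃ : Carrier
      p₁ = powerSum₁ 3 M
      p₂ = powerSum₂ 3 M
      p₃ = powerSum₃ 3 M

    leading-coefficient : χ 3 ≈ 1#
    leading-coefficient = ring-identity (coefficient 3) (con 1ℤ) ρ

    newton₁ : χ 2 ≈ - p₁
    newton₁ = ring-identity (coefficient 2) (⊝ t₁) ρ

    newton₂ : (1# + 1#) * χ 1 ≈ p₁ * p₁ - p₂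
    newton₂ = ring-identity (con (+ 2) ⊗ coefficient 1) (t₁ ⊗ t₁ ⊕ ⊝ t₂) ρ

    newton₃ : (1# + 1# + 1# + 1# + 1# + 1#) * χ 0 ≈ - (p₁ * (p₁ * p₁) + - ((1# + 1# + 1#) * (p₁ * p₂)) + (1# + 1#) * p₃)
    newton₃ = ring-identity (con (+ 6) ⊗ coefficient 0) (⊝ (t₁ ⊗ (t₁ ⊗ t₁) ⊕ ⊝ (con (+ 3) ⊗ (t₁ ⊗ t₂)) ⊕ con (+ 2) ⊗ t₃)) ρ

open CharacteristicPolynomial ℚ.+-*-rawRing using (charPolyOf; powerSum₁; powerSum₂; powerSum₃)

-- The `degree` of a `NumberField` is 3 only up to a proof, hence the variable n. Newton's
-- identities carry factors 2 and 6, which can be cancelled in ℚ.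
charPoly-from-power-sums : ∀ n M t s r → n ≡ 3 →
  powerSum₁ n M ≡ t →
  powerSum₂ n M ≡ t ℚ.* t ℚ.- (1ℚ ℚ.+ 1ℚ) ℚ.* s →
  powerSum₃ n M ≡ t ℚ.* t ℚ.* t ℚ.- (1ℚ ℚ.+ 1ℚ ℚ.+ 1ℚ) ℚ.* (t ℚ.* s) ℚ.+ (1ℚ ℚ.+ 1ℚ ℚ.+ 1ℚ) ℚ.* r →
  (ℚ.- r ∷ s ∷ ℚ.- t ∷ 1ℚ ∷ []) ℚ[X].≈ₚ charPolyOf n M
charPoly-from-power-sums n M t s r refl p₁ p₂ p₃ = λ where
    0 → ℚ-cancelˡ 6ℚ (λ ()) (sym (trans (newton₃ M) (trans
      (cong₂ (λ p r → ℚ.- (p ℚ.* (p ℚ.* p) ℚ.+ ℚ.- (3ℚ ℚ.* (p ℚ.* powerSum₂ 3 M)) ℚ.+ 2ℚ ℚ.* r)) p₁ p₃) (trans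
      (cong (λ q → ℚ.- (t ℚ.* (t ℚ.* t) ℚ.+ ℚ.- (3ℚ ℚ.* (t ℚ.* q)) ℚ.+ 2ℚ ℚ.* (t ℚ.* t ℚ.* t ℚ.- 3ℚ ℚ.* (t ℚ.* s) ℚ.+ 3ℚ ℚ.* r))) p₂)
      (ℚSolver.solve 3 (λ t s r → ⊝ (t ⊗ (t ⊗ t) ⊕ ⊝ (con (+ 3) ⊗ (t ⊗ (t ⊗ t ⊕ ⊝ (con (+ 2) ⊗ s))))
          ⊕ con (+ 2) ⊗ (t ⊗ t ⊗ t ⊕ ⊝ (con (+ 3) ⊗ (t ⊗ s)) ⊕ con (+ 3) ⊗ r)) , con (+ 6) ⊗ ⊝ r) t s r)))))
    1 → ℚ-cancelˡ 2ℚ (λ ()) (sym (trans (newton₂ M) (trans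
      (cong₂ (λ p q → p ℚ.* p ℚ.- q) p₁ p₂)
      (ℚSolver.solve 2 (λ t s → t ⊗ t ⊕ ⊝ (t ⊗ t ⊕ ⊝ (con (+ 2) ⊗ s)) , con (+ 2) ⊗ s) t s))))
    2 → sym (trans (newton₁ M) (cong ℚ.-_ p₁))
    3 → sym (leading-coefficient M)
    (suc (suc (suc (suc k)))) → refl
  where
  open Newton ℚ.+-*-commutativeRing
  2ℚ 3ℚ 6ℚ : ℚ
  2ℚ = 1ℚ ℚ.+ 1ℚ
  3ℚ = 1ℚ ℚ.+ 1ℚ ℚ.+ 1ℚ
  6ℚ = 1ℚ ℚ.+ 1ℚ ℚ.+ 1ℚ ℚ.+ 1ℚ ℚ.+ 1ℚ ℚ.+ 1ℚ

-- Coordinates and traces in a number field.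

module ℚSum = SemiringSum (CommutativeRing.semiring ℚ.+-*-commutativeRing)

module LinearAlgebra {c ℓ} (K : NumberField c ℓ) where

  open NumberField K renaming (refl to ≈-refl; sym to ≈-sym; trans to ≈-trans; sum to K-sum)
  open RingMorphisms.IsRingHomomorphism ι-hom public
    renaming (+-homo to ι-+; *-homo to ι-*; -‿homo to ι-neg; 0#-homo to ι-0; 1#-homo to ι-1; ⟦⟧-cong to ι-cong)
  open Solver commutativeRing using (solve)
  open SemiringSum semiring using (sum; sum-cong-≋; ∑-comm; ∑-distrib-+; *-distribˡ-sum; *-distribʳ-sum)
  open import Relation.Binary.Reasoning.Setoid setoid

  ι-sum : ∀ {n} (r : Vector ℚ n) → ι (ℚSum.sum r) ≈ sum (λ i → ι (r i))
  ι-sum {zero}  r = ι-0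
  ι-sum {suc n} r = ≈-trans (ι-+ _ _) (+-congˡ (ι-sum (λ i → r (suc i))))

  combination : ∀ {n} → Vector ℚ n → Vector Carrier n → Carrier
  combination r z = sum (λ i → ι (r i) * z i)

  combination-congʳ : ∀ {n} (r : Vector ℚ n) {y z} → (∀ i → y i ≈ z i) → combination r y ≈ combination r z
  combination-congʳ r y≈z = sum-cong-≋ λ i → *-congˡ (y≈z i)

  *-combination : ∀ {n} y (r : Vector ℚ n) z → y * combination r z ≈ combination r (λ i → y * z i)
  *-combination y r z = ≈-trans (*-distribˡ-sum y (λ i → ι (r i) * z i))
    (sum-cong-≋ λ i → solve 3 (λ y r z → y ⊗ (r ⊗ z) , r ⊗ (y ⊗ z)) y (ι (r i)) (z i))

  combination-minus : ∀ {n} (r s : Vector ℚ n) z →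
    combination (λ i → r i ℚ.- s i) z + combination s z ≈ combination r z
  combination-minus r s z = ≈-trans (≈-sym (∑-distrib-+ (λ i → ι (r i ℚ.- s i) * z i) (λ i → ι (s i) * z i)))
    (sum-cong-≋ λ i → begin
      ι (r i ℚ.- s i) * z i + ι (s i) * z i       ≈⟨ +-congʳ (*-congʳ (≈-trans (ι-+ _ _) (+-congˡ (ι-neg _)))) ⟩
      (ι (r i) - ι (s i)) * z i + ι (s i) * z i
        ≈⟨ solve 3 (λ r s z → (r ⊕ ⊝ s) ⊗ z ⊕ s ⊗ z , r ⊗ z) (ι (r i)) (ι (s i)) (z i) ⟩
      ι (r i) * z i                               ∎)

  record Basis (n : ℕ) : Set (c ⊔ ℓ) where
    field
      vector  : Vector Carrier n
      coords  : Carrier → Vector ℚ n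
      spans   : ∀ x → x ≈ combination (coords x) vector
      independent₀ : ∀ r → combination r vector ≈ 0# → ∀ i → r i ≡ 0ℚ

    coords-unique : ∀ {x} r → x ≈ combination r vector → ∀ i → coords x i ≡ r i
    coords-unique {x} r x≈ i = trans
      (sym (ℚSolver.solve 2 (λ x y → (x ⊕ ⊝ y) ⊕ y , x) (coords x i) (r i)))
      (trans (cong (ℚ._+ r i) (independent₀ (λ i → coords x i ℚ.- r i) difference≈0 i)) (ℚ.+-identityˡ (r i)))
      where
      difference≈0 : combination (λ i → coords x i ℚ.- r i) vector ≈ 0#
      difference≈0 = begin
        d                                                ≈⟨ solve 2 (λ d e → d , d ⊕ e ⊕ ⊝ e) d (combination r vector) ⟩
        d + combination r vector - combination r vector  ≈⟨ +-cong (combination-minus (coords x) r vector) (-‿cong (≈-sym x≈)) ⟩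
        combination (coords x) vector - x                ≈⟨ +-congʳ (spans x) ⟨
        x - x                                            ≈⟨ -‿inverseʳ x ⟩
        0#                                               ∎
        where d = combination (λ i → coords x i ℚ.- r i) vector

    coords-cong : ∀ {x y} → x ≈ y → ∀ i → coords x i ≡ coords y i
    coords-cong {x} {y} x≈y = coords-unique (coords y) (≈-trans x≈y (spans y))

    coords-combination : ∀ {m} (r : Vector ℚ m) z i →
      coords (combination r z) i ≡ ℚSum.sum (λ a → r a ℚ.* coords (z a) i)
    coords-combination {m} r z = coords-unique (λ i → ℚSum.sum (λ a → r a ℚ.* coords (z a) i)) (begin
      combination r z
        ≈⟨ combination-congʳ r (λ a → spans (z a)) ⟩
      sum (λ a → ι (r a) * sum (λ i → ι (coords (z a) i) * vector i))
        ≈⟨ sum-cong-≋ {m} (λ a → *-distribˡ-sum (ι (r a)) (λ i → ι (coords (z a) i) * vector i)) ⟩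
      sum (λ a → sum (λ i → ι (r a) * (ι (coords (z a) i) * vector i)))
        ≈⟨ ∑-comm (λ a i → ι (r a) * (ι (coords (z a) i) * vector i)) ⟩
      sum (λ i → sum (λ a → ι (r a) * (ι (coords (z a) i) * vector i)))
        ≈⟨ sum-cong-≋ {n} (λ i → sum-cong-≋ {m} (λ a → ≈-trans (≈-sym (*-assoc _ _ _)) (*-congʳ (≈-sym (ι-* (r a) (coords (z a) i)))))) ⟩
      sum (λ i → sum (λ a → ι (r a ℚ.* coords (z a) i) * vector i))
        ≈⟨ sum-cong-≋ {n} (λ i → *-distribʳ-sum (vector i) (λ a → ι (r a ℚ.* coords (z a) i))) ⟨
      sum (λ i → sum (λ a → ι (r a ℚ.* coords (z a) i)) * vector i)
        ≈⟨ sum-cong-≋ {n} (λ i → *-congʳ (ι-sum (λ a → r a ℚ.* coords (z a) i))) ⟨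
      combination (λ i → ℚSum.sum (λ a → r a ℚ.* coords (z a) i)) vector ∎)

    coords-* : ∀ y x i → coords (y * x) i ≡ ℚSum.sum (λ a → coords x a ℚ.* coords (y * vector a) i)
    coords-* y x i = trans (coords-cong (≈-trans (*-congˡ (spans x)) (*-combination y (coords x) vector)) i)
      (coords-combination (coords x) (λ a → y * vector a) i)

    basisTrace : Carrier → ℚ
    basisTrace y = ℚSum.sum (λ i → coords (y * vector i) i)

    matrix : Carrier → Fin n → Fin n → ℚ
    matrix y i j = coords (y * vector j) i

    matrix-powerSum₂ : ∀ y → powerSum₂ n (matrix y) ≡ basisTrace (y * y)
    matrix-powerSum₂ y = ℚSum.sum-cong-≗ {n} λ i → sym
      (trans (coords-cong (*-assoc y y (vector i)) i) (coords-* y (y * vector i) i))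

    matrix-powerSum₃ : ∀ y → powerSum₃ n (matrix y) ≡ basisTrace (y * (y * y))
    matrix-powerSum₃ y = ℚSum.sum-cong-≗ {n} λ i → sym (trans
      (coords-cong (solve 2 (λ y v → y ⊗ (y ⊗ y) ⊗ v , y ⊗ y ⊗ (y ⊗ v)) y (vector i)) i)
      (trans (coords-* (y * y) (y * vector i) i)
        (ℚSum.sum-cong-≗ {n} λ j → cong (coords (y * vector i) j ℚ.*_)
          (trans (coords-cong (*-assoc y y (vector j)) i) (coords-* y (y * vector j) i)))))

  open Basis

  -- Let P hold the F-coordinates of y times the vectors of E, and Q the E-coordinates of the
  -- vectors of F. Then y has the matrix QP in E and PQ in F. The sizes m and n may differ a priori,
  -- which is what `basis-size-unique` rests on.
  basisTrace-invariant : ∀ {m n} (E : Basis m) (F : Basis n) y → basisTrace E y ≡ basisTrace F y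
  basisTrace-invariant {m} {n} E F y =
    trans (ℚSum.sum-cong-≗ {m} expand)
    (trans (ℚSum.∑-comm {m} {n} λ i a → coords F (y * vector E i) a ℚ.* coords E (vector F a) i)
    (trans (ℚSum.sum-cong-≗ {n} λ a → ℚSum.sum-cong-≗ {m} λ i → ℚ.*-comm (coords F (y * vector E i) a) (coords E (vector F a) i))
    (ℚSum.sum-cong-≗ {n} contract)))
    where
    expand : ∀ i → coords E (y * vector E i) i ≡ ℚSum.sum (λ a → coords F (y * vector E i) a ℚ.* coords E (vector F a) i)
    expand i = trans (coords-cong E (spans F (y * vector E i)) i)
      (coords-combination E (coords F (y * vector E i)) (vector F) i)
    contract : ∀ a → ℚSum.sum (λ i → coords E (vector F a) i ℚ.* coords F (y * vector E i) a) ≡ coords F (y * vector F a) a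
    contract a = sym (trans (coords-cong F (≈-trans (*-congˡ (spans E (vector F a))) (*-combination y (coords E (vector F a)) (vector E))) a)
      (coords-combination F (coords E (vector F a)) (λ i → y * vector E i) a))

  givenBasis : Basis degree
  givenBasis = record { vector = basis ; coords = coord ; spans = spanning ; independent₀ = independent }

  unit : ∀ {n} → Fin n → Vector ℚ n
  unit zero    zero    = 1ℚ
  unit zero    (suc j) = 0ℚ
  unit (suc i) zero    = 0ℚ
  unit (suc i) (suc j) = unit i j

  combination-zero : ∀ {n} (z : Vector Carrier n) → combination (λ _ → 0ℚ) z ≈ 0#
  combination-zero {zero}  z = ≈-refl
  combination-zero {suc n} z = begin
    ι 0ℚ * z 0F + combination (λ _ → 0ℚ) (λ i → z (suc i))  ≈⟨ +-cong (*-congʳ ι-0) (combination-zero λ i → z (suc i)) ⟩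
    0# * z 0F + 0#                                          ≈⟨ solve 1 (λ z → con 0ℤ ⊗ z ⊕ con 0ℤ , con 0ℤ) (z 0F) ⟩
    0#                                                      ∎

  combination-unit : ∀ {n} (i : Fin n) (z : Vector Carrier n) → combination (unit i) z ≈ z i
  combination-unit {suc n} zero z = begin
    ι 1ℚ * z 0F + combination (λ _ → 0ℚ) (λ i → z (suc i))  ≈⟨ +-cong (*-congʳ ι-1) (combination-zero λ i → z (suc i)) ⟩
    1# * z 0F + 0#                                          ≈⟨ solve 1 (λ z → con 1ℤ ⊗ z ⊕ con 0ℤ , z) (z 0F) ⟩
    z 0F                                                    ∎
  combination-unit {suc n} (suc i) z = begin
    ι 0ℚ * z 0F + combination (unit i) (λ i → z (suc i))    ≈⟨ +-cong (*-congʳ ι-0) (combination-unit i λ i → z (suc i)) ⟩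
    0# * z 0F + z (suc i)                                   ≈⟨ solve 2 (λ y z → con 0ℤ ⊗ y ⊕ z , z) (z 0F) (z (suc i)) ⟩
    z (suc i)                                               ∎

  unit-diagonal : ∀ {n} (i : Fin n) → unit i i ≡ 1ℚ
  unit-diagonal zero    = refl
  unit-diagonal (suc i) = unit-diagonal i

  sum-ones : ∀ n → ℚSum.sum {n} (λ _ → 1ℚ) ≡ ℤ→ℚ (+ n)
  sum-ones zero    = refl
  sum-ones (suc n) = trans (cong (1ℚ ℚ.+_) (sum-ones n)) (sym (ℤ→ℚ-+ 1ℤ (+ n)))

  basisTrace-1 : ∀ {n} (E : Basis n) → basisTrace E 1# ≡ ℤ→ℚ (+ n)
  basisTrace-1 {n} E = trans (ℚSum.sum-cong-≗ {n} λ i → trans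
    (coords-unique E (unit i) (≈-trans (*-identityˡ _) (≈-sym (combination-unit i (vector E)))) i) (unit-diagonal i)) (sum-ones n)

  basis-size-unique : ∀ {m n} → Basis m → Basis n → m ≡ n
  basis-size-unique E F = ℤ.+-injective (ℤ→ℚ-injective
    (trans (sym (basisTrace-1 E)) (trans (basisTrace-invariant E F 1#) (basisTrace-1 F))))

-- The cubic field in the basis 1, θ, θ².

CubicRelation : ∀ {c ℓ} (K : NumberField c ℓ) (A B : ℚ) → NumberField.Carrier K → Set ℓ
CubicRelation K A B θ = θ * θ * θ ≈ ι A * θ + ι B
  where open NumberField K

module CubicField {c ℓ} (K : NumberField c ℓ) (A B : ℚ)
  (no-root : ∀ t → t ℚ.* t ℚ.* t ≢ A ℚ.* t ℚ.+ B)
  (θ : NumberField.Carrier K)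
  (θ³≈ : CubicRelation K A B θ) (θ-primitive : IsPrimitive K θ) where

  open NumberField K renaming (refl to ≈-refl; sym to ≈-sym; trans to ≈-trans)

  open LinearAlgebra K
  open Solver commutativeRing using (solve; x-y≈0⇒x≈y)
  open HomomorphicEvaluation ℚ.+-*-rawRing commutativeRing ι-hom using () renaming (⟦⟧-homo to ι-⟦⟧)
  open import Relation.Binary.Reasoning.Setoid setoid
  open Basis

  element : ℚ → ℚ → ℚ → Carrier
  element u v w = ι u + ι v * θ + ι w * (θ * θ)

  element-cong : ∀ {u v w u′ v′ w′} → u ≡ u′ → v ≡ v′ → w ≡ w′ → element u v w ≈ element u′ v′ w′
  element-cong refl refl refl = ≈-refl

  relation≈0 : θ * θ * θ - (ι A * θ + ι B) ≈ 0#
  relation≈0 = ≈-trans (+-congʳ θ³≈) (-‿inverseʳ _)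

  -- Given the cofactor z of the cubic relation, an equality that depends on this relation becomes
  -- an identity for the ring solver.
  reduce : ∀ {x y} z → x ≈ y + z * (θ * θ * θ - (ι A * θ + ι B)) → x ≈ y
  reduce {x} {y} z x≈ = begin
    x                                           ≈⟨ x≈ ⟩
    y + z * (θ * θ * θ - (ι A * θ + ι B))       ≈⟨ +-congˡ (*-congˡ relation≈0) ⟩
    y + z * 0#                                  ≈⟨ solve 2 (λ y z → y ⊕ z ⊗ con 0ℤ , y) y z ⟩
    y                                           ∎

  module ℚ-product (u v w u′ v′ w′ : ℚ) where
    product₀ product₁ product₂ : ℚ
    product₀ = Q.product₀ 0ℚ A B u v w u′ v′ w′
    product₁ = Q.product₁ 0ℚ A B u v w u′ v′ w′
    product₂ = Q.product₂ 0ℚ A B u v w u′ v′ w′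

  element-* : ∀ u v w u′ v′ w′ → let open ℚ-product u v w u′ v′ w′ in
    element u v w * element u′ v′ w′ ≈ element product₀ product₁ product₂
  element-* u v w u′ v′ w′ = ≈-trans
    (reduce (ι v * ι w′ + ι w * ι v′ + ι w * ι w′ * θ)
      (solve 9 (λ q r t u v w u′ v′ w′ →
        (u ⊕ v ⊗ t ⊕ w ⊗ (t ⊗ t)) ⊗ (u′ ⊕ v′ ⊗ t ⊕ w′ ⊗ (t ⊗ t)) ,
        E.product₀ (con 0ℤ) q r u v w u′ v′ w′ ⊕ E.product₁ (con 0ℤ) q r u v w u′ v′ w′ ⊗ t
          ⊕ E.product₂ (con 0ℤ) q r u v w u′ v′ w′ ⊗ (t ⊗ t)
          ⊕ (v ⊗ w′ ⊕ w ⊗ v′ ⊕ w ⊗ w′ ⊗ t) ⊗ (t ⊗ t ⊗ t ⊕ ⊝ (q ⊗ t ⊕ r)))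
        (ι A) (ι B) θ (ι u) (ι v) (ι w) (ι u′) (ι v′) (ι w′)))
    (≈-sym (+-cong (+-cong (image E.product₀) (*-congʳ (image E.product₁))) (*-congʳ (image E.product₂))))
    where
    open Evaluation ℚ.+-*-rawRing using () renaming (⟦_⟧ to ⟦_⟧ℚ)
    open Evaluation rawRing using (⟦_⟧)
    ρ : Vec ℚ 8
    ρ = A ∷ B ∷ u ∷ v ∷ w ∷ u′ ∷ v′ ∷ w′ ∷ []
    form : (Expr 8 → Expr 8 → Expr 8 → Expr 8 → Expr 8 → Expr 8 → Expr 8 → Expr 8 → Expr 8 → Expr 8) → Expr 8
    form f = f (con 0ℤ) (var 0F) (var 1F) (var 2F) (var 3F) (var 4F) (var 5F) (var 6F) (var 7F)
    image : ∀ f → ι (⟦ form f ⟧ℚ ρ) ≈ ⟦ form f ⟧ (Vec.map ι ρ)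
    image f = ι-⟦⟧ (form f) ρ

  ι-cancel : ∀ {k} → ι k ≈ 0# → k ≡ 0ℚ
  ι-cancel {k} ιk≈0 with k ℚ.≟ 0ℚ
  ... | yes k≡0 = k≡0
  ... | no  k≢0 = contradiction 0≈1 0≉1
    where
    0≈1 : 0# ≈ 1#
    0≈1 = begin
      0#                    ≈⟨ zeroˡ _ ⟨
      0# * ι k⁻¹            ≈⟨ *-congʳ ιk≈0 ⟨
      ι k * ι k⁻¹           ≈⟨ ι-* k k⁻¹ ⟨
      ι (k ℚ.* k⁻¹)         ≈⟨ reflexive (cong ι (proj₂ (ℚ-inverse k k≢0))) ⟩
      ι 1ℚ                  ≈⟨ ι-1 ⟩
      1#                    ∎
      where k⁻¹ = proj₁ (ℚ-inverse k k≢0)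

  linear-independent : ∀ x y → ι x + ι y * θ ≈ 0# → x ≡ 0ℚ × y ≡ 0ℚ
  linear-independent x y x+yθ≈0 with y ℚ.≟ 0ℚ
  ... | yes refl = ι-cancel (≈-trans (solve 2 (λ x t → x , x ⊕ con 0ℤ ⊗ t) (ι x) θ)
                       (≈-trans (+-congˡ (*-congʳ (≈-sym ι-0))) x+yθ≈0)) , refl
  ... | no  y≢0    = contradiction t³≡At+B (no-root t)
    where
    y⁻¹ t : ℚ
    y⁻¹ = proj₁ (ℚ-inverse y y≢0)
    t = ℚ.- (x ℚ.* y⁻¹)
    ιyιy⁻¹≈1 : ι y * ι y⁻¹ ≈ 1#
    ιyιy⁻¹≈1 = ≈-trans (≈-sym (ι-* y y⁻¹)) (≈-trans (reflexive (cong ι (proj₂ (ℚ-inverse y y≢0)))) ι-1)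
    θ≈ιt : θ ≈ ι t
    θ≈ιt = begin
      θ                                                   ≈⟨ *-identityˡ θ ⟨
      1# * θ                                              ≈⟨ *-congʳ ιyιy⁻¹≈1 ⟨
      ι y * ι y⁻¹ * θ
        ≈⟨ solve 4 (λ x y y⁻¹ t → y ⊗ y⁻¹ ⊗ t , (x ⊕ y ⊗ t) ⊗ y⁻¹ ⊕ ⊝ (x ⊗ y⁻¹)) (ι x) (ι y) (ι y⁻¹) θ ⟩
      (ι x + ι y * θ) * ι y⁻¹ - ι x * ι y⁻¹               ≈⟨ +-congʳ (*-congʳ x+yθ≈0) ⟩
      0# * ι y⁻¹ - ι x * ι y⁻¹                            ≈⟨ solve 2 (λ x y⁻¹ → con 0ℤ ⊗ y⁻¹ ⊕ ⊝ (x ⊗ y⁻¹) , ⊝ (x ⊗ y⁻¹)) (ι x) (ι y⁻¹) ⟩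
      - (ι x * ι y⁻¹)                                     ≈⟨ -‿cong (ι-* x y⁻¹) ⟨
      - ι (x ℚ.* y⁻¹)                                     ≈⟨ ι-neg (x ℚ.* y⁻¹) ⟨
      ι t                                                 ∎
    open Evaluation ℚ.+-*-rawRing using () renaming (⟦_⟧ to ⟦_⟧ℚ)
    f : Expr 3
    f = var 0F ⊗ var 0F ⊗ var 0F ⊕ ⊝ (var 1F ⊗ var 0F ⊕ var 2F)
    t³≡At+B : t ℚ.* t ℚ.* t ≡ A ℚ.* t ℚ.+ B
    t³≡At+B = ℚSolver.x-y≈0⇒x≈y (ι-cancel (begin
      ι (⟦ f ⟧ℚ (t ∷ A ∷ B ∷ []))                        ≈⟨ ι-⟦⟧ f (t ∷ A ∷ B ∷ []) ⟩
      ι t * ι t * ι t - (ι A * ι t + ι B)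
        ≈⟨ +-cong (*-cong (*-cong θ≈ιt θ≈ιt) θ≈ιt) (-‿cong (+-congʳ (*-congˡ θ≈ιt))) ⟨
      θ * θ * θ - (ι A * θ + ι B)                        ≈⟨ relation≈0 ⟩
      0#                                                 ∎))

  cubic-form : ℚ → ℚ → ℚ
  cubic-form v w = v ℚ.* v ℚ.* v ℚ.- A ℚ.* (v ℚ.* (w ℚ.* w)) ℚ.- B ℚ.* (w ℚ.* w ℚ.* w)

  -- The form is w³ times the cubic at v / w, so a zero with w ≠ 0 would be a rational root.
  cubic-form-anisotropic : ∀ v w → cubic-form v w ≡ 0ℚ → v ≡ 0ℚ × w ≡ 0ℚ
  cubic-form-anisotropic v w form≡0 with w ℚ.≟ 0ℚ
  ... | yes refl = v≡0 , refl
    where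
    v≡0 : v ≡ 0ℚ
    v≡0 with v ℚ.≟ 0ℚ
    ... | yes v≡0 = v≡0
    ... | no  v≢0 = contradiction (trans
      (ℚSolver.solve 3 (λ v A B → v ⊗ v ⊗ v , v ⊗ v ⊗ v ⊕ ⊝ (A ⊗ (v ⊗ (con 0ℤ ⊗ con 0ℤ))) ⊕ ⊝ (B ⊗ (con 0ℤ ⊗ con 0ℤ ⊗ con 0ℤ))) v A B) form≡0)
      (ℚ-*-≢0 (ℚ-*-≢0 v≢0 v≢0) v≢0)
  ... | no  w≢0 = contradiction (ℚSolver.x-y≈0⇒x≈y (begin′)) (no-root (v ℚ.* w⁻¹))
    where
    w⁻¹ = proj₁ (ℚ-inverse w w≢0)
    t = v ℚ.* w⁻¹
    begin′ : t ℚ.* t ℚ.* t ℚ.- (A ℚ.* t ℚ.+ B) ≡ 0ℚ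
    begin′ = ℚ-zero-product (w ℚ.* w ℚ.* w) _ (ℚ-*-≢0 (ℚ-*-≢0 w≢0 w≢0) w≢0) (trans
      (ℚSolver.solve 5 (λ v w w⁻¹ A B → let t = v ⊗ w⁻¹; one = w ⊗ w⁻¹ in
        w ⊗ w ⊗ w ⊗ (t ⊗ t ⊗ t ⊕ ⊝ (A ⊗ t ⊕ B)) ,
        v ⊗ v ⊗ v ⊗ (one ⊗ one ⊗ one) ⊕ ⊝ (A ⊗ (v ⊗ (w ⊗ w)) ⊗ one) ⊕ ⊝ (B ⊗ (w ⊗ w ⊗ w))) v w w⁻¹ A B)
      (trans (cong (λ one → v ℚ.* v ℚ.* v ℚ.* (one ℚ.* one ℚ.* one) ℚ.- A ℚ.* (v ℚ.* (w ℚ.* w)) ℚ.* one ℚ.- B ℚ.* (w ℚ.* w ℚ.* w))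
          (proj₂ (ℚ-inverse w w≢0)))
        (trans (ℚSolver.solve 4 (λ v w A B →
            v ⊗ v ⊗ v ⊗ (con 1ℤ ⊗ con 1ℤ ⊗ con 1ℤ) ⊕ ⊝ (A ⊗ (v ⊗ (w ⊗ w)) ⊗ con 1ℤ) ⊕ ⊝ (B ⊗ (w ⊗ w ⊗ w)) ,
            v ⊗ v ⊗ v ⊕ ⊝ (A ⊗ (v ⊗ (w ⊗ w))) ⊕ ⊝ (B ⊗ (w ⊗ w ⊗ w))) v w A B)
          form≡0)))

  -- Eliminate θ² between x and x θ.
  element-independent : ∀ u v w → element u v w ≈ 0# → u ≡ 0ℚ × v ≡ 0ℚ × w ≡ 0ℚ
  element-independent u v w x≈0 = conclude
      (linear-independent x y (≈-trans (+-cong (ι-⟦⟧ xᵉ ρ) (*-congʳ (ι-⟦⟧ yᵉ ρ))) eliminated))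
    where
    xᵉ yᵉ : Expr 5
    xᵉ = var 1F ⊗ (var 4F ⊗ var 4F) ⊕ ⊝ (var 2F ⊗ var 3F)
    yᵉ = var 2F ⊗ var 4F ⊕ var 0F ⊗ (var 4F ⊗ var 4F) ⊕ ⊝ (var 3F ⊗ var 3F)
    ρ : Vec ℚ 5
    ρ = A ∷ B ∷ u ∷ v ∷ w ∷ []
    x y : ℚ
    x = B ℚ.* (w ℚ.* w) ℚ.- u ℚ.* v
    y = u ℚ.* w ℚ.+ A ℚ.* (w ℚ.* w) ℚ.- v ℚ.* v

    eliminated : ι B * (ι w * ι w) - ι u * ι v + (ι u * ι w + ι A * (ι w * ι w) - ι v * ι v) * θ ≈ 0#
    eliminated = ≈-trans (reduce (- (ι w * ι w)) (solve 6 (λ q r t u v w →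
        let e = u ⊕ v ⊗ t ⊕ w ⊗ (t ⊗ t) in
        r ⊗ (w ⊗ w) ⊕ ⊝ (u ⊗ v) ⊕ (u ⊗ w ⊕ q ⊗ (w ⊗ w) ⊕ ⊝ (v ⊗ v)) ⊗ t ,
        (w ⊗ t ⊕ ⊝ v) ⊗ e ⊕ ⊝ (w ⊗ w) ⊗ (t ⊗ t ⊗ t ⊕ ⊝ (q ⊗ t ⊕ r))) (ι A) (ι B) θ (ι u) (ι v) (ι w)))
      (≈-trans (*-congˡ x≈0) (zeroʳ _))

    conclude : x ≡ 0ℚ × y ≡ 0ℚ → u ≡ 0ℚ × v ≡ 0ℚ × w ≡ 0ℚ
    conclude (x≡0 , y≡0) = u≡0 , v≡0 , w≡0
      where
      -- The combination -(v y + w x) is free of u and equals the cubic form.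
      v≡0×w≡0 : v ≡ 0ℚ × w ≡ 0ℚ
      v≡0×w≡0 = cubic-form-anisotropic v w (trans
        (ℚSolver.solve 5 (λ q r u v w →
          v ⊗ v ⊗ v ⊕ ⊝ (q ⊗ (v ⊗ (w ⊗ w))) ⊕ ⊝ (r ⊗ (w ⊗ w ⊗ w)) ,
          ⊝ (v ⊗ (u ⊗ w ⊕ q ⊗ (w ⊗ w) ⊕ ⊝ (v ⊗ v))) ⊕ ⊝ (w ⊗ (r ⊗ (w ⊗ w) ⊕ ⊝ (u ⊗ v)))) A B u v w)
        (trans (cong₂ (λ x y → ℚ.- (v ℚ.* y) ℚ.- w ℚ.* x) x≡0 y≡0)
          (ℚSolver.solve 2 (λ v w → ⊝ (v ⊗ con 0ℤ) ⊕ ⊝ (w ⊗ con 0ℤ) , con 0ℤ) v w)))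
      v≡0 = proj₁ v≡0×w≡0
      w≡0 = proj₂ v≡0×w≡0
      u≡0 : u ≡ 0ℚ
      u≡0 = ι-cancel (begin
        ι u                                       ≈⟨ solve 2 (λ u t → u , u ⊕ con 0ℤ ⊗ t ⊕ con 0ℤ ⊗ (t ⊗ t)) (ι u) θ ⟩
        ι u + 0# * θ + 0# * (θ * θ)               ≈⟨ +-cong (+-congˡ (*-congʳ ι-0)) (*-congʳ ι-0) ⟨
        ι u + ι 0ℚ * θ + ι 0ℚ * (θ * θ)           ≈⟨ element-cong refl v≡0 w≡0 ⟨
        element u v w                             ≈⟨ x≈0 ⟩
        0#                                        ∎)

  traceᶿ minorsᶿ normᶿ indexᶿ : ℚ → ℚ → ℚ → ℚ
  traceᶿ = Q.trace 0ℚ A B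
  minorsᶿ = Q.minors 0ℚ A B
  normᶿ = Q.norm 0ℚ A B
  indexᶿ = Q.index 0ℚ A B

  I≡cubic-form : ∀ u v w → indexᶿ u v w ≡ cubic-form v w
  I≡cubic-form u v w = ℚSolver.solve 5 (λ q r u v w → E.index (con 0ℤ) q r u v w ,
    v ⊗ v ⊗ v ⊕ ⊝ (q ⊗ (v ⊗ (w ⊗ w))) ⊕ ⊝ (r ⊗ (w ⊗ w ⊗ w))) A B u v w

  element-ι : ∀ x → element x 0ℚ 0ℚ ≈ ι x
  element-ι x = begin
    ι x + ι 0ℚ * θ + ι 0ℚ * (θ * θ)  ≈⟨ +-cong (+-congˡ (*-congʳ ι-0)) (*-congʳ ι-0) ⟩
    ι x + 0# * θ + 0# * (θ * θ)      ≈⟨ solve 2 (λ x t → x ⊕ con 0ℤ ⊗ t ⊕ con 0ℤ ⊗ (t ⊗ t) , x) (ι x) θ ⟩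
    ι x                              ∎

  element-+ : ∀ u v w u′ v′ w′ → element u v w + element u′ v′ w′ ≈ element (u ℚ.+ u′) (v ℚ.+ v′) (w ℚ.+ w′)
  element-+ u v w u′ v′ w′ = ≈-trans
    (solve 7 (λ t u v w u′ v′ w′ → (u ⊕ v ⊗ t ⊕ w ⊗ (t ⊗ t)) ⊕ (u′ ⊕ v′ ⊗ t ⊕ w′ ⊗ (t ⊗ t)) ,
      (u ⊕ u′) ⊕ (v ⊕ v′) ⊗ t ⊕ (w ⊕ w′) ⊗ (t ⊗ t)) θ (ι u) (ι v) (ι w) (ι u′) (ι v′) (ι w′))
    (≈-sym (+-cong (+-cong (ι-+ u u′) (*-congʳ (ι-+ v v′))) (*-congʳ (ι-+ w w′))))

  element-scale : ∀ k u v w → ι k * element u v w ≈ element (k ℚ.* u) (k ℚ.* v) (k ℚ.* w)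
  element-scale k u v w = ≈-trans
    (solve 5 (λ t k u v w → k ⊗ (u ⊕ v ⊗ t ⊕ w ⊗ (t ⊗ t)) , k ⊗ u ⊕ k ⊗ v ⊗ t ⊕ k ⊗ w ⊗ (t ⊗ t)) θ (ι k) (ι u) (ι v) (ι w))
    (≈-sym (+-cong (+-cong (ι-* k u) (*-congʳ (ι-* k v))) (*-congʳ (ι-* k w))))

  element-neg : ∀ u v w → - element u v w ≈ element (ℚ.- u) (ℚ.- v) (ℚ.- w)
  element-neg u v w = ≈-trans
    (solve 4 (λ t u v w → ⊝ (u ⊕ v ⊗ t ⊕ w ⊗ (t ⊗ t)) , ⊝ u ⊕ ⊝ v ⊗ t ⊕ ⊝ w ⊗ (t ⊗ t)) θ (ι u) (ι v) (ι w))
    (≈-sym (+-cong (+-cong (ι-neg u) (*-congʳ (ι-neg v))) (*-congʳ (ι-neg w))))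

  element-θ : element 0ℚ 1ℚ 0ℚ ≈ θ
  element-θ = begin
    ι 0ℚ + ι 1ℚ * θ + ι 0ℚ * (θ * θ)  ≈⟨ +-cong (+-cong ι-0 (*-congʳ ι-1)) (*-congʳ ι-0) ⟩
    0# + 1# * θ + 0# * (θ * θ)        ≈⟨ solve 1 (λ t → con 0ℤ ⊕ con 1ℤ ⊗ t ⊕ con 0ℤ ⊗ (t ⊗ t) , t) θ ⟩
    θ                                 ∎

  element-θ² : element 0ℚ 0ℚ 1ℚ ≈ θ * θ
  element-θ² = begin
    ι 0ℚ + ι 0ℚ * θ + ι 1ℚ * (θ * θ)  ≈⟨ +-cong (+-cong ι-0 (*-congʳ ι-0)) (*-congʳ ι-1) ⟩
    0# + 0# * θ + 1# * (θ * θ)        ≈⟨ solve 1 (λ t → con 0ℤ ⊕ con 0ℤ ⊗ t ⊕ con 1ℤ ⊗ (t ⊗ t) , t ⊗ t) θ ⟩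
    θ * θ                             ∎

  record InSpan (z : Carrier) : Set ℓ where
    constructor inSpan
    field
      {x₀ x₁ x₂} : ℚ
      z≈ : z ≈ element x₀ x₁ x₂

  span-ι : ∀ x → InSpan (ι x)
  span-ι x = inSpan (≈-sym (element-ι x))

  span-+ : ∀ {y z} → InSpan y → InSpan z → InSpan (y + z)
  span-+ (inSpan y≈) (inSpan z≈) = inSpan (≈-trans (+-cong y≈ z≈) (element-+ _ _ _ _ _ _))

  span-* : ∀ {y z} → InSpan y → InSpan z → InSpan (y * z)
  span-* (inSpan y≈) (inSpan z≈) = inSpan (≈-trans (*-cong y≈ z≈) (element-* _ _ _ _ _ _))

  span-evalℚ : ∀ p → InSpan (evalℚ K p θ)
  span-evalℚ []      = inSpan (≈-trans (≈-sym ι-0) (≈-sym (element-ι 0ℚ)))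
  span-evalℚ (x ∷ p) = span-+ (span-ι x) (span-* (inSpan (≈-sym element-θ)) (span-evalℚ p))

  module Adjugate (u v w : ℚ) where

    adj₀ adj₁ adj₂ : ℚ
    adj₀ = Q.adjugate₀ 0ℚ A B u v w
    adj₁ = Q.adjugate₁ 0ℚ A B u v w
    adj₂ = Q.adjugate₂ 0ℚ A B u v w

    element*adjugate : element u v w * element adj₀ adj₁ adj₂ ≈ ι (normᶿ u v w)
    element*adjugate = ≈-trans (element-* u v w adj₀ adj₁ adj₂) (≈-trans (element-cong
      (ℚSolver.solve 5 (λ q r u v w → E.product₀ (con 0ℤ) q r u v w (E.adjugate₀ (con 0ℤ) q r u v w)
        (E.adjugate₁ (con 0ℤ) q r u v w) (E.adjugate₂ (con 0ℤ) q r u v w) , E.norm (con 0ℤ) q r u v w) A B u v w)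
      (ℚSolver.solve 5 (λ q r u v w → E.product₁ (con 0ℤ) q r u v w (E.adjugate₀ (con 0ℤ) q r u v w)
        (E.adjugate₁ (con 0ℤ) q r u v w) (E.adjugate₂ (con 0ℤ) q r u v w) , con 0ℤ) A B u v w)
      (ℚSolver.solve 5 (λ q r u v w → E.product₂ (con 0ℤ) q r u v w (E.adjugate₀ (con 0ℤ) q r u v w)
        (E.adjugate₁ (con 0ℤ) q r u v w) (E.adjugate₂ (con 0ℤ) q r u v w) , con 0ℤ) A B u v w))
      (element-ι (normᶿ u v w)))

    -- If the norm vanished, dividing by the element would make its adjugate zero. But v `adj₂` - w
    -- `adj₁` is the cubic form, so v = w = 0, and then the norm is u³.
    norm≢0 : ¬ (element u v w ≈ 0#) → normᶿ u v w ≢ 0ℚ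
    norm≢0 x≉0 N≡0 = x≉0 (≈-trans (element-cong u≡0 v≡0 w≡0) (≈-trans (element-ι 0ℚ) ι-0))
      where
      x⁻¹ : Carrier
      x⁻¹ = proj₁ (inverse (element u v w) x≉0)
      adj≈0 : element adj₀ adj₁ adj₂ ≈ 0#
      adj≈0 = begin
        element adj₀ adj₁ adj₂                               ≈⟨ *-identityˡ _ ⟨
        1# * element adj₀ adj₁ adj₂                          ≈⟨ *-congʳ (proj₂ (inverse (element u v w) x≉0)) ⟨
        element u v w * x⁻¹ * element adj₀ adj₁ adj₂
          ≈⟨ solve 3 (λ x y z → x ⊗ y ⊗ z , y ⊗ (x ⊗ z)) (element u v w) x⁻¹ (element adj₀ adj₁ adj₂) ⟩
        x⁻¹ * (element u v w * element adj₀ adj₁ adj₂)       ≈⟨ *-congˡ (≈-trans element*adjugate (≈-trans (reflexive (cong ι N≡0)) ι-0)) ⟩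
        x⁻¹ * 0#                                             ≈⟨ zeroʳ x⁻¹ ⟩
        0#                                                   ∎
      adj≡0 = element-independent adj₀ adj₁ adj₂ adj≈0
      v≡0×w≡0 : v ≡ 0ℚ × w ≡ 0ℚ
      v≡0×w≡0 = cubic-form-anisotropic v w (trans
        (ℚSolver.solve 5 (λ q r u v w → v ⊗ v ⊗ v ⊕ ⊝ (q ⊗ (v ⊗ (w ⊗ w))) ⊕ ⊝ (r ⊗ (w ⊗ w ⊗ w)) ,
          v ⊗ E.adjugate₂ (con 0ℤ) q r u v w ⊕ ⊝ (w ⊗ E.adjugate₁ (con 0ℤ) q r u v w)) A B u v w)
        (trans (cong₂ (λ x y → v ℚ.* y ℚ.- w ℚ.* x) (proj₁ (proj₂ adj≡0)) (proj₂ (proj₂ adj≡0)))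
          (ℚSolver.solve 2 (λ v w → v ⊗ con 0ℤ ⊕ ⊝ (w ⊗ con 0ℤ) , con 0ℤ) v w)))
      v≡0 = proj₁ v≡0×w≡0
      w≡0 = proj₂ v≡0×w≡0
      u≡0 : u ≡ 0ℚ
      u≡0 with u ℚ.≟ 0ℚ
      ... | yes u≡0 = u≡0
      ... | no  u≢0 = contradiction (trans
        (ℚSolver.solve 3 (λ q r u → u ⊗ u ⊗ u , E.norm (con 0ℤ) q r u (con 0ℤ) (con 0ℤ)) A B u)
        (trans (sym (cong₂ (normᶿ u) v≡0 w≡0)) N≡0)) (ℚ-*-≢0 (ℚ-*-≢0 u≢0 u≢0) u≢0)

  -- Primitivity provides quotients p(θ) / q(θ); the denominator is inverted as its adjugate divided
  -- by its norm, which stays in the span of 1, θ, θ².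
  spanning-set : ∀ z → InSpan z
  spanning-set z = go (θ-primitive z)
    where
    go : ∃[ p ] ∃[ q ] (¬ (evalℚ K q θ ≈ 0#) × z * evalℚ K q θ ≈ evalℚ K p θ) → InSpan z
    go (p , q , q≉0 , zq≈p) = from-span (span-evalℚ q)
      where
      from-span : InSpan (evalℚ K q θ) → InSpan z
      from-span (inSpan {u} {v} {w} q≈) = inSpan (begin
          z                                                     ≈⟨ *-identityʳ z ⟨
          z * 1#                                                ≈⟨ *-congˡ ι-1 ⟨
          z * ι 1ℚ                                              ≈⟨ *-congˡ (reflexive (cong ι (proj₂ (ℚ-inverse (normᶿ u v w) N≢0)))) ⟨
          z * ι (normᶿ u v w ℚ.* N⁻¹)                               ≈⟨ *-congˡ (ι-* (normᶿ u v w) N⁻¹) ⟩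
          z * (ι (normᶿ u v w) * ι N⁻¹)                             ≈⟨ *-congˡ (*-congʳ element*adjugate) ⟨
          z * (element u v w * element adj₀ adj₁ adj₂ * ι N⁻¹)  ≈⟨ *-congˡ (*-congʳ (*-congʳ q≈)) ⟨
          z * (evalℚ K q θ * element adj₀ adj₁ adj₂ * ι N⁻¹)
            ≈⟨ solve 4 (λ z q a n → z ⊗ (q ⊗ a ⊗ n) , z ⊗ q ⊗ (a ⊗ n)) z (evalℚ K q θ) (element adj₀ adj₁ adj₂) (ι N⁻¹) ⟩
          z * evalℚ K q θ * (element adj₀ adj₁ adj₂ * ι N⁻¹)    ≈⟨ *-congʳ zq≈p ⟩
          evalℚ K p θ * (element adj₀ adj₁ adj₂ * ι N⁻¹)        ≈⟨ InSpan.z≈ expressed ⟩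
          element _ _ _                                         ∎)
        where
        open Adjugate u v w
        N≢0 : normᶿ u v w ≢ 0ℚ
        N≢0 = norm≢0 λ x≈0 → q≉0 (≈-trans q≈ x≈0)
        N⁻¹ : ℚ
        N⁻¹ = proj₁ (ℚ-inverse (normᶿ u v w) N≢0)
        expressed : InSpan (evalℚ K p θ * (element adj₀ adj₁ adj₂ * ι N⁻¹))
        expressed = span-* (span-evalℚ p) (span-* (inSpan ≈-refl) (span-ι N⁻¹))

  private
    horner : ∀ {n} (c₀ c₁ c₂ c₃ z : Expr n) → Expr n
    horner c₀ c₁ c₂ c₃ z = c₀ ⊕ z ⊗ (c₁ ⊕ z ⊗ (c₂ ⊕ z ⊗ (c₃ ⊕ z ⊗ con 0ℤ)))

  -- The adjugate of z is z² - t z + s for trace t and minors s, so the value at z is z times the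
  -- adjugate minus the norm. This gives the integrality of the witnesses.
  cayley-hamilton : ∀ {z u v w} → z ≈ element u v w →
    evalℚ K (ℚ.- normᶿ u v w ∷ minorsᶿ u v w ∷ ℚ.- traceᶿ u v w ∷ 1ℚ ∷ []) z ≈ 0#
  cayley-hamilton {z} {u} {v} {w} z≈ = begin
    ι (ℚ.- normᶿ u v w) + z * (ι (minorsᶿ u v w) + z * (ι (ℚ.- traceᶿ u v w) + z * (ι 1ℚ + z * 0#)))
      ≈⟨ +-cong (ι-neg _) (*-congˡ (+-congˡ (*-congˡ (+-cong (ι-neg _) (*-congˡ (+-congʳ ι-1)))))) ⟩
    - ι (normᶿ u v w) + z * (ι (minorsᶿ u v w) + z * (- ι (traceᶿ u v w) + z * (1# + z * 0#)))
      ≈⟨ solve 4 (λ n s t z → horner (⊝ n) s (⊝ t) (con 1ℤ) z , z ⊗ (z ⊗ z ⊕ ⊝ (t ⊗ z) ⊕ s) ⊕ ⊝ n)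
           (ι (normᶿ u v w)) (ι (minorsᶿ u v w)) (ι (traceᶿ u v w)) z ⟩
    z * (z * z - ι (traceᶿ u v w) * z + ι (minorsᶿ u v w)) - ι (normᶿ u v w)
      ≈⟨ +-congʳ (*-cong z≈ adjugate≈) ⟩
    element u v w * element adj₀ adj₁ adj₂ - ι (normᶿ u v w)
      ≈⟨ +-congʳ element*adjugate ⟩
    ι (normᶿ u v w) - ι (normᶿ u v w)
      ≈⟨ -‿inverseʳ _ ⟩
    0# ∎
    where
    open Adjugate u v w
    open ℚ-product u v w u v w
    adjugate≈ : z * z - ι (traceᶿ u v w) * z + ι (minorsᶿ u v w) ≈ element adj₀ adj₁ adj₂
    adjugate≈ = begin
      z * z - ι (traceᶿ u v w) * z + ι (minorsᶿ u v w)
        ≈⟨ +-congʳ (+-cong (*-cong z≈ z≈) (-‿cong (*-congˡ z≈))) ⟩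
      element u v w * element u v w - ι (traceᶿ u v w) * element u v w + ι (minorsᶿ u v w)
        ≈⟨ +-cong (+-cong (element-* u v w u v w) (≈-trans (-‿cong (element-scale (traceᶿ u v w) u v w)) (element-neg _ _ _))) (≈-sym (element-ι _)) ⟩
      element product₀ product₁ product₂ + element (ℚ.- (traceᶿ u v w ℚ.* u)) (ℚ.- (traceᶿ u v w ℚ.* v)) (ℚ.- (traceᶿ u v w ℚ.* w))
        + element (minorsᶿ u v w) 0ℚ 0ℚ
        ≈⟨ ≈-trans (+-congʳ (element-+ _ _ _ _ _ _)) (element-+ _ _ _ _ _ _) ⟩
      element (product₀ ℚ.- traceᶿ u v w ℚ.* u ℚ.+ minorsᶿ u v w) (product₁ ℚ.- traceᶿ u v w ℚ.* v ℚ.+ 0ℚ) (product₂ ℚ.- traceᶿ u v w ℚ.* w ℚ.+ 0ℚ)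
        ≈⟨ element-cong
             (ℚSolver.solve 5 (λ q r u v w → E.product₀ (con 0ℤ) q r u v w u v w ⊕ ⊝ (E.trace (con 0ℤ) q r u v w ⊗ u)
               ⊕ E.minors (con 0ℤ) q r u v w , E.adjugate₀ (con 0ℤ) q r u v w) A B u v w)
             (ℚSolver.solve 5 (λ q r u v w → E.product₁ (con 0ℤ) q r u v w u v w ⊕ ⊝ (E.trace (con 0ℤ) q r u v w ⊗ v)
               ⊕ con 0ℤ , E.adjugate₁ (con 0ℤ) q r u v w) A B u v w)
             (ℚSolver.solve 5 (λ q r u v w → E.product₂ (con 0ℤ) q r u v w u v w ⊕ ⊝ (E.trace (con 0ℤ) q r u v w ⊗ w)
               ⊕ con 0ℤ , E.adjugate₂ (con 0ℤ) q r u v w) A B u v w) ⟩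
      element adj₀ adj₁ adj₂ ∎

  open module Span z = InSpan (spanning-set z) using (x₀; x₁; x₂; z≈)

  θ-basis : Basis 3
  θ-basis = record
    { vector = λ { 0F → 1# ; 1F → θ ; 2F → θ * θ }
    ; coords = λ { z 0F → x₀ z ; z 1F → x₁ z ; z 2F → x₂ z }
    ; spans  = λ z → ≈-trans (z≈ z) (≈-sym (flatten (x₀ z) (x₁ z) (x₂ z)))
    ; independent₀ = λ r r≈0 → let (p , q , s) = element-independent (r 0F) (r 1F) (r 2F)
                                     (≈-trans (≈-sym (flatten (r 0F) (r 1F) (r 2F))) r≈0)
                     in λ { 0F → p ; 1F → q ; 2F → s }
    }
    where
    flatten : ∀ u v w → ι u * 1# + (ι v * θ + (ι w * (θ * θ) + 0#)) ≈ element u v w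
    flatten u v w = solve 4 (λ t u v w → u ⊗ con 1ℤ ⊕ (v ⊗ t ⊕ (w ⊗ (t ⊗ t) ⊕ con 0ℤ)) , u ⊕ v ⊗ t ⊕ w ⊗ (t ⊗ t)) θ (ι u) (ι v) (ι w)

  coords≡ : ∀ {z u v w} → z ≈ element u v w → x₀ z ≡ u × x₁ z ≡ v × x₂ z ≡ w
  coords≡ {z} {u} {v} {w} z≈ = unique 0F , unique 1F , unique 2F
    where
    r : Vector ℚ 3
    r = λ { 0F → u ; 1F → v ; 2F → w }
    unique = coords-unique θ-basis r (≈-trans z≈
      (solve 4 (λ t u v w → u ⊕ v ⊗ t ⊕ w ⊗ (t ⊗ t) , u ⊗ con 1ℤ ⊕ (v ⊗ t ⊕ (w ⊗ (t ⊗ t) ⊕ con 0ℤ))) θ (ι u) (ι v) (ι w)))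

  θ-basisTrace : ∀ {z u v w} → z ≈ element u v w → basisTrace θ-basis z ≡ traceᶿ u v w
  θ-basisTrace {z} {u} {v} {w} z≈ = trans
    (cong₂ ℚ._+_ (proj₁ (coords≡ (≈-trans (*-identityʳ z) z≈)))
      (cong₂ (λ x y → x ℚ.+ (y ℚ.+ 0ℚ))
        (proj₁ (proj₂ (coords≡ (≈-trans (*-cong z≈ (≈-sym element-θ)) (element-* u v w 0ℚ 1ℚ 0ℚ)))))
        (proj₂ (proj₂ (coords≡ (≈-trans (*-cong z≈ (≈-sym element-θ²)) (element-* u v w 0ℚ 0ℚ 1ℚ)))))))
    (ℚSolver.solve 5 (λ q r u v w → u ⊕ (E.product₁ (con 0ℤ) q r u v w (con 0ℤ) (con 1ℤ) (con 0ℤ)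
      ⊕ (E.product₂ (con 0ℤ) q r u v w (con 0ℤ) (con 0ℤ) (con 1ℤ) ⊕ con 0ℤ)) , E.trace (con 0ℤ) q r u v w) A B u v w)

  trace≡ : ∀ {z u v w} → z ≈ element u v w → basisTrace givenBasis z ≡ traceᶿ u v w
  trace≡ {z} z≈ = trans (basisTrace-invariant givenBasis θ-basis z) (θ-basisTrace z≈)

  -- The matrix of z in the given basis enters only through traces, which can be computed in 1, θ,
  -- θ² instead. There tr z² = t² - 2 s and tr z³ = t³ - 3 t s + 3 n are polynomial identities in A,
  -- B, u, v, w.
  charPoly≈ : ∀ {z u v w} → z ≈ element u v w →
    (ℚ.- normᶿ u v w ∷ minorsᶿ u v w ∷ ℚ.- traceᶿ u v w ∷ 1ℚ ∷ []) ℚ[X].≈ₚ charPoly K z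
  charPoly≈ {z} {u} {v} {w} z≈ = charPoly-from-power-sums degree (mulMatrix K z) (traceᶿ u v w) (minorsᶿ u v w) (normᶿ u v w)
    (basis-size-unique givenBasis θ-basis)
    (trace≡ z≈)
    (trans (matrix-powerSum₂ givenBasis z) (trans (trace≡ z²≈)
      (ℚSolver.solve 5 (λ q r u v w → E.trace (con 0ℤ) q r (p₀ q r u v w) (p₁ q r u v w) (p₂ q r u v w) ,
        E.trace (con 0ℤ) q r u v w ⊗ E.trace (con 0ℤ) q r u v w ⊕ ⊝ (con (+ 2) ⊗ E.minors (con 0ℤ) q r u v w)) A B u v w)))
    (trans (matrix-powerSum₃ givenBasis z) (trans (trace≡ (≈-trans (*-cong z≈ z²≈) (element-* u v w product₀ product₁ product₂)))
      (ℚSolver.solve 5 (λ q r u v w → let t = E.trace (con 0ℤ) q r u v w ; x = p₀ q r u v w ; y = p₁ q r u v w ; z = p₂ q r u v w in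
        E.trace (con 0ℤ) q r (E.product₀ (con 0ℤ) q r u v w x y z) (E.product₁ (con 0ℤ) q r u v w x y z) (E.product₂ (con 0ℤ) q r u v w x y z) ,
        t ⊗ t ⊗ t ⊕ ⊝ (con (+ 3) ⊗ (t ⊗ E.minors (con 0ℤ) q r u v w)) ⊕ con (+ 3) ⊗ E.norm (con 0ℤ) q r u v w) A B u v w)))
    where
    open ℚ-product u v w u v w
    p₀ p₁ p₂ : ∀ {n} (q r u v w : Expr n) → Expr n
    p₀ q r u v w = E.product₀ (con 0ℤ) q r u v w u v w
    p₁ q r u v w = E.product₁ (con 0ℤ) q r u v w u v w
    p₂ q r u v w = E.product₂ (con 0ℤ) q r u v w u v w
    z²≈ : z * z ≈ element product₀ product₁ product₂
    z²≈ = ≈-trans (*-cong z≈ z≈) (element-* u v w u v w)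

  -- The index is the determinant of 1, z, z² in 1, θ, θ². When it is nonzero, Cramer's rule writes
  -- y as a quadratic polynomial in z, over the denominator 1.
  element-primitive : ∀ {z u v w} → z ≈ element u v w → indexᶿ u v w ≢ 0ℚ → IsPrimitive K z
  element-primitive {z} {u} {v} {w} z≈ I≢0 y = go (spanning-set y)
    where
    open ℚ-product u v w u v w
    J : ℚ
    J = proj₁ (ℚ-inverse (indexᶿ u v w) I≢0)
    I≡ : indexᶿ u v w ≡ v ℚ.* product₂ ℚ.- w ℚ.* product₁
    I≡ = ℚSolver.solve 5 (λ q r u v w → E.index (con 0ℤ) q r u v w ,
      v ⊗ E.product₂ (con 0ℤ) q r u v w u v w ⊕ ⊝ (w ⊗ E.product₁ (con 0ℤ) q r u v w u v w)) A B u v w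
    IJ≡1 : (v ℚ.* product₂ ℚ.- w ℚ.* product₁) ℚ.* J ≡ 1ℚ
    IJ≡1 = trans (cong (ℚ._* J) (sym I≡)) (proj₂ (ℚ-inverse (indexᶿ u v w) I≢0))
    1≉0 : ¬ (evalℚ K (1ℚ ∷ []) z ≈ 0#)
    1≉0 1≈0 = 0≉1 (≈-sym (begin
      1#               ≈⟨ solve 1 (λ z → con 1ℤ , con 1ℤ ⊕ z ⊗ con 0ℤ) z ⟩
      1# + z * 0#      ≈⟨ +-congʳ ι-1 ⟨
      ι 1ℚ + z * 0#    ≈⟨ 1≈0 ⟩
      0#               ∎))
    go : InSpan y → ∃[ p ] ∃[ q ] (¬ (evalℚ K q z ≈ 0#) × y * evalℚ K q z ≈ evalℚ K p z)
    go (inSpan {s₀} {s₁} {s₂} y≈) = t₀ ∷ t₁ ∷ t₂ ∷ [] , 1ℚ ∷ [] , 1≉0 , (begin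
      y * (ι 1ℚ + z * 0#)                                  ≈⟨ *-congˡ (+-congʳ ι-1) ⟩
      y * (1# + z * 0#)                                    ≈⟨ solve 2 (λ y z → y ⊗ (con 1ℤ ⊕ z ⊗ con 0ℤ) , y) y z ⟩
      y                                                    ≈⟨ y≈ ⟩
      element s₀ s₁ s₂                                     ≈⟨ element-cong coordinate₀ coordinate₁ coordinate₂ ⟨
      element (t₀ ℚ.+ t₁ ℚ.* u ℚ.+ t₂ ℚ.* product₀) (0ℚ ℚ.+ t₁ ℚ.* v ℚ.+ t₂ ℚ.* product₁) (0ℚ ℚ.+ t₁ ℚ.* w ℚ.+ t₂ ℚ.* product₂)
        ≈⟨ ≈-trans (+-congʳ (element-+ _ _ _ _ _ _)) (element-+ _ _ _ _ _ _) ⟨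
      element t₀ 0ℚ 0ℚ + element (t₁ ℚ.* u) (t₁ ℚ.* v) (t₁ ℚ.* w) + element (t₂ ℚ.* product₀) (t₂ ℚ.* product₁) (t₂ ℚ.* product₂)
        ≈⟨ +-cong (+-cong (≈-sym (element-ι t₀)) (element-scale t₁ u v w)) (element-scale t₂ product₀ product₁ product₂) ⟨
      ι t₀ + ι t₁ * element u v w + ι t₂ * element product₀ product₁ product₂
        ≈⟨ +-cong (+-congˡ (*-congˡ z≈)) (*-congˡ (≈-trans (*-cong z≈ z≈) (element-* u v w u v w))) ⟨
      ι t₀ + ι t₁ * z + ι t₂ * (z * z)
        ≈⟨ solve 4 (λ z t₀ t₁ t₂ → t₀ ⊕ t₁ ⊗ z ⊕ t₂ ⊗ (z ⊗ z) , t₀ ⊕ z ⊗ (t₁ ⊕ z ⊗ (t₂ ⊕ z ⊗ con 0ℤ))) z (ι t₀) (ι t₁) (ι t₂) ⟩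
      ι t₀ + z * (ι t₁ + z * (ι t₂ + z * 0#))              ∎)
      where
      t₀ t₁ t₂ : ℚ
      t₁ = (s₁ ℚ.* product₂ ℚ.- s₂ ℚ.* product₁) ℚ.* J
      t₂ = (v ℚ.* s₂ ℚ.- w ℚ.* s₁) ℚ.* J
      t₀ = s₀ ℚ.- t₁ ℚ.* u ℚ.- t₂ ℚ.* product₀
      coordinate₀ : t₀ ℚ.+ t₁ ℚ.* u ℚ.+ t₂ ℚ.* product₀ ≡ s₀
      coordinate₀ = ℚSolver.solve 3 (λ s x y → s ⊕ ⊝ x ⊕ ⊝ y ⊕ x ⊕ y , s) s₀ (t₁ ℚ.* u) (t₂ ℚ.* product₀)
      coordinate₁ : 0ℚ ℚ.+ t₁ ℚ.* v ℚ.+ t₂ ℚ.* product₁ ≡ s₁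
      coordinate₁ = trans (ℚSolver.solve 7 (λ s₁ s₂ v w p₁ p₂ J →
          con 0ℤ ⊕ (s₁ ⊗ p₂ ⊕ ⊝ (s₂ ⊗ p₁)) ⊗ J ⊗ v ⊕ (v ⊗ s₂ ⊕ ⊝ (w ⊗ s₁)) ⊗ J ⊗ p₁ , s₁ ⊗ ((v ⊗ p₂ ⊕ ⊝ (w ⊗ p₁)) ⊗ J))
          s₁ s₂ v w product₁ product₂ J)
        (trans (cong (s₁ ℚ.*_) IJ≡1) (ℚ.*-identityʳ s₁))
      coordinate₂ : 0ℚ ℚ.+ t₁ ℚ.* w ℚ.+ t₂ ℚ.* product₂ ≡ s₂
      coordinate₂ = trans (ℚSolver.solve 7 (λ s₁ s₂ v w p₁ p₂ J →
          con 0ℤ ⊕ (s₁ ⊗ p₂ ⊕ ⊝ (s₂ ⊗ p₁)) ⊗ J ⊗ w ⊕ (v ⊗ s₂ ⊕ ⊝ (w ⊗ s₁)) ⊗ J ⊗ p₂ , s₂ ⊗ ((v ⊗ p₂ ⊕ ⊝ (w ⊗ p₁)) ⊗ J))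
          s₁ s₂ v w product₁ product₂ J)
        (trans (cong (s₂ ℚ.*_) IJ≡1) (ℚ.*-identityʳ s₂))

-- From rational coordinates to integral representations and back.

module Scaling (a b : ℤ) where

  A B : ℚ
  A = ℤ→ℚ a
  B = ℤ→ℚ (ℤ.- b)

  open HomomorphicEvaluation ℤ.+-*-rawRing ℚ.+-*-commutativeRing ℤ→ℚ-isRingHomomorphism using (⟦⟧-homo)

  image : ∀ (f : Expr 5 → Expr 5 → Expr 5 → Expr 5 → Expr 5 → Expr 5 → Expr 5) u v w →
    let e = f (con 0ℤ) (var 0F) (var 1F) (var 2F) (var 3F) (var 4F); ρ = a ∷ ℤ.- b ∷ u ∷ v ∷ w ∷ [] in
    ℤ→ℚ (ℤSolver.⟦ e ⟧ ρ) ≡ ℚSolver.⟦ e ⟧ (Vec.map ℤ→ℚ ρ)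
  image f u v w = ⟦⟧-homo (f (con 0ℤ) (var 0F) (var 1F) (var 2F) (var 3F) (var 4F)) (a ∷ ℤ.- b ∷ u ∷ v ∷ w ∷ [])

  record Scaled (u v w m : ℤ) (x y z : ℚ) : Set where
    constructor scaled
    field
      u≡ : ℤ→ℚ m ℚ.* x ≡ ℤ→ℚ u
      v≡ : ℤ→ℚ m ℚ.* y ≡ ℤ→ℚ v
      w≡ : ℤ→ℚ m ℚ.* z ≡ ℤ→ℚ w

  module _ {u v w m x y z} (m≢0 : m ≢ 0ℤ) (s : Scaled u v w m x y z) where

    open Scaled s
    open ≡-Reasoning

    private
      M : ℚ
      M = ℤ→ℚ m

      M≢0 : M ≢ 0ℚ
      M≢0 = ℤ→ℚ-≢0 m≢0

      cong₃ : ∀ (f : ℚ → ℚ → ℚ → ℚ) → f (M ℚ.* x) (M ℚ.* y) (M ℚ.* z) ≡ f (ℤ→ℚ u) (ℤ→ℚ v) (ℤ→ℚ w)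
      cong₃ f = trans (cong (λ x → f x (M ℚ.* y) (M ℚ.* z)) u≡) (cong₂ (f (ℤ→ℚ u)) v≡ w≡)

      trace-scaled : M ℚ.* Q.trace 0ℚ A B x y z ≡ ℤ→ℚ (Z.trace 0ℤ a (ℤ.- b) u v w)
      trace-scaled = trans (ℚSolver.solve 6 (λ q r x y z m → m ⊗ E.trace (con 0ℤ) q r x y z ,
        E.trace (con 0ℤ) q r (m ⊗ x) (m ⊗ y) (m ⊗ z)) A B x y z M)
        (trans (cong₃ (Q.trace 0ℚ A B)) (sym (image E.trace u v w)))

      minors-scaled : M ℚ.* M ℚ.* Q.minors 0ℚ A B x y z ≡ ℤ→ℚ (Z.minors 0ℤ a (ℤ.- b) u v w)
      minors-scaled = trans (ℚSolver.solve 6 (λ q r x y z m → m ⊗ m ⊗ E.minors (con 0ℤ) q r x y z ,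
        E.minors (con 0ℤ) q r (m ⊗ x) (m ⊗ y) (m ⊗ z)) A B x y z M)
        (trans (cong₃ (Q.minors 0ℚ A B)) (sym (image E.minors u v w)))

      norm-scaled : M ℚ.* M ℚ.* M ℚ.* Q.norm 0ℚ A B x y z ≡ ℤ→ℚ (Z.norm 0ℤ a (ℤ.- b) u v w)
      norm-scaled = trans (ℚSolver.solve 6 (λ q r x y z m → m ⊗ m ⊗ m ⊗ E.norm (con 0ℤ) q r x y z ,
        E.norm (con 0ℤ) q r (m ⊗ x) (m ⊗ y) (m ⊗ z)) A B x y z M)
        (trans (cong₃ (Q.norm 0ℚ A B)) (sym (image E.norm u v w)))

      ℤ→ℚ-neg-* : ∀ c k → ℤ→ℚ (ℤ.- (c ℤ.* k)) ≡ ℤ→ℚ k ℚ.* (ℚ.- ℤ→ℚ c)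
      ℤ→ℚ-neg-* c k = trans (ℤ→ℚ-neg (c ℤ.* k)) (trans (cong ℚ.-_ (ℤ→ℚ-* c k))
        (ℚSolver.solve 2 (λ c k → ⊝ (c ⊗ k) , k ⊗ ⊝ c) (ℤ→ℚ c) (ℤ→ℚ k)))

      ℤ→ℚ-m² : ℤ→ℚ (m ℤ.* m) ≡ M ℚ.* M
      ℤ→ℚ-m² = ℤ→ℚ-* m m

      ℤ→ℚ-m³ : ℤ→ℚ (m ℤ.* m ℤ.* m) ≡ M ℚ.* M ℚ.* M
      ℤ→ℚ-m³ = trans (ℤ→ℚ-* (m ℤ.* m) m) (cong (ℚ._* M) ℤ→ℚ-m²)

      flip-sign : ∀ {x y} → x ≡ ℚ.- y → y ≡ ℚ.- x
      flip-sign {x} {y} x≡-y = trans (ℚSolver.solve 1 (λ y → y , ⊝ (⊝ y)) y) (cong ℚ.-_ (sym x≡-y))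

      M²≢0 : M ℚ.* M ≢ 0ℚ
      M²≢0 = ℚ-*-≢0 M≢0 M≢0

      M³≢0 : M ℚ.* M ℚ.* M ≢ 0ℚ
      M³≢0 = ℚ-*-≢0 M²≢0 M≢0

    module _ {c₀ c₁ c₂ : ℤ} where

      scaled⇒represents :
        ℤ→ℚ c₀ ≡ ℚ.- Q.norm 0ℚ A B x y z → ℤ→ℚ c₁ ≡ Q.minors 0ℚ A B x y z → ℤ→ℚ c₂ ≡ ℚ.- Q.trace 0ℚ A B x y z →
        Represents 0ℤ a (ℤ.- b) c₀ c₁ c₂ u v w m
      scaled⇒represents n≡ s≡ t≡ = represents
        (ℤ→ℚ-injective (begin
          ℤ→ℚ (Z.trace 0ℤ a (ℤ.- b) u v w)  ≡⟨ trace-scaled ⟨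
          M ℚ.* Q.trace 0ℚ A B x y z        ≡⟨ cong (M ℚ.*_) (flip-sign t≡) ⟩
          M ℚ.* (ℚ.- ℤ→ℚ c₂)                ≡⟨ ℤ→ℚ-neg-* c₂ m ⟨
          ℤ→ℚ (ℤ.- (c₂ ℤ.* m))              ∎))
        (ℤ→ℚ-injective (begin
          ℤ→ℚ (Z.minors 0ℤ a (ℤ.- b) u v w)      ≡⟨ minors-scaled ⟨
          M ℚ.* M ℚ.* Q.minors 0ℚ A B x y z      ≡⟨ cong₂ ℚ._*_ ℤ→ℚ-m² s≡ ⟨
          ℤ→ℚ (m ℤ.* m) ℚ.* ℤ→ℚ c₁               ≡⟨ ℚ.*-comm (ℤ→ℚ (m ℤ.* m)) (ℤ→ℚ c₁) ⟩
          ℤ→ℚ c₁ ℚ.* ℤ→ℚ (m ℤ.* m)               ≡⟨ ℤ→ℚ-* c₁ (m ℤ.* m) ⟨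
          ℤ→ℚ (c₁ ℤ.* (m ℤ.* m))                 ∎))
        (ℤ→ℚ-injective (begin
          ℤ→ℚ (Z.norm 0ℤ a (ℤ.- b) u v w)          ≡⟨ norm-scaled ⟨
          M ℚ.* M ℚ.* M ℚ.* Q.norm 0ℚ A B x y z    ≡⟨ cong₂ ℚ._*_ (sym ℤ→ℚ-m³) (flip-sign n≡) ⟩
          ℤ→ℚ (m ℤ.* m ℤ.* m) ℚ.* (ℚ.- ℤ→ℚ c₀)     ≡⟨ ℤ→ℚ-neg-* c₀ (m ℤ.* m ℤ.* m) ⟨
          ℤ→ℚ (ℤ.- (c₀ ℤ.* (m ℤ.* m ℤ.* m)))       ∎))

      represents⇒scaled : Represents 0ℤ a (ℤ.- b) c₀ c₁ c₂ u v w m →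
        ℤ→ℚ c₀ ≡ ℚ.- Q.norm 0ℚ A B x y z × ℤ→ℚ c₁ ≡ Q.minors 0ℚ A B x y z × ℤ→ℚ c₂ ≡ ℚ.- Q.trace 0ℚ A B x y z
      represents⇒scaled (represents t-eq s-eq n-eq) =
        flip-sign (ℚ-cancelˡ (M ℚ.* M ℚ.* M) M³≢0 (begin
          M ℚ.* M ℚ.* M ℚ.* Q.norm 0ℚ A B x y z    ≡⟨ norm-scaled ⟩
          ℤ→ℚ (Z.norm 0ℤ a (ℤ.- b) u v w)          ≡⟨ cong ℤ→ℚ n-eq ⟩
          ℤ→ℚ (ℤ.- (c₀ ℤ.* (m ℤ.* m ℤ.* m)))       ≡⟨ ℤ→ℚ-neg-* c₀ (m ℤ.* m ℤ.* m) ⟩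
          ℤ→ℚ (m ℤ.* m ℤ.* m) ℚ.* (ℚ.- ℤ→ℚ c₀)     ≡⟨ cong (ℚ._* (ℚ.- ℤ→ℚ c₀)) ℤ→ℚ-m³ ⟩
          M ℚ.* M ℚ.* M ℚ.* (ℚ.- ℤ→ℚ c₀)           ∎)) ,
        sym (ℚ-cancelˡ (M ℚ.* M) M²≢0 (begin
          M ℚ.* M ℚ.* Q.minors 0ℚ A B x y z        ≡⟨ minors-scaled ⟩
          ℤ→ℚ (Z.minors 0ℤ a (ℤ.- b) u v w)        ≡⟨ cong ℤ→ℚ s-eq ⟩
          ℤ→ℚ (c₁ ℤ.* (m ℤ.* m))                   ≡⟨ ℤ→ℚ-* c₁ (m ℤ.* m) ⟩
          ℤ→ℚ c₁ ℚ.* ℤ→ℚ (m ℤ.* m)                 ≡⟨ ℚ.*-comm (ℤ→ℚ c₁) (ℤ→ℚ (m ℤ.* m)) ⟩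
          ℤ→ℚ (m ℤ.* m) ℚ.* ℤ→ℚ c₁                 ≡⟨ cong (ℚ._* ℤ→ℚ c₁) ℤ→ℚ-m² ⟩
          M ℚ.* M ℚ.* ℤ→ℚ c₁                       ∎)) ,
        flip-sign (ℚ-cancelˡ M M≢0 (begin
          M ℚ.* Q.trace 0ℚ A B x y z               ≡⟨ trace-scaled ⟩
          ℤ→ℚ (Z.trace 0ℤ a (ℤ.- b) u v w)         ≡⟨ cong ℤ→ℚ t-eq ⟩
          ℤ→ℚ (ℤ.- (c₂ ℤ.* m))                     ≡⟨ ℤ→ℚ-neg-* c₂ m ⟩
          M ℚ.* (ℚ.- ℤ→ℚ c₂)                       ∎))

  common-denominator : ∀ x y z → ∃[ u ] ∃[ v ] ∃[ w ] ∃[ m ] m ≢ 0ℤ × Scaled u v w m x y z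
  common-denominator x y z = go (clear-denominator x) (clear-denominator y) (clear-denominator z)
    where
    go : _ → _ → _ → _
    go (n₀ , d₀ , d₀≢0 , e₀) (n₁ , d₁ , d₁≢0 , e₁) (n₂ , d₂ , d₂≢0 , e₂) =
      n₀ ℤ.* (d₁ ℤ.* d₂) , n₁ ℤ.* (d₀ ℤ.* d₂) , n₂ ℤ.* (d₀ ℤ.* d₁) , d₀ ℤ.* d₁ ℤ.* d₂ ,
      *-≢0 (*-≢0 d₀≢0 d₁≢0) d₂≢0 ,
      scaled
        (lift x n₀ d₀ (d₁ ℤ.* d₂) e₀ (ℤSolver.solve 3 (λ d₀ d₁ d₂ → d₀ ⊗ d₁ ⊗ d₂ , d₀ ⊗ (d₁ ⊗ d₂)) d₀ d₁ d₂))
        (lift y n₁ d₁ (d₀ ℤ.* d₂) e₁ (ℤSolver.solve 3 (λ d₀ d₁ d₂ → d₀ ⊗ d₁ ⊗ d₂ , d₁ ⊗ (d₀ ⊗ d₂)) d₀ d₁ d₂))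
        (lift z n₂ d₂ (d₀ ℤ.* d₁) e₂ (ℤSolver.solve 3 (λ d₀ d₁ d₂ → d₀ ⊗ d₁ ⊗ d₂ , d₂ ⊗ (d₀ ⊗ d₁)) d₀ d₁ d₂))
      where
      lift : ∀ {m} x n d k → ℤ→ℚ d ℚ.* x ≡ ℤ→ℚ n → m ≡ d ℤ.* k → ℤ→ℚ m ℚ.* x ≡ ℤ→ℚ (n ℤ.* k)
      lift x n d k dx≡n refl = begin
        ℤ→ℚ (d ℤ.* k) ℚ.* x         ≡⟨ cong (ℚ._* x) (ℤ→ℚ-* d k) ⟩
        ℤ→ℚ d ℚ.* ℤ→ℚ k ℚ.* x       ≡⟨ ℚSolver.solve 3 (λ d k x → d ⊗ k ⊗ x , d ⊗ x ⊗ k) (ℤ→ℚ d) (ℤ→ℚ k) x ⟩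
        ℤ→ℚ d ℚ.* x ℚ.* ℤ→ℚ k       ≡⟨ cong (ℚ._* ℤ→ℚ k) dx≡n ⟩
        ℤ→ℚ n ℚ.* ℤ→ℚ k             ≡⟨ ℤ→ℚ-* n k ⟨
        ℤ→ℚ (n ℤ.* k)               ∎
        where open ≡-Reasoning

  divide-by : ∀ u v w m → m ≢ 0ℤ → ∃[ x ] ∃[ y ] ∃[ z ] Scaled u v w m x y z
  divide-by u v w m m≢0 = _ , _ , _ , scaled (cancel u) (cancel v) (cancel w)
    where
    M⁻¹ : ℚ
    M⁻¹ = proj₁ (ℚ-inverse (ℤ→ℚ m) (ℤ→ℚ-≢0 m≢0))
    cancel : ∀ u → ℤ→ℚ m ℚ.* (M⁻¹ ℚ.* ℤ→ℚ u) ≡ ℤ→ℚ u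
    cancel u = trans (sym (ℚ.*-assoc (ℤ→ℚ m) M⁻¹ (ℤ→ℚ u)))
      (trans (cong (ℚ._* ℤ→ℚ u) (proj₂ (ℚ-inverse (ℤ→ℚ m) (ℤ→ℚ-≢0 m≢0)))) (ℚ.*-identityˡ (ℤ→ℚ u)))

-- The index of the field as 2^α 3^β.

open import Data.Nat.Base using (_*_; _^_; _<_)

coeff-ℤ→ℚ : ∀ F k → ℚ[X].coeff (ℤ[X]→ℚ[X] F) k ≡ ℤ→ℚ (ℤ[X].coeff F k)
coeff-ℤ→ℚ []      k       = refl
coeff-ℤ→ℚ (c ∷ F) zero    = refl
coeff-ℤ→ℚ (c ∷ F) (suc k) = coeff-ℤ→ℚ F k

∣-prime-multiple : ∀ {p d} m → Prime p → d ℕ.∣ p * m → ¬ (p ℕ.∣ d) → d ℕ.∣ m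
∣-prime-multiple {p} {d} m p-prime (ℕ.divides q pm≡qd) p∤d =
  [ (λ { (ℕ.divides k refl) → ℕ.divides k (ℕ.*-cancelˡ-≡ m (k * d) p {{prime⇒nonZero p-prime}} (begin
      p * m          ≡⟨ pm≡qd ⟩
      k * p * d      ≡⟨ cong (_* d) (ℕ.*-comm k p) ⟩
      p * k * d      ≡⟨ ℕ.*-assoc p k d ⟩
      p * (k * d)    ∎)) }) , (λ p∣d → contradiction p∣d p∤d) ]′
    (euclidsLemma q d p-prime (ℕ.divides m (trans (sym pm≡qd) (ℕ.*-comm p m))))
  where open ≡-Reasoning

2∣∧3∣⇒6∣ : ∀ {m} → 2 ℕ.∣ m → 3 ℕ.∣ m → 6 ℕ.∣ m
2∣∧3∣⇒6∣ (ℕ.divides k refl) 3∣2k = ℕ.*-monoˡ-∣ 2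
  ([ id , (λ 3∣2 → contradiction 3∣2 (toWitnessFalse {a? = 3 ℕ.∣? 2} _)) ]′ (euclidsLemma k 2 prime-3 3∣2k))

-- Matching on it replaces an exponent by 1 or 0 and at the same time hands over the condition or
-- its refutation, so the four cases of 2^α 3^β compute.
Indicates : ∀ {p} → Set p → ℕ → Set p
Indicates P n = (P × n ≡ 1) ⊎ (¬ P × n ≡ 0)

indicator : ∀ {p} {P : Set p} (P? : Dec P) → Indicates P (if does P? then 1 else 0)
indicator (yes p) = inj₁ (p , refl)
indicator (no ¬p) = inj₂ (¬p , refl)

module _ {P Q : Set} {α β : ℕ} where

  ∣2^α3^β : ∀ {d} → Indicates P α → Indicates Q β → d ℕ.∣ 6 → (2 ℕ.∣ d → P) → (3 ℕ.∣ d → Q) → d ℕ.∣ 2 ^ α * 3 ^ β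
  ∣2^α3^β (inj₁ (_ , refl))  (inj₁ (_ , refl))  d∣6 _   _   = d∣6
  ∣2^α3^β (inj₁ (_ , refl))  (inj₂ (¬Q , refl)) d∣6 _   3∣⇒ = ∣-prime-multiple {3} 2 prime-3 d∣6 (¬Q ∘ 3∣⇒)
  ∣2^α3^β (inj₂ (¬P , refl)) (inj₁ (_ , refl))  d∣6 2∣⇒ _   = ∣-prime-multiple {2} 3 prime-2 d∣6 (¬P ∘ 2∣⇒)
  ∣2^α3^β (inj₂ (¬P , refl)) (inj₂ (¬Q , refl)) d∣6 2∣⇒ 3∣⇒ =
    ∣-prime-multiple {2} 1 prime-2 (∣-prime-multiple {3} 2 prime-3 d∣6 (¬Q ∘ 3∣⇒)) (¬P ∘ 2∣⇒)

  2^α3^β∣ : ∀ {m} → Indicates P α → Indicates Q β → (P → 2 ℕ.∣ m) → (Q → 3 ℕ.∣ m) → 2 ^ α * 3 ^ β ℕ.∣ m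
  2^α3^β∣     (inj₁ (p , refl)) (inj₁ (q , refl)) ⇒2∣ ⇒3∣ = 2∣∧3∣⇒6∣ (⇒2∣ p) (⇒3∣ q)
  2^α3^β∣     (inj₁ (p , refl)) (inj₂ (_ , refl)) ⇒2∣ _   = ⇒2∣ p
  2^α3^β∣     (inj₂ (_ , refl)) (inj₁ (q , refl)) _   ⇒3∣ = ⇒3∣ q
  2^α3^β∣ {m} (inj₂ (_ , refl)) (inj₂ (_ , refl)) _   _   = ℕ.1∣ m

module FieldIndex (a b : ℤ)
  (irreducible : ℚ[X].Irreducible (ℤ[X]→ℚ[X] (cubic a b)))
  (minimal : ∀ (p : ℕ) → Prime p → v p a <⁺ [ 2 ] ⊎ v p b <⁺ [ 3 ])
  {c ℓ} (K : NumberField c ℓ) (θ : NumberField.Carrier K)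
  (root : NumberField._≈_ K (evalℤ K (cubic a b) θ) (NumberField.0# K))
  (θ-primitive : IsPrimitive K θ) where

  open NumberField K using (_≈_; 0#; 1#; _+_; -_; _-_; ι; *-cong; +-cong; +-congˡ; +-congʳ; *-congˡ; *-congʳ; -‿cong; reflexive; setoid; commutativeRing)
    renaming (_*_ to _*ᴷ_; sym to ≈-sym; trans to ≈-trans)
  open Scaling a b
  open LinearAlgebra K using (ι-0; ι-1; ι-neg)

  θ³≈ : θ *ᴷ θ *ᴷ θ ≈ ι A *ᴷ θ + ι B
  θ³≈ = begin
    θ *ᴷ θ *ᴷ θ
      ≈⟨ solve 3 (λ t A B → t ⊗ t ⊗ t , (⊝ B ⊕ t ⊗ (⊝ A ⊕ t ⊗ (con 0ℤ ⊕ t ⊗ (con 1ℤ ⊕ t ⊗ con 0ℤ)))) ⊕ (A ⊗ t ⊕ B)) θ (ι A) (ι B) ⟩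
    - ι B + θ *ᴷ (- ι A + θ *ᴷ (0# + θ *ᴷ (1# + θ *ᴷ 0#))) + (ι A *ᴷ θ + ι B)
      ≈⟨ +-congʳ (+-cong (≈-trans (reflexive (cong ι b≡)) (ι-neg B)) (*-congˡ (+-cong (≈-trans (reflexive (cong ι (ℤ→ℚ-neg a))) (ι-neg A))
           (*-congˡ (+-cong ι-0 (*-congˡ (+-congʳ ι-1))))))) ⟨
    evalℤ K (cubic a b) θ + (ι A *ᴷ θ + ι B)
      ≈⟨ +-congʳ root ⟩
    0# + (ι A *ᴷ θ + ι B)
      ≈⟨ CommutativeRing.+-identityˡ commutativeRing _ ⟩
    ι A *ᴷ θ + ι B ∎
    where
    open import Relation.Binary.Reasoning.Setoid setoid
    open Solver commutativeRing using (solve)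
    b≡ : ℤ→ℚ b ≡ ℚ.- B
    b≡ = trans (cong ℤ→ℚ (sym (ℤ.neg-involutive b))) (ℤ→ℚ-neg (ℤ.- b))

  open CubicField K A B (irreducible⇒no-root a b irreducible) θ θ³≈ θ-primitive

  not-both : ∀ {p} → Prime p → 1 < p → ¬ (p ^ᶻ 2 ℤ.∣ a × p ^ᶻ 3 ℤ.∣ b)
  not-both {p} p-prime 1<p (p²∣a , p³∣b) =
    [ (λ v<2 → v-<⇒∤ 1<p {a} {2} v<2 p²∣a) , (λ v<3 → v-<⇒∤ 1<p {b} {3} v<3 p³∣b) ]′ (minimal p p-prime)

  module Upper {z : NumberField.Carrier K} {x₀ x₁ x₂ : ℚ} (z≈ : z ≈ element x₀ x₁ x₂)
    (F : ℤ[X].Poly) (F-charPoly : IsCharPoly K z F) {d : ℕ} (d∣F : ∀ x → d ℕ.∣ ∣ ℤ[X].eval F x ∣) where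

    c₀ c₁ c₂ : ℤ
    c₀ = ℤ[X].coeff F 0
    c₁ = ℤ[X].coeff F 1
    c₂ = ℤ[X].coeff F 2

    coefficient : ∀ k → ℤ→ℚ (ℤ[X].coeff F k) ≡ ℚ[X].coeff (ℚ.- normᶿ x₀ x₁ x₂ ∷ minorsᶿ x₀ x₁ x₂ ∷ ℚ.- traceᶿ x₀ x₁ x₂ ∷ 1ℚ ∷ []) k
    coefficient k = trans (sym (coeff-ℤ→ℚ F k)) (trans (F-charPoly k) (sym (charPoly≈ z≈ k)))

    -- F is determined only coefficientwise and may carry trailing zeros; its values depend on the
    -- coefficients alone.
    F≈ : F ℤ[X].≈ₚ monicCubic c₀ c₁ c₂
    F≈ 0 = refl
    F≈ 1 = refl
    F≈ 2 = refl
    F≈ 3 = ℤ→ℚ-injective (coefficient 3)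
    F≈ (suc (suc (suc (suc k)))) = ℤ→ℚ-injective (coefficient (4 ℕ.+ k))

    d∣values : ∀ x → d ℕ.∣ ∣ ℤ[X].eval (monicCubic c₀ c₁ c₂) x ∣
    d∣values x = subst (λ y → d ℕ.∣ ∣ y ∣)
      (PolynomialEvaluation.eval-cong ℤ.+-*-commutativeRing F (monicCubic c₀ c₁ c₂) x F≈) (d∣F x)

    d∣6 : d ℕ.∣ 6
    d∣6 = gcd-of-values-∣6 c₀ c₁ c₂ d∣values

    represented : ∃[ y₀ ] ∃[ y₁ ] ∃[ y₂ ] ∃[ m ] m ≢ 0ℤ × Represents 0ℤ a (ℤ.- b) c₀ c₁ c₂ y₀ y₁ y₂ m
    represented = go (common-denominator x₀ x₁ x₂)
      where
      go : ∃[ y₀ ] ∃[ y₁ ] ∃[ y₂ ] ∃[ m ] m ≢ 0ℤ × Scaled y₀ y₁ y₂ m x₀ x₁ x₂ →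
        ∃[ y₀ ] ∃[ y₁ ] ∃[ y₂ ] ∃[ m ] m ≢ 0ℤ × Represents 0ℤ a (ℤ.- b) c₀ c₁ c₂ y₀ y₁ y₂ m
      go (y₀ , y₁ , y₂ , m , m≢0 , s) =
        y₀ , y₁ , y₂ , m , m≢0 , scaled⇒represents m≢0 s (coefficient 0) (coefficient 1) (coefficient 2)

    module _ {l : ℕ} (l∣d : l ℕ.∣ d) where

      l∣values : ∀ x → + l ℤ.∣ ℤ[X].eval (monicCubic c₀ c₁ c₂) x
      l∣values x = ℤ.∣ᵤ⇒∣ (ℕ.∣-trans l∣d (d∣values x))

      l∣F0 : + l ℤ.∣ c₀
      l∣F0 = subst (+ l ℤ.∣_) (ℤSolver.solve 3 (λ c₀ c₁ c₂ → monicCubicᵉ c₀ c₁ c₂ (con 0ℤ) , c₀) c₀ c₁ c₂) (l∣values 0ℤ)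

      l∣F1 : + l ℤ.∣ 1ℤ ℤ.+ c₂ ℤ.+ c₁ ℤ.+ c₀
      l∣F1 = subst (+ l ℤ.∣_) (ℤSolver.solve 3 (λ c₀ c₁ c₂ → monicCubicᵉ c₀ c₁ c₂ (con 1ℤ) ,
        con 1ℤ ⊕ c₂ ⊕ c₁ ⊕ c₀) c₀ c₁ c₂) (l∣values 1ℤ)

      l∣F-1 : + l ℤ.∣ ℤ.- 1ℤ ℤ.+ c₂ ℤ.- c₁ ℤ.+ c₀
      l∣F-1 = subst (+ l ℤ.∣_) (ℤSolver.solve 3 (λ c₀ c₁ c₂ → monicCubicᵉ c₀ c₁ c₂ (con (ℤ.- 1ℤ)) ,
        con (ℤ.- 1ℤ) ⊕ c₂ ⊕ ⊝ c₁ ⊕ c₀) c₀ c₁ c₂) (l∣values (ℤ.- 1ℤ))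

    2∣d⇒α : 2 ℕ.∣ d → αCondition a b
    2∣d⇒α 2∣d = let (_ , _ , _ , _ , m≢0 , rep) = represented in
      α-necessary a b (not-both prime-2 (s≤s (s≤s z≤n))) m≢0 rep (l∣F0 2∣d) (l∣F1 2∣d)

    3∣d⇒β : 3 ℕ.∣ d → βCondition a b
    3∣d⇒β 3∣d = let (_ , _ , _ , _ , m≢0 , rep) = represented in
      β-Necessary.β-necessary (l∣F0 3∣d) (l∣F1 3∣d) (l∣F-1 3∣d) a b (not-both prime-3 (s≤s (s≤s z≤n))) m≢0 rep

    d∣index : d ℕ.∣ 2 ^ α a b * 3 ^ β a b
    d∣index = ∣2^α3^β (indicator (αCondition? a b)) (indicator (βCondition? a b)) d∣6 2∣d⇒α 3∣d⇒β

  module LowerBound {l} (W : Witness l a b) {x y z : ℚ}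
    (s : Scaled (Witness.y₀ W) (Witness.y₁ W) (Witness.y₂ W) (Witness.m W) x y z) where

    open Witness W

    F : ℤ[X].Poly
    F = monicCubic c₀ c₁ c₂
    ζ : NumberField.Carrier K
    ζ = element x y z
    χ : ℚ[X].Poly
    χ = ℚ.- normᶿ x y z ∷ minorsᶿ x y z ∷ ℚ.- traceᶿ x y z ∷ 1ℚ ∷ []

    nonzero : ∀ {u x} → u ≢ 0ℤ → ℤ→ℚ m ℚ.* x ≡ ℤ→ℚ u → x ≢ 0ℚ
    nonzero u≢0 mx≡u refl = ℤ→ℚ-≢0 u≢0 (trans (sym mx≡u) (ℚ.*-zeroʳ (ℤ→ℚ m)))

    I≢0 : indexᶿ x y z ≢ 0ℚ
    I≢0 I≡0 = let (y≡0 , z≡0) = cubic-form-anisotropic y z (trans (sym (I≡cubic-form x y z)) I≡0) in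
      [ (λ y₁≢0 → nonzero y₁≢0 (Scaled.v≡ s) y≡0) , (λ y₂≢0 → nonzero y₂≢0 (Scaled.w≡ s) z≡0) ]′ generates

    monic : ℤ[X].Monic F
    monic = 3 , refl , λ { (suc (suc (suc (suc k)))) _ → refl
                         ; zero () ; (suc zero) (s≤s ()) ; (suc (suc zero)) (s≤s (s≤s ()))
                         ; (suc (suc (suc zero))) (s≤s (s≤s (s≤s ()))) }

    -- An index d of ζ has to be exhibited before `multiple` applies, whence the existence of the
    -- gcd of the values. Then l ∣ d because d is the greatest common divisor, and d ∣ k.
    l∣multiple : ∀ k → IsCommonMultipleOfIndices K k → l ℕ.∣ k
    l∣multiple k multiple = go (represents⇒scaled m≢0 s isRepresented) (gcd-of-values-exists c₀ c₁ c₂)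
      where
      go : ℤ→ℚ c₀ ≡ ℚ.- normᶿ x y z × ℤ→ℚ c₁ ≡ minorsᶿ x y z × ℤ→ℚ c₂ ≡ ℚ.- traceᶿ x y z → ∃[ d ] IsGCDOfValues F d → l ℕ.∣ k
      go (n≡ , s≡ , t≡) (d , d∣F , greatest) = ℕ.∣-trans
        (greatest l λ x → ℤ.∣⇒∣ᵤ (l∣values x))
        (multiple ζ (F , monic , subst (λ p → evalℚ K p ζ ≈ 0#) (sym F≡χ) (cayley-hamilton (NumberField.refl K)))
          (element-primitive (NumberField.refl K) I≢0) d
          (F , subst (ℚ[X]._≈ₚ charPoly K ζ) (sym F≡χ) (charPoly≈ (NumberField.refl K)) , d∣F , greatest))
        where
        F≡χ : ℤ[X]→ℚ[X] F ≡ χ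
        F≡χ = cong₂ _∷_ n≡ (cong₂ _∷_ s≡ (cong (_∷ 1ℚ ∷ []) t≡))

  witness-∣ : ∀ {l} → Witness l a b → ∀ m → IsCommonMultipleOfIndices K m → l ℕ.∣ m
  witness-∣ W k multiple = let (x , y , z , s) = divide-by y₀ y₁ y₂ m m≢0 in
    LowerBound.l∣multiple W s k multiple
    where open Witness W

  index-upper : IsCommonMultipleOfIndices K (2 ^ α a b * 3 ^ β a b)
  index-upper z _ _ d (F , F-charPoly , d∣F , _) = from-span (spanning-set z)
    where
    from-span : InSpan z → d ℕ.∣ 2 ^ α a b * 3 ^ β a b
    from-span (inSpan z≈) = Upper.d∣index z≈ F F-charPoly d∣F

  index-∣ : ∀ m → IsCommonMultipleOfIndices K m → 2 ^ α a b * 3 ^ β a b ℕ.∣ m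
  index-∣ m multiple = 2^α3^β∣ (indicator (αCondition? a b)) (indicator (βCondition? a b))
    (λ α-cond → witness-∣ (α-sufficient a b α-cond) m multiple)
    (λ β-cond → witness-∣ (β-sufficient a b β-cond) m multiple)

theorem1p2 : ∀ (a b : ℤ) →
    ℚ[X].Irreducible (ℤ[X]→ℚ[X] (cubic a b)) →
    (∀ (p : ℕ) → Prime p → v p a <⁺ [ 2 ] ⊎ v p b <⁺ [ 3 ]) →
    ∀ {c ℓ} (K : NumberField c ℓ) (θ : NumberField.Carrier K) →
    NumberField._≈_ K (evalℤ K (cubic a b) θ) (NumberField.0# K) →
    IsPrimitive K θ →
    IsFieldIndex K (2 ^ α a b * 3 ^ β a b)
theorem1p2 a b irreducible minimal K θ root θ-primitive = index-upper , index-∣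
  where open FieldIndex a b irreducible minimal K θ root θ-primitive
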